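{- Let $n\geq2$ be an integer. Then $$\frac{\Delta(\Psi_n(x))}{\Delta(\Phi_n(x))}=\begin{cases} \dfrac{2^{\varphi(n)}}{p}&\text{if $n=p^\alpha$ for some prime $p$ and some positive integer $\alpha$};\\ 2^{\varphi(n)}&\text{otherwise}. \end{cases}$$
   Context: $\Phi_n(x)$ is the $n$-th cyclotomic polynomial, $\Delta(f)$ denotes the discriminant of a polynomial $f$, and $\varphi$ is Euler's totient function. The Fibonacci polynomials are defined by $F_1(x)=1$, $F_2(x)=x$, and $F_n(x)=xF_{n-1}(x)+F_{n-2}(x)$ for $n\geq 3$. For $n\geq 2$, the $n$-th fibotomic polynomial $\Psi_n(x)$ is the product of the monic irreducible factors (in $\mathbb{Z}[x]$) of $F_n(x)$ which are not factors of $F_k(x)$ for any $k<n$; equivalently $\Psi_n(x)=\prod_{1\le s\le n,\ \gcd(s,n)=1}\left(x-2i\cos\frac{\pi s}{n}\right)$. -}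

module Defs where

open import Data.Nat as ℕ using (ℕ; zero; suc; _∸_; _≤?_; _<ᵇ_)
open import Data.Nat.Divisibility using (_∣?_)
open import Data.Nat.GCD using (gcd)
open import Data.Integer as ℤ using (ℤ; +_; -[1+_]; +[1+_])
open import Data.Integer.Properties using () renaming (_≟_ to _≟ℤ_)
open import Data.List using (List; []; _∷_; length; _++_; foldr; replicate)
open import Data.Fin using (Fin; zero; suc; punchIn; toℕ)
open import Data.Bool using (Bool; true; false; if_then_else_)
open import Data.Product using (Σ; ∃; _×_; _,_)
open import Data.Sum using (_⊎_)
open import Relation.Nullary using (¬_; yes; no)
open import Relation.Binary.PropositionalEquality using (_≡_)

-- Polynomials over ℤ as coefficient lists, lowest degree first
-- (trailing zeros allowed; equality is taken up to trailing zeros).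

Poly : Set
Poly = List ℤ

norm : Poly → Poly
norm [] = []
norm (a ∷ p) with norm p
... | [] with a ≟ℤ + 0
...   | yes _ = []
...   | no  _ = a ∷ []
norm (a ∷ p) | b ∷ q = a ∷ b ∷ q

infix 4 _≈_
_≈_ : Poly → Poly → Set
p ≈ q = norm p ≡ norm q

infixl 6 _⊕_ _⊖_
infixl 7 _⊛_

_⊕_ : Poly → Poly → Poly
[] ⊕ q = q
(a ∷ p) ⊕ [] = a ∷ p
(a ∷ p) ⊕ (b ∷ q) = (a ℤ.+ b) ∷ (p ⊕ q)

scale : ℤ → Poly → Poly
scale c [] = []
scale c (a ∷ p) = (c ℤ.* a) ∷ scale c p

neg : Poly → Poly
neg = scale (ℤ.- + 1)

_⊖_ : Poly → Poly → Poly
p ⊖ q = p ⊕ neg q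

_⊛_ : Poly → Poly → Poly
[] ⊛ q = []
(a ∷ p) ⊛ q = scale a q ⊕ (+ 0 ∷ (p ⊛ q))

const : ℤ → Poly
const c = c ∷ []

X : Poly
X = + 0 ∷ + 1 ∷ []

monomial : ℤ → ℕ → Poly
monomial c k = replicate k (+ 0) ++ (c ∷ [])

coef : Poly → ℕ → ℤ
coef [] _ = + 0
coef (a ∷ p) zero = a
coef (a ∷ p) (suc k) = coef p k

-- degree (degree of the zero polynomial is taken to be 0)
deg : Poly → ℕ
deg p = length (norm p) ∸ 1

lastℤ : Poly → ℤ
lastℤ [] = + 0
lastℤ (a ∷ []) = a
lastℤ (a ∷ b ∷ p) = lastℤ (b ∷ p)

lc : Poly → ℤ
lc p = lastℤ (norm p)

Monic : Poly → Set
Monic p = lc p ≡ + 1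

derivFrom : ℕ → Poly → Poly
derivFrom i [] = []
derivFrom i (a ∷ p) = (+ i ℤ.* a) ∷ derivFrom (suc i) p

deriv : Poly → Poly
deriv [] = []
deriv (a ∷ p) = derivFrom 1 p

infix 4 _∣ₚ_
_∣ₚ_ : Poly → Poly → Set
a ∣ₚ b = ∃ λ c → a ⊛ c ≈ b

IsUnit : Poly → Set
IsUnit u = (u ≈ const (+ 1)) ⊎ (u ≈ const (ℤ.- + 1))

Irreducible : Poly → Set
Irreducible q = (¬ q ≈ []) × (¬ IsUnit q) ×
  (∀ a b → q ≈ a ⊛ b → IsUnit a ⊎ IsUnit b)

Σᶠ : ∀ {n} → (Fin n → ℤ) → ℤ
Σᶠ {zero} f = + 0
Σᶠ {suc n} f = f zero ℤ.+ Σᶠ {n} (λ i → f (suc i))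

signℕ : ℕ → ℤ
signℕ zero = + 1
signℕ (suc k) = ℤ.- signℕ k

det : ∀ n → (Fin n → Fin n → ℤ) → ℤ
det zero M = + 1
det (suc n) M =
  Σᶠ (λ j → signℕ (toℕ j) ℤ.* M zero j ℤ.* det n (λ r c → M (suc r) (punchIn j c)))

-- entry in column j of the i-th shifted row built from f of degree m
band : Poly → ℕ → ℕ → ℕ → ℤ
band f m i j with i ≤? j
... | no _ = + 0
... | yes _ with (j ∸ i) ≤? m
...   | yes _ = coef f (m ∸ (j ∸ i))
...   | no _ = + 0

sylvester : (f g : Poly) → Fin (deg f ℕ.+ deg g) → Fin (deg f ℕ.+ deg g) → ℤ
sylvester f g r c with toℕ r <ᵇ deg g
... | true = band f (deg f) (toℕ r) (toℕ c)
... | false = band g (deg g) (toℕ r ∸ deg g) (toℕ c)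

resultant : Poly → Poly → ℤ
resultant f g = det (deg f ℕ.+ deg g) (sylvester f g)

-- exact division by the leading coefficient (0 if lc = 0)
divLc : ℤ → ℤ → ℤ
divLc a (+ zero) = + 0
divLc a +[1+ k ] = a ℤ./ +[1+ k ]
divLc a -[1+ k ] = a ℤ./ -[1+ k ]

disc : Poly → ℤ
disc f = divLc (signℕ ((deg f ℕ.* (deg f ∸ 1)) ℕ./ 2) ℤ.* resultant f (deriv f)) (lc f)

-- Cyclotomic polynomials: x^n - 1 = ∏_{d ∣ n} Φ_d

quotFuel : ℕ → Poly → Poly → Poly
quotFuel zero f g = []
quotFuel (suc fuel) f g with norm f
... | [] = []
... | a ∷ f' with length (a ∷ f') ℕ.<ᵇ length (norm g)
...   | true = []
...   | false =
  let t = monomial (lc (a ∷ f')) (deg (a ∷ f') ∸ deg g)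
  in t ⊕ quotFuel fuel ((a ∷ f') ⊖ (t ⊛ g)) g

quotMonic : Poly → Poly → Poly
quotMonic f g = quotFuel (suc (length f)) f g

-- product of the entries at (1-based) positions d of the list with d ∣ m
prodDivisors : ℕ → ℕ → List Poly → Poly
prodDivisors m d [] = const (+ 1)
prodDivisors m d (p ∷ ps) with d ∣? m
... | yes _ = p ⊛ prodDivisors m (suc d) ps
... | no _ = prodDivisors m (suc d) ps

-- cycloTable n = [Φ_1, …, Φ_n]
cycloTable : ℕ → List Poly
cycloTable zero = []
cycloTable (suc n) =
  cycloTable n ++
  (quotMonic (monomial (+ 1) (suc n) ⊖ const (+ 1)) (prodDivisors (suc n) 1 (cycloTable n)) ∷ [])

lastP : List Poly → Poly
lastP [] = const (+ 1)
lastP (p ∷ []) = p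
lastP (p ∷ q ∷ ps) = lastP (q ∷ ps)

-- Φ n  (Φ 0 is a dummy value, never used)
Φ : ℕ → Poly
Φ n = lastP (cycloTable n)

countCoprime : ℕ → ℕ → ℕ
countCoprime n zero = 0
countCoprime n (suc s) with gcd (suc s) n ℕ.≟ 1
... | yes _ = suc (countCoprime n s)
... | no _ = countCoprime n s

φ : ℕ → ℕ
φ n = countCoprime n n

Fib : ℕ → Poly
Fib zero = []
Fib (suc zero) = const (+ 1)
Fib (suc (suc n)) = X ⊛ Fib (suc n) ⊕ Fib n

-- P is the n-th fibotomic polynomial Ψ_n: the product of the (distinct)
-- monic irreducible factors of F_n that are not factors of any F_k, 1 ≤ k < n.

NewFactor : ℕ → Poly → Set
NewFactor n q = q ∣ₚ Fib n × (∀ k → 1 ℕ.≤ k → k ℕ.< n → ¬ (q ∣ₚ Fib k))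

IsFibotomic : ℕ → Poly → Set
IsFibotomic n P =
  Monic P ×
  (∀ q → Monic q → Irreducible q → (q ∣ₚ P → NewFactor n q) × (NewFactor n q → q ∣ₚ P)) ×
  (∀ q → Irreducible q → ¬ (q ⊛ q ∣ₚ P))

{-# OPTIONS --safe #-}
-- For n ≥ 3 write Ψₙ(x) = Gₙ(x²) and let m be the degree of Gₙ. If x = z - z⁻¹ and w = -z², then w + w⁻¹ = -(x² + 2), and
-- Fₙ(x) becomes a power of z times (wⁿ - 1)/(w - 1). So in a ring where Gₙ = ∏ (y - rᵢ²) the roots of Ψₙ are ± rᵢ,
-- while those of Φₙ are wᵢ and wᵢ⁻¹ with hᵢ := wᵢ + wᵢ⁻¹ = -(rᵢ² + 2). The differences between the roots of the i-th and of
-- the j-th pair multiply to (hᵢ - hⱼ)² for both polynomials; within a pair (2 rᵢ)² = -4 (hᵢ + 2) for Ψₙ, and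
-- (wᵢ - wᵢ⁻¹)² = (hᵢ - 2)(hᵢ + 2) for Φₙ. Hence Δ(Ψₙ) ∏ (2 - hᵢ) = 4ᵐ Δ(Φₙ), where 2m = φ(n) and ∏ (2 - hᵢ) = Φₙ(1),
-- which is p or 1 because the Φ_d(1) with 1 < d ∣ n multiply to n.
--
-- The polynomials Ψ_d with Fₙ = ∏_{d ∣ n} Ψ_d exist since F_gcd(m,n) lies in the ideal (Fₘ, Fₙ) and 2n lies in (Fₙ, Fₙ′):
-- distinct Ψ_d are coprime up to an integer, and a monic divisor ignores integers. By Gauss's lemma Ψₙ is the
-- squarefree product of the irreducible factors of Fₙ that divide no earlier Fibonacci polynomial.
module Submission where

open import Algebra.Bundles using (CommutativeRing; CommutativeMonoid)
open import Data.Maybe.Base using (Maybe; just; nothing)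
open import Level using (0ℓ)
open import Data.Nat as ℕ using (ℕ; zero; suc; z≤n; s≤s; z<s; s<s; _∸_; ⌊_/2⌋)
import Data.Nat.Properties as ℕP
open import Data.Integer as ℤ using (ℤ; +_; -[1+_])
import Data.Integer.Properties as ℤP
open import Data.Fin as Fin using (Fin; toℕ; punchIn)
open import Data.Integer.DivMod using (a≡a%n+[a/n]*n; n%d<d)
open import Data.Bool using (Bool; true; false; T; if_then_else_; not)
open import Data.Bool.Properties using (not-involutive)
open import Data.List using (List; []; _∷_; length; map; foldr; _++_)
import Data.List.Properties as ListP
open import Data.List.Relation.Unary.All as All using (All; []; _∷_)
open import Data.Product using (Σ; ∃; _×_; _,_; proj₁; proj₂)
open import Data.Sum using (_⊎_; inj₁; inj₂; [_,_]′)
open import Data.Empty using (⊥; ⊥-elim)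
open import Relation.Nullary using (¬_; Dec; yes; no)
open import Relation.Binary.Definitions using (tri<; tri≈; tri>)
import Relation.Binary.PropositionalEquality as ≡
import Defs
open import Data.Nat.Divisibility using (_∣_; _∣?_; ∣-refl; ∣-trans; ∣⇒≤; divides; _∣0; ∣m∣n⇒∣m+n; ∣m+n∣m⇒∣n; ∣1⇒≡1)
open import Data.Integer.Divisibility.Signed using (∣⇒∣ᵤ; ∣ᵤ⇒∣) renaming (_∣_ to _∣ℤ_; _∣?_ to _∣?ℤ_; divides to dividesℤ; ∣m+n∣m⇒∣n to ∣m+n∣m⇒∣nℤ; ∣m⇒∣m*n to ∣m⇒∣m*nℤ; ∣-refl to ∣-reflℤ)
open import Relation.Nullary.Decidable using (decidable-stable)
open import Data.Nat.Primality using (Prime; prime[2]; euclidsLemma; prime⇒irreducible; prime⇒nonZero; prime⇒nonTrivial)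
open import Data.Nat.Primality.Factorisation using (factorise)
open import Data.Nat.Coprimality using (Coprime; coprime-divisor)
open import Data.Nat.Solver using (module +-*-Solver)
module NS = +-*-Solver
import Data.Nat.ListAction as ListN
open import Data.Nat.GCD using (gcd; gcd[m,n]∣m; gcd[m,n]∣n; c*gcd[m,n]≡gcd[cm,cn])
open ≡ using (_≡_; _≢_)

-- The roots have to be constructed. They are adjoined in quotients R[x]/(f) by a monic f, which in
-- general are neither fields nor domains. This does no harm: the relation between the two
-- resultants is a polynomial identity in the roots, proved without cancellation, and the map from ℤ
-- into the extension is injective. Splitting G, rather than Ψ and Φ separately, yields the roots of
-- both in matching pairs. Since Ψ and Φ have equal degree, the signs in their discriminants agree
-- and only Res(p, p′) has to be compared. The G are computed by successive divisions, just as the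
-- cyclotomic polynomials are, so exactness of these divisions needs a strong induction on n. In
-- ℤ[x] coprime polynomials need not satisfy a Bézout identity with 1; hence the ideals in which a
-- nonzero integer is sought. That 2m = φ(n) follows by comparing divisor sums. Irreducible factors
-- are found only up to double negation, which the decidable equality of coefficients removes at the
-- end. The index 2 stands apart, as Ψ₂ = x and Φ₂ = x + 1 are linear.

module RingKit (R : CommutativeRing 0ℓ 0ℓ) where
  open CommutativeRing R public hiding (zero)
  open import Algebra.Properties.Ring ring public using (-‿distribˡ-*; -‿distribʳ-*; -‿involutive; -0#≈0#; -1*x≈-x; x+x≈x⇒x≈0)
  open import Algebra.Properties.AbelianGroup +-abelianGroup using (⁻¹-∙-comm)
  open import Algebra.Properties.Monoid.Mult.TCOptimised +-monoid using (×-homo-+; 1+×)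
    renaming (_×_ to _×′_)
  open import Algebra.Properties.Semiring.Mult.TCOptimised semiring using (×1-homo-*)
  open import Relation.Binary.Reasoning.Setoid setoid public
  open import Algebra.Solver.Ring.AlmostCommutativeRing

  -- It lets the ring solver use integer literals in every ring. With the optimised multiple `_×′_`,
  -- the images of 0, 1 and 2 reduce to `0#`, `1#` and `1# + 1#`, on which later steps rely.
  fromℤ : ℤ → Carrier
  fromℤ (+ n) = n ×′ 1#
  fromℤ -[1+ n ] = - (suc n ×′ 1#)

  private
    [x+y]-[x+z] : ∀ x y z → (x + y) - (x + z) ≈ y - z
    [x+y]-[x+z] x y z = begin
      (x + y) - (x + z) ≈⟨ +-congˡ (⁻¹-∙-comm x z) ⟨
      (x + y) + (- x - z) ≈⟨ +-congʳ (+-comm x y) ⟩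
      (y + x) + (- x - z) ≈⟨ +-assoc y x _ ⟩
      y + (x + (- x - z)) ≈⟨ +-congˡ (+-assoc x (- x) (- z)) ⟨
      y + ((x - x) - z) ≈⟨ +-congˡ (+-congʳ (-‿inverseʳ x)) ⟩
      y + (0# - z) ≈⟨ +-congˡ (+-identityˡ _) ⟩
      y - z ∎

  fromℤ-⊖ : ∀ m n → fromℤ (m ℤ.⊖ n) ≈ m ×′ 1# - n ×′ 1#
  fromℤ-⊖ zero zero = sym (-‿inverseʳ 0#)
  fromℤ-⊖ (suc m) zero = sym (trans (+-congˡ -0#≈0#) (+-identityʳ _))
  fromℤ-⊖ zero (suc n) = sym (+-identityˡ _)
  fromℤ-⊖ (suc m) (suc n) = begin
    fromℤ (suc m ℤ.⊖ suc n) ≡⟨ ≡.cong fromℤ (ℤP.[1+m]⊖[1+n]≡m⊖n m n) ⟩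
    fromℤ (m ℤ.⊖ n) ≈⟨ fromℤ-⊖ m n ⟩
    m ×′ 1# - n ×′ 1# ≈⟨ [x+y]-[x+z] 1# _ _ ⟨
    (1# + m ×′ 1#) - (1# + n ×′ 1#) ≈⟨ +-cong (1+× m 1#) (-‿cong (1+× n 1#)) ⟨
    suc m ×′ 1# - suc n ×′ 1# ∎

  fromℤ-+ : ∀ i j → fromℤ (i ℤ.+ j) ≈ fromℤ i + fromℤ j
  fromℤ-+ (+ m) (+ n) = ×-homo-+ 1# m n
  fromℤ-+ (+ m) -[1+ n ] = fromℤ-⊖ m (suc n)
  fromℤ-+ -[1+ m ] (+ n) = trans (fromℤ-⊖ n (suc m)) (+-comm _ _)
  fromℤ-+ -[1+ m ] -[1+ n ] = begin
    - (suc (suc (m ℕ.+ n)) ×′ 1#) ≡⟨ ≡.cong (λ k → - (suc k ×′ 1#)) (ℕP.+-suc m n) ⟨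
    - ((suc m ℕ.+ suc n) ×′ 1#) ≈⟨ -‿cong (×-homo-+ 1# (suc m) (suc n)) ⟩
    - (suc m ×′ 1# + suc n ×′ 1#) ≈⟨ ⁻¹-∙-comm _ _ ⟨
    - (suc m ×′ 1#) - suc n ×′ 1# ∎

  fromℤ-neg : ∀ i → fromℤ (ℤ.- i) ≈ - fromℤ i
  fromℤ-neg (+ zero) = sym -0#≈0#
  fromℤ-neg (+ suc n) = refl
  fromℤ-neg -[1+ n ] = sym (-‿involutive _)

  private
    fromℤ-*⁺ : ∀ m n → fromℤ (+ m ℤ.* + n) ≈ fromℤ (+ m) * fromℤ (+ n)
    fromℤ-*⁺ m n = trans (reflexive (≡.cong fromℤ (≡.sym (ℤP.pos-* m n)))) (×1-homo-* m n)

    fromℤ-*ⁿ : ∀ m j → fromℤ (+ m ℤ.* j) ≈ fromℤ (+ m) * fromℤ j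
    fromℤ-*ⁿ m (+ n) = fromℤ-*⁺ m n
    fromℤ-*ⁿ m -[1+ n ] = begin
      fromℤ (+ m ℤ.* -[1+ n ]) ≡⟨ ≡.cong fromℤ (≡.sym (ℤP.neg-distribʳ-* (+ m) (+ suc n))) ⟩
      fromℤ (ℤ.- (+ m ℤ.* + suc n)) ≈⟨ fromℤ-neg (+ m ℤ.* + suc n) ⟩
      - fromℤ (+ m ℤ.* + suc n) ≈⟨ -‿cong (fromℤ-*⁺ m (suc n)) ⟩
      - (m ×′ 1# * (suc n ×′ 1#)) ≈⟨ -‿distribʳ-* _ _ ⟩
      m ×′ 1# * - (suc n ×′ 1#) ∎

  fromℤ-* : ∀ i j → fromℤ (i ℤ.* j) ≈ fromℤ i * fromℤ j
  fromℤ-* (+ m) j = fromℤ-*ⁿ m j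
  fromℤ-* -[1+ m ] j = begin
    fromℤ (-[1+ m ] ℤ.* j) ≡⟨ ≡.cong fromℤ (≡.sym (ℤP.neg-distribˡ-* (+ suc m) j)) ⟩
    fromℤ (ℤ.- (+ suc m ℤ.* j)) ≈⟨ fromℤ-neg (+ suc m ℤ.* j) ⟩
    - fromℤ (+ suc m ℤ.* j) ≈⟨ -‿cong (fromℤ-*ⁿ (suc m) j) ⟩
    - (suc m ×′ 1# * fromℤ j) ≈⟨ -‿distribˡ-* _ _ ⟩
    - (suc m ×′ 1#) * fromℤ j ∎

  private
    almost = fromCommutativeRing R
    morphism : ℤ.+-*-rawRing -Raw-AlmostCommutative⟶ almost
    morphism = record
      { ⟦_⟧ = fromℤ ; +-homo = fromℤ-+ ; *-homo = fromℤ-* ; -‿homo = fromℤ-neg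
      ; 0-homo = refl ; 1-homo = refl }
    coeff≟ : ∀ i j → Maybe (fromℤ i ≈ fromℤ j)
    coeff≟ i j with i ℤP.≟ j
    ... | yes i≡j = just (reflexive (≡.cong fromℤ i≡j))
    ... | no _ = nothing

  open import Algebra.Solver.Ring ℤ.+-*-rawRing almost morphism coeff≟ public
    using (solve; _:+_; _:*_; _:-_; :-_; _:=_; con)

-- Determinants

-- The counterpart of `punchIn` on ℕ. With natural numbers as indices a matrix is a function on all
-- of ℕ × ℕ, and its size enters only through `det`.
skip : ℕ → ℕ → ℕ
skip zero c = suc c
skip (suc j) zero = zero
skip (suc j) (suc c) = suc (skip j c)

skip-≤ : ∀ {j k} → k ℕ.≤ j → skip (suc j) k ≡ k
skip-≤ {j} {zero} _ = ≡.refl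
skip-≤ {suc j} {suc k} (s≤s p) = ≡.cong suc (skip-≤ p)

skip-≥ : ∀ {j k} → j ℕ.≤ k → skip j k ≡ suc k
skip-≥ {zero} _ = ≡.refl
skip-≥ {suc j} {suc k} (s≤s p) = ≡.cong suc (skip-≥ p)

-- The simplicial identity for face maps; it matches the two orders of deleting a pair of columns in
-- `det-equal-rows`.
skip-skip : ∀ {j k} → k ℕ.≤ j → ∀ c → skip (suc j) (skip k c) ≡ skip k (skip j c)
skip-skip {j} {zero} _ c = ≡.refl
skip-skip {suc j} {suc k} (s≤s p) zero = ≡.refl
skip-skip {suc j} {suc k} (s≤s p) (suc c) = ≡.cong suc (skip-skip p c)

skip-< : ∀ j {c n} → c ℕ.< n → skip j c ℕ.< suc n
skip-< zero p = s<s p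
skip-< (suc j) {zero} {suc n} p = z<s
skip-< (suc j) {suc c} {suc n} (s≤s p) = s<s (skip-< j p)

skip-injective : ∀ j {c d} → skip j c ≡ skip j d → c ≡ d
skip-injective zero ≡.refl = ≡.refl
skip-injective (suc j) {zero} {zero} _ = ≡.refl
skip-injective (suc j) {suc c} {suc d} e = ≡.cong suc (skip-injective j (ℕP.suc-injective e))

skip-≢ : ∀ j c → skip j c ≢ j
skip-≢ (suc j) (suc c) e = skip-≢ j c (ℕP.suc-injective e)

unskip : ∀ j k → k ≡ j ⊎ ∃ λ k′ → skip j k′ ≡ k
unskip zero zero = inj₁ ≡.refl
unskip zero (suc k) = inj₂ (k , ≡.refl)
unskip (suc j) zero = inj₂ (zero , ≡.refl)
unskip (suc j) (suc k) with unskip j k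
... | inj₁ e = inj₁ (≡.cong suc e)
... | inj₂ (k′ , e) = inj₂ (suc k′ , ≡.cong suc e)

-- Deleting any other column leaves columns k and k + 1 adjacent, as the induction in
-- `det-equal-columns` requires.
unskip-adjacent : ∀ j k {n} → j ℕ.< suc n → suc k ℕ.< suc n →
  k ≡ j ⊎ suc k ≡ j ⊎ ∃ λ k′ → skip j k′ ≡ k × skip j (suc k′) ≡ suc k × suc k′ ℕ.< n
unskip-adjacent zero zero _ _ = inj₁ ≡.refl
unskip-adjacent zero (suc k) _ (s≤s p) = inj₂ (inj₂ (k , ≡.refl , ≡.refl , p))
unskip-adjacent (suc zero) zero _ _ = inj₂ (inj₁ ≡.refl)
unskip-adjacent (suc (suc j)) zero {suc zero} (s≤s (s≤s ())) _
unskip-adjacent (suc (suc j)) zero {suc (suc n)} _ _ = inj₂ (inj₂ (zero , ≡.refl , ≡.refl , s<s z<s))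
unskip-adjacent (suc j) (suc k) {suc n} (s≤s q) (s≤s p) with unskip-adjacent j k q p
... | inj₁ e = inj₁ (≡.cong suc e)
... | inj₂ (inj₁ e) = inj₂ (inj₁ (≡.cong suc e))
... | inj₂ (inj₂ (k′ , e , e′ , q)) = inj₂ (inj₂ (suc k′ , ≡.cong suc e , ≡.cong suc e′ , s<s q))

skip-suc : ∀ k c → (skip k c ≡ skip (suc k) c) ⊎ (skip k c ≡ suc k × skip (suc k) c ≡ k)
skip-suc zero zero = inj₂ (≡.refl , ≡.refl)
skip-suc zero (suc c) = inj₁ ≡.refl
skip-suc (suc k) zero = inj₁ ≡.refl
skip-suc (suc k) (suc c) with skip-suc k c
... | inj₁ e = inj₁ (≡.cong suc e)
... | inj₂ (e , e′) = inj₂ (≡.cong suc e , ≡.cong suc e′)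

-- The test r < k, by recursion on both indices, so that it computes on constructors without a
-- decision procedure.
pick : {A : Set} → ℕ → ℕ → A → A → A
pick r zero x y = y
pick zero (suc k) x y = x
pick (suc r) (suc k) x y = pick r k x y

pick-< : {A : Set} {x y : A} {r k : ℕ} → r ℕ.< k → pick r k x y ≡ x
pick-< {r = zero} {suc k} _ = ≡.refl
pick-< {r = suc r} {suc k} (s≤s p) = pick-< p

pick-≥ : {A : Set} {x y : A} {r k : ℕ} → k ℕ.≤ r → pick r k x y ≡ y
pick-≥ {r = r} {zero} _ = ≡.refl
pick-≥ {r = suc r} {suc k} (s≤s p) = pick-≥ p

pick-≢ : {A : Set} {x y : A} {r k : ℕ} → r ≢ k → pick r (suc k) x y ≡ pick r k x y
pick-≢ {r = r} {k} r≢k with ℕP.<-cmp r k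
... | tri< r<k _ _ = ≡.trans (pick-< (ℕP.m<n⇒m<1+n r<k)) (≡.sym (pick-< r<k))
... | tri≈ _ e _ = ⊥-elim (r≢k e)
... | tri> _ _ k<r = ≡.trans (pick-≥ k<r) (≡.sym (pick-≥ (ℕP.<⇒≤ k<r)))


module Determinants (R : CommutativeRing 0ℓ 0ℓ) where
  open RingKit R

  Matrix : Set
  Matrix = ℕ → ℕ → Carrier

  opaque
    ∑ : ℕ → (ℕ → Carrier) → Carrier
    ∑ zero f = 0#
    ∑ (suc n) f = f 0 + ∑ n (λ i → f (suc i))

    ∑-cong : ∀ n {f g} → (∀ i → i ℕ.< n → f i ≈ g i) → ∑ n f ≈ ∑ n g
    ∑-cong zero e = refl
    ∑-cong (suc n) e = +-cong (e 0 z<s) (∑-cong n λ i p → e (suc i) (s<s p))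

    ∑-zero : ∀ n {f} → (∀ i → i ℕ.< n → f i ≈ 0#) → ∑ n f ≈ 0#
    ∑-zero zero e = refl
    ∑-zero (suc n) e = trans (+-cong (e 0 z<s) (∑-zero n λ i p → e (suc i) (s<s p))) (+-identityˡ _)

    ∑-linear : ∀ n t f g → ∑ n (λ i → f i + t * g i) ≈ ∑ n f + t * ∑ n g
    ∑-linear zero t f g = solve 1 (λ t → con (+ 0) := con (+ 0) :+ t :* con (+ 0)) refl t
    ∑-linear (suc n) t f g = trans (+-congˡ (∑-linear n t _ _))
      (solve 5 (λ t a b s u → (a :+ t :* b) :+ (s :+ t :* u) := (a :+ s) :+ t :* (b :+ u)) refl
        t (f 0) (g 0) _ _)

    ∑-* : ∀ n t f → t * ∑ n f ≈ ∑ n (λ i → t * f i)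
    ∑-* zero t f = zeroʳ t
    ∑-* (suc n) t f = trans (distribˡ t _ _) (+-congˡ (∑-* n t _))

    ∑-last : ∀ n f → ∑ (suc n) f ≈ ∑ n f + f n
    ∑-last zero f = +-comm _ _
    ∑-last (suc n) f = trans (+-congˡ (∑-last n _)) (sym (+-assoc _ _ _))

    ∑-cancelling-pair : ∀ n k f → suc k ℕ.< n → (∀ i → i ℕ.< n → k ≢ i → suc k ≢ i → f i ≈ 0#) →
      f k + f (suc k) ≈ 0# → ∑ n f ≈ 0#
    ∑-cancelling-pair (suc (suc n)) zero f _ z e = begin
      f 0 + (f 1 + ∑ n _) ≈⟨ +-assoc _ _ _ ⟨
      f 0 + f 1 + ∑ n _ ≈⟨ +-cong e (∑-zero n λ i i<n → z (suc (suc i)) (s<s (s<s i<n)) (λ ()) (λ ())) ⟩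
      0# + 0# ≈⟨ +-identityˡ _ ⟩
      0# ∎
    ∑-cancelling-pair (suc n) (suc k) f (s≤s p) z e = trans
      (+-cong (z 0 z<s (λ ()) (λ ()))
        (∑-cancelling-pair n k _ p
          (λ i i<n h h′ → z (suc i) (s<s i<n) (λ q → h (ℕP.suc-injective q)) (λ q → h′ (ℕP.suc-injective q))) e))
      (+-identityˡ _)

    -- The index pairs are matched by (j + 1, k) ↔ (k, j) for k ≤ j and each match cancels. Nothing
    -- is divided by 2, so characteristic 2 is covered.
    ∑∑-antisymmetric : ∀ n (f : ℕ → ℕ → Carrier) → (∀ j k → k ℕ.≤ j → f (suc j) k ≈ - f k j) →
      ∑ (suc n) (λ j → ∑ n (f j)) ≈ 0#
    ∑∑-antisymmetric zero f h = +-identityˡ 0#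
    ∑∑-antisymmetric (suc n) f h = begin
      top + ∑ (suc n) (λ j → f (suc j) 0 + lower j)
        ≈⟨ +-congˡ (∑-cong (suc n) {g = λ j → - 1# * f 0 j + 1# * lower j} λ j _ →
             +-cong (trans (h j 0 z≤n) (sym (-1*x≈-x _))) (sym (*-identityˡ (lower j)))) ⟩
      top + ∑ (suc n) (λ j → - 1# * f 0 j + 1# * lower j)
        ≈⟨ +-congˡ (∑-linear (suc n) 1# (λ j → - 1# * f 0 j) lower) ⟩
      top + (∑ (suc n) (λ j → - 1# * f 0 j) + 1# * ∑ (suc n) lower)
        ≈⟨ +-congˡ (+-cong (sym (∑-* (suc n) (- 1#) (f 0)))
             (*-congˡ (∑∑-antisymmetric n (λ j k → f (suc j) (suc k)) λ j k p → h (suc j) (suc k) (s≤s p)))) ⟩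
      top + (- 1# * top + 1# * 0#)
        ≈⟨ solve 1 (λ s → s :+ (:- con (+ 1) :* s :+ con (+ 1) :* con (+ 0)) := con (+ 0)) refl top ⟩
      0# ∎
      where
      top : Carrier
      top = ∑ (suc n) (f 0)
      lower : ℕ → Carrier
      lower j = ∑ n (λ k → f (suc j) (suc k))

    ∑-one : ∀ f → ∑ 1 f ≈ f 0
    ∑-one f = +-identityʳ (f 0)

  sgn : ℕ → Carrier
  sgn zero = 1#
  sgn (suc k) = - sgn k

  minor : ℕ → Matrix → Matrix
  minor j M r c = M (suc r) (skip j c)

  opaque
    det : ℕ → Matrix → Carrier
    det zero M = 1#
    det (suc n) M = ∑ (suc n) (λ j → sgn j * M 0 j * det n (minor j M))

    det-empty : ∀ M → det 0 M ≈ 1#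
    det-empty M = refl

    det-cong : ∀ n {M M′} → (∀ r c → r ℕ.< n → c ℕ.< n → M r c ≈ M′ r c) → det n M ≈ det n M′
    det-cong zero e = refl
    det-cong (suc n) e = ∑-cong (suc n) λ j p →
      *-cong (*-congˡ (e 0 j z<s p)) (det-cong n λ r c q q′ → e (suc r) (skip j c) (s<s q) (skip-< j q′))

    det-row-linear : ∀ n k t {A B C} → k ℕ.< n → (∀ r c → r ≢ k → A r c ≈ B r c) →
      (∀ r c → r ≢ k → A r c ≈ C r c) → (∀ c → A k c ≈ B k c + t * C k c) →
      det n A ≈ det n B + t * det n C
    det-row-linear (suc n) zero t {A} {B} {C} _ b c l = trans
      (∑-cong (suc n) λ j _ → begin
        sgn j * A 0 j * det n (minor j A) ≈⟨ *-congʳ (*-congˡ (l j)) ⟩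
        sgn j * (B 0 j + t * C 0 j) * det n (minor j A)
          ≈⟨ solve 5 (λ s x t y d → s :* (x :+ t :* y) :* d := s :* x :* d :+ t :* (s :* y :* d)) refl (sgn j)
              (B 0 j) t (C 0 j) _ ⟩
        sgn j * B 0 j * det n (minor j A) + t * (sgn j * C 0 j * det n (minor j A))
          ≈⟨ +-cong (*-congˡ (det-cong n λ r _ _ _ → b (suc r) _ λ ()))
              (*-congˡ (*-congˡ (det-cong n λ r _ _ _ → c (suc r) _ λ ()))) ⟩
        sgn j * B 0 j * det n (minor j B) + t * (sgn j * C 0 j * det n (minor j C)) ∎)
      (∑-linear (suc n) t _ _)
    det-row-linear (suc n) (suc k) t {A} {B} {C} (s≤s p) b c l = trans
      (∑-cong (suc n) λ j _ → begin
        sgn j * A 0 j * det n (minor j A)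
          ≈⟨ *-congˡ (det-row-linear n k t p
               (λ r c′ h → b (suc r) _ λ e → h (ℕP.suc-injective e))
               (λ r c′ h → c (suc r) _ λ e → h (ℕP.suc-injective e)) (λ c′ → l _)) ⟩
        sgn j * A 0 j * (det n (minor j B) + t * det n (minor j C))
          ≈⟨ solve 5 (λ s a x t y → s :* a :* (x :+ t :* y) := s :* a :* x :+ t :* (s :* a :* y)) refl (sgn j)
              (A 0 j) _ t _ ⟩
        sgn j * A 0 j * det n (minor j B) + t * (sgn j * A 0 j * det n (minor j C))
          ≈⟨ +-cong (*-congʳ (*-congˡ (b 0 j λ ()))) (*-congˡ (*-congʳ (*-congˡ (c 0 j λ ())))) ⟩
        sgn j * B 0 j * det n (minor j B) + t * (sgn j * C 0 j * det n (minor j C)) ∎)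
      (∑-linear (suc n) t _ _)

    -- Lower rows are reached through minors. For the top two rows, expand along both: exchanging
    -- the two deleted columns reverses the sign of the term.
    det-equal-rows : ∀ n k {M} → suc k ℕ.< n → (∀ c → M k c ≈ M (suc k) c) → det n M ≈ 0#
    det-equal-rows (suc n) (suc k) {M} (s≤s p) e = ∑-zero (suc n) λ j _ →
      trans (*-congˡ (det-equal-rows n k p λ c → e _)) (zeroʳ _)
    det-equal-rows (suc zero) zero (s≤s ()) _
    det-equal-rows (suc (suc n)) zero {M} _ e = trans
      (∑-cong (suc (suc n)) λ j _ → ∑-* (suc n) _ _)
      (∑∑-antisymmetric (suc n) f antisymmetric)
      where
      f : ℕ → ℕ → Carrier
      f j k = sgn j * M 0 j * (sgn k * M 1 (skip j k) * det n (minor k (minor j M)))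
      antisymmetric : ∀ j k → k ℕ.≤ j → f (suc j) k ≈ - f k j
      antisymmetric j k k≤j = begin
        - sgn j * M 0 (suc j) * (sgn k * M 1 (skip (suc j) k) * det n (minor k (minor (suc j) M)))
          ≈⟨ *-cong (*-congˡ (e (suc j)))
              (*-cong (*-congˡ (trans (reflexive (≡.cong (M 1) (skip-≤ k≤j))) (sym (e k))))
               (det-cong n λ r c _ _ → reflexive (≡.cong (M (suc (suc r))) (skip-skip k≤j c)))) ⟩
        - sgn j * M 1 (suc j) * (sgn k * M 0 k * det n (minor j (minor k M)))
          ≈⟨ solve 5 (λ s a t b d → :- s :* a :* (t :* b :* d) := :- (t :* b :* (s :* a :* d))) refl (sgn j)
              (M 1 (suc j)) (sgn k) (M 0 k) _ ⟩
        - (sgn k * M 0 k * (sgn j * M 1 (suc j) * det n (minor j (minor k M))))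
          ≡⟨ ≡.cong (λ i → - (sgn k * M 0 k * (sgn j * M 1 i * det n (minor j (minor k M))))) (skip-≥ k≤j) ⟨
        - f k j ∎

    det-column-linear : ∀ n k t {A B C} → (∀ r c → c ≢ k → A r c ≈ B r c) →
      (∀ r c → c ≢ k → A r c ≈ C r c) → (∀ r → A r k ≈ B r k + t * C r k) → k ℕ.< n →
      det n A ≈ det n B + t * det n C
    det-column-linear (suc n) k t {A} {B} {C} b c l k<n = trans (∑-cong (suc n) term) (∑-linear (suc n) t _ _)
      where
      term : ∀ j → j ℕ.< suc n → sgn j * A 0 j * det n (minor j A) ≈
        sgn j * B 0 j * det n (minor j B) + t * (sgn j * C 0 j * det n (minor j C))
      term j j<n with unskip j k
      ... | inj₁ ≡.refl = begin
        sgn j * A 0 j * det n (minor j A) ≈⟨ *-congʳ (*-congˡ (l 0)) ⟩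
        sgn j * (B 0 j + t * C 0 j) * det n (minor j A)
          ≈⟨ solve 5 (λ s x t y d → s :* (x :+ t :* y) :* d := s :* x :* d :+ t :* (s :* y :* d)) refl (sgn j)
              (B 0 j) t (C 0 j) _ ⟩
        sgn j * B 0 j * det n (minor j A) + t * (sgn j * C 0 j * det n (minor j A))
          ≈⟨ +-cong (*-congˡ (det-cong n λ r c′ _ _ → b (suc r) _ (skip-≢ j c′)))
              (*-congˡ (*-congˡ (det-cong n λ r c′ _ _ → c (suc r) _ (skip-≢ j c′)))) ⟩
        sgn j * B 0 j * det n (minor j B) + t * (sgn j * C 0 j * det n (minor j C)) ∎
      ... | inj₂ (k′ , ≡.refl) = begin
        sgn j * A 0 j * det n (minor j A)
          ≈⟨ *-congˡ (det-column-linear n k′ t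
               (λ r c′ h → b (suc r) _ λ e → h (skip-injective j e))
               (λ r c′ h → c (suc r) _ λ e → h (skip-injective j e)) (λ r → l _)
               (unskip-< j k′ j<n k<n)) ⟩
        sgn j * A 0 j * (det n (minor j B) + t * det n (minor j C))
          ≈⟨ solve 5 (λ s a x t y → s :* a :* (x :+ t :* y) := s :* a :* x :+ t :* (s :* a :* y)) refl (sgn j)
              (A 0 j) _ t _ ⟩
        sgn j * A 0 j * det n (minor j B) + t * (sgn j * A 0 j * det n (minor j C))
          ≈⟨ +-cong (*-congʳ (*-congˡ (b 0 j λ e → skip-≢ j k′ (≡.sym e))))
              (*-congˡ (*-congʳ (*-congˡ (c 0 j λ e → skip-≢ j k′ (≡.sym e))))) ⟩
        sgn j * B 0 j * det n (minor j B) + t * (sgn j * C 0 j * det n (minor j C)) ∎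
        where
        unskip-< : ∀ j k {n} → j ℕ.< suc n → skip j k ℕ.< suc n → k ℕ.< n
        unskip-< zero k _ (s≤s p) = p
        unskip-< (suc j) zero {suc n} _ _ = z<s
        unskip-< (suc zero) zero {zero} (s≤s ()) _
        unskip-< (suc j) (suc k) {suc n} (s≤s q) (s≤s p) = s<s (unskip-< j k q p)

    -- In the expansion along the first row only the terms of columns k and k + 1 survive; their
    -- minors agree and their signs are opposite.
    det-equal-columns : ∀ n k {M} → suc k ℕ.< n → (∀ r → M r k ≈ M r (suc k)) → det n M ≈ 0#
    det-equal-columns (suc n) k {M} k<n e = ∑-cancelling-pair (suc n) k _ k<n other pair
      where
      other : ∀ j → j ℕ.< suc n → k ≢ j → suc k ≢ j → sgn j * M 0 j * det n (minor j M) ≈ 0#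
      other j j<n h h′ with unskip-adjacent j k j<n k<n
      ... | inj₁ q = ⊥-elim (h q)
      ... | inj₂ (inj₁ q) = ⊥-elim (h′ q)
      ... | inj₂ (inj₂ (k′ , p , p′ , lt)) = trans (*-congˡ (det-equal-columns n k′ lt λ r →
        trans (reflexive (≡.cong (M (suc r)) p)) (trans (e (suc r)) (reflexive (≡.cong (M (suc r)) (≡.sym p′))))))
            (zeroʳ _)
      minors : ∀ r c → M (suc r) (skip k c) ≈ M (suc r) (skip (suc k) c)
      minors r c with skip-suc k c
      ... | inj₁ q = reflexive (≡.cong (M (suc r)) q)
      ... | inj₂ (q , q′) = trans (reflexive (≡.cong (M (suc r)) q))
        (trans (sym (e (suc r))) (reflexive (≡.cong (M (suc r)) (≡.sym q′))))
      pair : sgn k * M 0 k * det n (minor k M) + - sgn k * M 0 (suc k) * det n (minor (suc k) M) ≈ 0#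
      pair = begin
        sgn k * M 0 k * det n (minor k M) + - sgn k * M 0 (suc k) * det n (minor (suc k) M)
          ≈⟨ +-congʳ (*-cong (*-congˡ (e 0)) (det-cong n λ r c _ _ → minors r c)) ⟩
        sgn k * M 0 (suc k) * det n (minor (suc k) M) + - sgn k * M 0 (suc k) * det n (minor (suc k) M)
          ≈⟨ solve 3 (λ s a d → s :* a :* d :+ :- s :* a :* d := con (+ 0)) refl (sgn k) (M 0 (suc k)) _ ⟩
        0# ∎

    -- The determinant is expanded along its first row only, so this expansion along the last column
    -- comes by induction.
    det-corner : ∀ n {M} → (∀ r → r ℕ.< n → M r n ≈ 0#) → det (suc n) M ≈ det n M * M n n
    det-corner zero {M} _ = trans (∑-one _)
        (solve 1 (λ a → con (+ 1) :* a :* con (+ 1) := con (+ 1) :* a) refl (M 0 0))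
    det-corner (suc n) {M} z = begin
      det (suc (suc n)) M ≈⟨ ∑-last (suc n) _ ⟩
      ∑ (suc n) (λ j → sgn j * M 0 j * det (suc n) (minor j M)) + sgn (suc n) * M 0 (suc n) * det (suc n)
          (minor (suc n) M)
        ≈⟨ +-cong (∑-cong (suc n) term) (*-congʳ (*-congˡ (z 0 z<s))) ⟩
      ∑ (suc n) (λ j → M (suc n) (suc n) * (sgn j * M 0 j * det n (minor j M))) + sgn (suc n) * 0# * det (suc n)
          (minor (suc n) M)
        ≈⟨ +-congʳ (∑-* (suc n) _ _) ⟨
      M (suc n) (suc n) * det (suc n) M + sgn (suc n) * 0# * det (suc n) (minor (suc n) M)
        ≈⟨ solve 4 (λ m d s e → m :* d :+ s :* con (+ 0) :* e := d :* m) refl (M (suc n) (suc n)) (det (suc n) M)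
            (sgn (suc n)) _ ⟩
      det (suc n) M * M (suc n) (suc n) ∎
      where
      last : ∀ j → j ℕ.< suc n → ∀ r → M (suc r) (skip j n) ≡ M (suc r) (suc n)
      last j (s≤s p) r = ≡.cong (M (suc r)) (skip-≥ p)
      term : ∀ j → j ℕ.< suc n → sgn j * M 0 j * det (suc n) (minor j M) ≈ M (suc n) (suc n) *
          (sgn j * M 0 j * det n (minor j M))
      term j p = begin
        sgn j * M 0 j * det (suc n) (minor j M)
          ≈⟨ *-congˡ (det-corner n λ r q → trans (reflexive (last j p r)) (z (suc r) (s<s q))) ⟩
        sgn j * M 0 j * (det n (minor j M) * M (suc n) (skip j n))
          ≈⟨ *-congˡ (*-congˡ (reflexive (last j p n))) ⟩
        sgn j * M 0 j * (det n (minor j M) * M (suc n) (suc n))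
          ≈⟨ solve 4 (λ s a d m → s :* a :* (d :* m) := m :* (s :* a :* d)) refl (sgn j) (M 0 j) _ _ ⟩
        M (suc n) (suc n) * (sgn j * M 0 j * det n (minor j M)) ∎

  -- Rows are replaced from the top down. The row k + 1 added to row k is then still the original
  -- one, and the error term has two equal adjacent rows.
  det-row-operations : ∀ n (t : ℕ → Carrier) M →
    det (suc n) (λ r c → pick r n (M r c + t r * M (suc r) c) (M r c)) ≈ det (suc n) M
  det-row-operations n t M = go n ℕP.≤-refl
    where
    stage : ℕ → Matrix
    stage k r c = pick r k (M r c + t r * M (suc r) c) (M r c)
    step : ∀ k → k ℕ.< n → det (suc n) (stage (suc k)) ≈ det (suc n) (stage k)
    step k k<n = begin
      det (suc n) (stage (suc k))
        ≈⟨ det-row-linear (suc n) k (t k) (ℕP.m<n⇒m<1+n k<n)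
             (λ r c h → reflexive (pick-≢ h))
             (λ r c h → trans (reflexive (pick-≢ h)) (off r c h))
             (λ c → trans (reflexive (pick-< (ℕP.n<1+n k)))
                 (+-cong (reflexive (≡.sym (pick-≥ (ℕP.≤-refl {k})))) (*-congˡ (sym (at c))))) ⟩
      det (suc n) (stage k) + t k * det (suc n) doubled
        ≈⟨ +-congˡ (*-congˡ (det-equal-rows (suc n) k (s<s k<n) λ c → trans (at c)
            (sym (trans (sym (off (suc k) c (ℕP.1+n≢n))) (reflexive (pick-≥ (ℕP.n≤1+n k))))))) ⟩
      det (suc n) (stage k) + t k * 0#
        ≈⟨ solve 2 (λ d s → d :+ s :* con (+ 0) := d) refl _ (t k) ⟩
      det (suc n) (stage k) ∎
      where
      doubled : Matrix
      doubled r c with r ℕ.≟ k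
      ... | yes _ = M (suc k) c
      ... | no _ = stage k r c
      off : ∀ r c → r ≢ k → stage k r c ≈ doubled r c
      off r c h with r ℕ.≟ k
      ... | yes e = ⊥-elim (h e)
      ... | no _ = refl
      at : ∀ c → doubled k c ≈ M (suc k) c
      at c with k ℕ.≟ k
      ... | yes _ = refl
      ... | no h = ⊥-elim (h ≡.refl)
    go : ∀ k → k ℕ.≤ n → det (suc n) (stage k) ≈ det (suc n) M
    go zero _ = refl
    go (suc k) p = trans (step k p) (go k (ℕP.<⇒≤ p))

  -- A sequence is read as a power series: with coefficients taken from the leading one downwards,
  -- the rows of a Sylvester matrix are shifts, and division by x - a becomes division by 1 - a x.
  times-1-ax : Carrier → (ℕ → Carrier) → ℕ → Carrier
  times-1-ax a F zero = F zero
  times-1-ax a F (suc c) = F (suc c) - a * F c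

  times-1-ax-cong : ∀ a {F G} → (∀ c → F c ≈ G c) → ∀ c → times-1-ax a F c ≈ times-1-ax a G c
  times-1-ax-cong a e zero = e zero
  times-1-ax-cong a e (suc c) = +-cong (e (suc c)) (-‿cong (*-congˡ (e c)))

  -- Columns are restored from the left: when column k + 1 is treated, column k is already the
  -- original one, so the error term has two equal adjacent columns.
  det-column-operations : ∀ n a M → det n (λ r → times-1-ax a (M r)) ≈ det n M
  det-column-operations zero a M = det-cong 0 λ _ _ ()
  det-column-operations (suc n) a M = trans (det-cong (suc n) λ r c _ _ → first r c)
    (trans (go n 0 (≡.sym (ℕP.+-comm n 1))) (det-cong (suc n) λ r c _ p → reflexive (pick-< p)))
    where
    stage : ℕ → Matrix
    stage k r c = pick c k (M r c) (times-1-ax a (M r) c)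
    first : ∀ r c → times-1-ax a (M r) c ≈ stage 1 r c
    first r zero = refl
    first r (suc c) = refl
    step : ∀ k → suc k ℕ.< suc n → det (suc n) (stage (suc k)) ≈ det (suc n) (stage (suc (suc k)))
    step k k<n = begin
      det (suc n) (stage (suc k))
        ≈⟨ det-column-linear (suc n) (suc k) (- a)
             (λ r c h → reflexive (≡.sym (pick-≢ h)))
             (λ r c h → off r c h)
             (λ r → trans (reflexive (pick-≥ (ℕP.≤-refl {suc k})))
                 (+-cong (reflexive (≡.sym (pick-< (ℕP.n<1+n (suc k)))))
               (trans (-‿distribˡ-* a _) (*-congˡ (sym (at r)))))) k<n ⟩
      det (suc n) (stage (suc (suc k))) + - a * det (suc n) doubled
        ≈⟨ +-congˡ (*-congˡ (det-equal-columns (suc n) k k<n λ r → trans (sym (off r k (λ e → ℕP.1+n≢n (≡.sym e))))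
             (trans (reflexive (pick-< (ℕP.n<1+n k))) (sym (at r))))) ⟩
      det (suc n) (stage (suc (suc k))) + - a * 0#
        ≈⟨ solve 2 (λ d s → d :+ s :* con (+ 0) := d) refl _ (- a) ⟩
      det (suc n) (stage (suc (suc k))) ∎
      where
      doubled : Matrix
      doubled r c with c ℕ.≟ suc k
      ... | yes _ = M r k
      ... | no _ = stage (suc k) r c
      off : ∀ r c → c ≢ suc k → stage (suc k) r c ≈ doubled r c
      off r c h with c ℕ.≟ suc k
      ... | yes e = ⊥-elim (h e)
      ... | no _ = refl
      at : ∀ r → doubled r (suc k) ≈ M r k
      at r with suc k ℕ.≟ suc k
      ... | yes _ = refl
      ... | no h = ⊥-elim (h ≡.refl)
    go : ∀ i k → suc n ≡ i ℕ.+ suc k → det (suc n) (stage (suc k)) ≈ det (suc n) (stage (suc n))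
    go zero k ≡.refl = refl
    go (suc i) k e = trans (step k (≡.subst (suc k ℕ.<_) (≡.sym e) (s<s (ℕP.m≤n+m (suc k) i))))
      (go i (suc k) (≡.trans e (≡.sym (ℕP.+-suc i (suc k)))))

  shift : ℕ → (ℕ → Carrier) → ℕ → Carrier
  shift zero F c = F c
  shift (suc i) F zero = 0#
  shift (suc i) F (suc c) = shift i F c

  Bounded : ℕ → (ℕ → Carrier) → Set
  Bounded n F = ∀ k → n ℕ.< k → F k ≈ 0#

  shift-bounded : ∀ i {b F} → Bounded b F → Bounded (i ℕ.+ b) (shift i F)
  shift-bounded zero B = B
  shift-bounded (suc i) B (suc k) (s≤s p) = shift-bounded i B k p

  shift-cong : ∀ i {F G} → (∀ c → F c ≈ G c) → ∀ c → shift i F c ≈ shift i G c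
  shift-cong zero e c = e c
  shift-cong (suc i) e zero = refl
  shift-cong (suc i) e (suc c) = shift-cong i e c

  shift-times-1-ax : ∀ i a F c → shift i (times-1-ax a F) c ≈ times-1-ax a (shift i F) c
  shift-times-1-ax zero a F c = refl
  shift-times-1-ax (suc i) a F zero = refl
  shift-times-1-ax (suc i) a F (suc zero) = trans (shift-times-1-ax i a F zero)
    (solve 2 (λ x a → x := x :- a :* con (+ 0)) refl _ a)
  shift-times-1-ax (suc i) a F (suc (suc c)) = shift-times-1-ax i a F (suc c)

  shift-minus-shift : ∀ i a F c → shift i F c + - a * shift (suc i) F c ≈ times-1-ax a (shift i F) c
  shift-minus-shift i a F zero = solve 2 (λ x a → x :+ :- a :* con (+ 0) := x) refl _ a
  shift-minus-shift i a F (suc c) = +-congˡ (sym (-‿distribˡ-* a _))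

  -- Two readings are combined: the sequence is the power series F / (1 - a x), and its n-th term is
  -- the value at a of the polynomial with coefficients F 0, ..., F n from the leading one down.
  horner : (ℕ → Carrier) → Carrier → ℕ → Carrier
  horner F a zero = F zero
  horner F a (suc k) = a * horner F a k + F (suc k)

  times-1-ax-horner : ∀ a F c → times-1-ax a (horner F a) c ≈ F c
  times-1-ax-horner a F zero = refl
  times-1-ax-horner a F (suc c) = solve 2 (λ x y → x :+ y :- x := y) refl _ (F (suc c))

  horner-shift : ∀ m F a n → horner (shift m F) a (m ℕ.+ n) ≈ horner F a n
  horner-shift zero F a n = refl
  horner-shift (suc m) F a n = trans (peel (m ℕ.+ n)) (horner-shift m F a n)
    where
    peel : ∀ k → horner (shift (suc m) F) a (suc k) ≈ horner (shift m F) a k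
    peel zero = solve 2 (λ a x → a :* con (+ 0) :+ x := x) refl a _
    peel (suc k) = +-congʳ (*-congˡ (peel k))

  δ₀ : ℕ → Carrier
  δ₀ zero = 1#
  δ₀ (suc _) = 0#

  det-identity : ∀ n {M} → (∀ r c → r ℕ.< n → c ℕ.< n → M r c ≈ shift r δ₀ c) → det n M ≈ 1#
  det-identity zero e = det-empty _
  det-identity (suc n) e = trans
    (det-corner n λ r p → trans (e r n (ℕP.m<n⇒m<1+n p) (ℕP.n<1+n n)) (off r p))
    (trans (*-cong (det-identity n λ r c p q → e r c (ℕP.m<n⇒m<1+n p) (ℕP.m<n⇒m<1+n q))
      (trans (e n n (ℕP.n<1+n n) (ℕP.n<1+n n)) (diagonal n))) (*-identityˡ 1#))
    where
    diagonal : ∀ n → shift n δ₀ n ≈ 1#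
    diagonal zero = refl
    diagonal (suc n) = diagonal n
    off : ∀ r {n} → r ℕ.< n → shift r δ₀ n ≈ 0#
    off zero {suc n} _ = refl
    off (suc r) {suc n} (s≤s p) = off r p

  -- The coefficients of ∏ (x - aᵢ) from the leading one downwards.
  reversed-roots : List Carrier → ℕ → Carrier
  reversed-roots [] = δ₀
  reversed-roots (a ∷ as) = times-1-ax a (reversed-roots as)

  reversed-roots-bounded : ∀ as → Bounded (length as) (reversed-roots as)
  reversed-roots-bounded [] (suc k) _ = refl
  reversed-roots-bounded (a ∷ as) (suc k) (s≤s p) = trans
    (+-cong (reversed-roots-bounded as (suc k) (ℕP.m<n⇒m<1+n p)) (-‿cong (*-congˡ (reversed-roots-bounded as k p))))
    (solve 1 (λ a → con (+ 0) :- a :* con (+ 0) := con (+ 0)) refl a)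

  sylvester : ℕ → (F G : ℕ → Carrier) → Matrix
  sylvester n F G r c = pick r n (shift r F c) (shift (r ∸ n) G c)

  product : List Carrier → Carrier
  product = foldr _*_ 1#

  -- Row operations turn every row but the last into a multiple of 1 - a x; column operations divide by it,
  -- which leaves the Sylvester matrix for one root less and the value at a in the corner.
  det-sylvester-roots : ∀ n G → Bounded n G → ∀ as →
    det (n ℕ.+ length as) (sylvester n (reversed-roots as) G) ≈ product (map (λ a → horner G a n) as)
  det-sylvester-roots n G bounded [] = det-identity (n ℕ.+ 0) λ r c p _ →
    reflexive (pick-< (≡.subst (r ℕ.<_) (ℕP.+-identityʳ n) p))
  det-sylvester-roots n G bounded (a ∷ as) = begin
    det (n ℕ.+ suc m) S′ ≡⟨ ≡.cong (λ k → det k S′) (ℕP.+-suc n m) ⟩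
    det (suc N) S′ ≈⟨ det-row-operations N t S′ ⟨
    det (suc N) (λ r c → pick r N (S′ r c + t r * S′ (suc r) c) (S′ r c))
        ≈⟨ det-cong (suc N) (λ r c p _ → rows r c p) ⟩
    det (suc N) (λ r → times-1-ax a (K r)) ≈⟨ det-column-operations (suc N) a K ⟩
    det (suc N) K ≈⟨ det-corner N column ⟩
    det N K * K N N ≈⟨ *-cong (det-cong N λ r c p _ → reflexive (pick-< p))
        (trans (reflexive (pick-≥ (ℕP.≤-refl {N}))) corner) ⟩
    det N (sylvester n F G) * horner G a n ≈⟨ *-comm _ _ ⟩
    horner G a n * det N (sylvester n F G) ≈⟨ *-congˡ (det-sylvester-roots n G bounded as) ⟩
    product (map (λ a → horner G a n) (a ∷ as)) ∎
    where
    m = length as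
    N = n ℕ.+ m
    F = reversed-roots as
    S′ = sylvester n (times-1-ax a F) G
    -- The rows of F already contain the factor 1 - a x; a row of G acquires it by subtracting a
    -- times the next shift.
    t : ℕ → Carrier
    t r = pick r n 0# (- a)
    -- The quotients of all rows by 1 - a x. The last row has no successor and is divided as a power
    -- series, by `horner`.
    K : Matrix
    K r c = pick r N (sylvester n F G r c) (horner (shift m G) a c)
    rows : ∀ r c → r ℕ.< suc N → pick r N (S′ r c + t r * S′ (suc r) c) (S′ r c) ≈ times-1-ax a (K r) c
    rows r c (s≤s p) with ℕP.<-cmp r N
    ... | tri> _ _ q = ⊥-elim (ℕP.<⇒≱ q p)
    ... | tri≈ _ ≡.refl _ = begin
      pick N N (S′ N c + t N * S′ (suc N) c) (S′ N c) ≡⟨ pick-≥ (ℕP.≤-refl {N}) ⟩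
      S′ N c ≡⟨ pick-≥ (ℕP.m≤m+n n m) ⟩
      shift (N ∸ n) G c ≡⟨ ≡.cong (λ i → shift i G c) (ℕP.m+n∸m≡n n m) ⟩
      shift m G c ≈⟨ times-1-ax-horner a (shift m G) c ⟨
      times-1-ax a (horner (shift m G) a) c
          ≈⟨ times-1-ax-cong a (λ c → reflexive (≡.sym (pick-≥ (ℕP.≤-refl {N})))) c ⟩
      times-1-ax a (K N) c ∎
    ... | tri< r<N _ _ with r ℕ.<? n
    ...   | yes r<n = begin
      pick r N (S′ r c + t r * S′ (suc r) c) (S′ r c) ≡⟨ pick-< r<N ⟩
      S′ r c + t r * S′ (suc r) c ≈⟨ +-cong (reflexive (pick-< r<n)) (*-congʳ (reflexive (pick-< r<n))) ⟩
      shift r (times-1-ax a F) c + 0# * S′ (suc r) c ≈⟨ solve 2 (λ x y → x :+ con (+ 0) :* y := x) refl _ _ ⟩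
      shift r (times-1-ax a F) c ≈⟨ shift-times-1-ax r a F c ⟩
      times-1-ax a (shift r F) c
          ≈⟨ times-1-ax-cong a (λ c → reflexive (≡.sym (≡.trans (pick-< r<N) (pick-< r<n)))) c ⟩
      times-1-ax a (K r) c ∎
    ...   | no r≮n = begin
      pick r N (S′ r c + t r * S′ (suc r) c) (S′ r c) ≡⟨ pick-< r<N ⟩
      S′ r c + t r * S′ (suc r) c
        ≈⟨ +-cong (reflexive (pick-≥ n≤r))
            (*-cong (reflexive (pick-≥ n≤r)) (reflexive (pick-≥ (ℕP.m≤n⇒m≤1+n n≤r)))) ⟩
      shift (r ∸ n) G c + - a * shift (suc r ∸ n) G c
          ≡⟨ ≡.cong (λ i → shift (r ∸ n) G c + - a * shift i G c) (ℕP.+-∸-assoc 1 n≤r) ⟩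
      shift (r ∸ n) G c + - a * shift (suc (r ∸ n)) G c ≈⟨ shift-minus-shift (r ∸ n) a G c ⟩
      times-1-ax a (shift (r ∸ n) G) c
          ≈⟨ times-1-ax-cong a (λ c → reflexive (≡.sym (≡.trans (pick-< r<N) (pick-≥ n≤r)))) c ⟩
      times-1-ax a (K r) c ∎
      where
      n≤r = ℕP.≮⇒≥ r≮n
    column : ∀ r → r ℕ.< N → K r N ≈ 0#
    column r r<N with r ℕ.<? n
    ... | yes r<n = trans (reflexive (≡.trans (pick-< r<N) (pick-< r<n)))
      (shift-bounded r (reversed-roots-bounded as) N (ℕP.+-monoˡ-< m r<n))
    ... | no r≮n = trans (reflexive (≡.trans (pick-< r<N) (pick-≥ n≤r)))
      (shift-bounded (r ∸ n) bounded N
          (≡.subst (r ∸ n ℕ.+ n ℕ.<_) ≡.refl (≡.subst (ℕ._< N) (≡.sym (ℕP.m∸n+n≡m n≤r)) r<N)))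
      where
      n≤r = ℕP.≮⇒≥ r≮n
    corner : horner (shift m G) a N ≈ horner G a n
    corner = trans (reflexive (≡.cong (horner (shift m G) a) (ℕP.+-comm n m))) (horner-shift m G a n)

-- Polynomials over a commutative ring

module Polynomials (R : CommutativeRing 0ℓ 0ℓ) where
  open RingKit R

  coef : List Carrier → ℕ → Carrier
  coef [] _ = 0#
  coef (a ∷ p) zero = a
  coef (a ∷ p) (suc k) = coef p k

  infix 4 _≋_
  -- Equality up to trailing zeros. The record wrapper lets p and q be inferred from a proof of
  -- equality.
  record _≋_ (p q : List Carrier) : Set where
    constructor mk≋
    field at : ∀ k → coef p k ≈ coef q k
  open _≋_ public

  infixl 6 _⊕_
  infixl 7 _⊛_

  opaque
    _⊕_ : List Carrier → List Carrier → List Carrier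
    [] ⊕ q = q
    (a ∷ p) ⊕ [] = a ∷ p
    (a ∷ p) ⊕ (b ∷ q) = (a + b) ∷ (p ⊕ q)

    scale : Carrier → List Carrier → List Carrier
    scale c [] = []
    scale c (a ∷ p) = (c * a) ∷ scale c p

    _⊛_ : List Carrier → List Carrier → List Carrier
    [] ⊛ q = []
    (a ∷ p) ⊛ q = scale a q ⊕ (0# ∷ (p ⊛ q))

  neg : List Carrier → List Carrier
  neg = scale (- 1#)

  const : Carrier → List Carrier
  const c = c ∷ []

  X : List Carrier
  X = 0# ∷ 1# ∷ []

  opaque
    unfolding _⊛_

    coef-⊕ : ∀ p q k → coef (p ⊕ q) k ≈ coef p k + coef q k
    coef-⊕ [] q k = sym (+-identityˡ _)
    coef-⊕ (a ∷ p) [] k = sym (+-identityʳ _)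
    coef-⊕ (a ∷ p) (b ∷ q) zero = refl
    coef-⊕ (a ∷ p) (b ∷ q) (suc k) = coef-⊕ p q k

    coef-scale : ∀ c p k → coef (scale c p) k ≈ c * coef p k
    coef-scale c [] k = sym (zeroʳ c)
    coef-scale c (a ∷ p) zero = refl
    coef-scale c (a ∷ p) (suc k) = coef-scale c p k

    coef-neg : ∀ p k → coef (neg p) k ≈ - coef p k
    coef-neg p k = trans (coef-scale _ p k) (-1*x≈-x _)

    coef-⊛ : ∀ a p q k → coef ((a ∷ p) ⊛ q) k ≈ a * coef q k + coef (0# ∷ (p ⊛ q)) k
    coef-⊛ a p q k = trans (coef-⊕ (scale a q) _ k) (+-congʳ (coef-scale a q k))

    coef-⊛-zero : ∀ a p q → coef ((a ∷ p) ⊛ q) 0 ≈ a * coef q 0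
    coef-⊛-zero a p q = trans (coef-⊕ (scale a q) _ 0) (trans (+-identityʳ _) (coef-scale a q 0))

    coef-⊛-suc : ∀ a p q k → coef ((a ∷ p) ⊛ q) (suc k) ≈ a * coef q (suc k) + coef (p ⊛ q) k
    coef-⊛-suc a p q k = trans (coef-⊕ (scale a q) _ (suc k)) (+-congʳ (coef-scale a q (suc k)))

    ≋-refl : ∀ {p} → p ≋ p
    ≋-refl = mk≋ λ _ → refl

    ≋-sym : ∀ {p q} → p ≋ q → q ≋ p
    ≋-sym e = mk≋ λ k → sym (at e k)

    ≋-trans : ∀ {p q r} → p ≋ q → q ≋ r → p ≋ r
    ≋-trans e f = mk≋ λ k → trans (at e k) (at f k)

    ∷-cong : ∀ {a b p q} → a ≈ b → p ≋ q → a ∷ p ≋ b ∷ q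
    ∷-cong e f = mk≋ λ { zero → e ; (suc k) → at f k }

    tail-≋ : ∀ {a b p q} → a ∷ p ≋ b ∷ q → p ≋ q
    tail-≋ e = mk≋ λ k → at e (suc k)

    0∷[] : 0# ∷ [] ≋ []
    0∷[] = mk≋ λ { zero → refl ; (suc k) → refl }

    ⊕-cong : ∀ {p p′ q q′} → p ≋ p′ → q ≋ q′ → p ⊕ q ≋ p′ ⊕ q′
    ⊕-cong {p} {p′} {q} {q′} e f = mk≋ λ k →
      trans (coef-⊕ p q k) (trans (+-cong (at e k) (at f k)) (sym (coef-⊕ p′ q′ k)))

    scale-cong : ∀ {c d p q} → c ≈ d → p ≋ q → scale c p ≋ scale d q
    scale-cong {c} {d} {p} {q} e f = mk≋ λ k →
      trans (coef-scale c p k) (trans (*-cong e (at f k)) (sym (coef-scale d q k)))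

    ⊕-assoc : ∀ p q r → (p ⊕ q) ⊕ r ≋ p ⊕ (q ⊕ r)
    ⊕-assoc p q r = mk≋ λ k → begin
      coef ((p ⊕ q) ⊕ r) k ≈⟨ trans (coef-⊕ (p ⊕ q) r k) (+-congʳ (coef-⊕ p q k)) ⟩
      coef p k + coef q k + coef r k ≈⟨ +-assoc _ _ _ ⟩
      coef p k + (coef q k + coef r k) ≈⟨ trans (coef-⊕ p (q ⊕ r) k) (+-congˡ (coef-⊕ q r k)) ⟨
      coef (p ⊕ (q ⊕ r)) k ∎

    ⊕-comm : ∀ p q → p ⊕ q ≋ q ⊕ p
    ⊕-comm p q = mk≋ λ k → trans (coef-⊕ p q k) (trans (+-comm _ _) (sym (coef-⊕ q p k)))

    ⊕-identityˡ : ∀ p → [] ⊕ p ≋ p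
    ⊕-identityˡ p = ≋-refl

    []-⊛ : ∀ p → [] ⊛ p ≋ []
    []-⊛ p = ≋-refl

    ⊕-identityʳ : ∀ p → p ⊕ [] ≋ p
    ⊕-identityʳ p = mk≋ λ k → trans (coef-⊕ p [] k) (+-identityʳ _)

    ⊕-inverseʳ : ∀ p → p ⊕ neg p ≋ []
    ⊕-inverseʳ p = mk≋ λ k → trans (coef-⊕ p (neg p) k) (trans (+-congˡ (coef-neg p k)) (-‿inverseʳ _))

    ⊕-inverseˡ : ∀ p → neg p ⊕ p ≋ []
    ⊕-inverseˡ p = ≋-trans (⊕-comm (neg p) p) (⊕-inverseʳ p)

    scale-⊕ : ∀ c p q → scale c (p ⊕ q) ≋ scale c p ⊕ scale c q
    scale-⊕ c p q = mk≋ λ k → begin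
      coef (scale c (p ⊕ q)) k ≈⟨ trans (coef-scale c (p ⊕ q) k) (*-congˡ (coef-⊕ p q k)) ⟩
      c * (coef p k + coef q k) ≈⟨ distribˡ _ _ _ ⟩
      c * coef p k + c * coef q k ≈⟨ trans (coef-⊕ (scale c p) _ k) (+-cong (coef-scale c p k) (coef-scale c q k)) ⟨
      coef (scale c p ⊕ scale c q) k ∎

    ⊛-congˡ : ∀ p {q q′} → q ≋ q′ → p ⊛ q ≋ p ⊛ q′
    ⊛-congˡ [] e = ≋-refl
    ⊛-congˡ (a ∷ p) e = ⊕-cong (scale-cong refl e) (∷-cong refl (⊛-congˡ p e))

    ⊛-zeroʳ : ∀ p → p ⊛ [] ≋ []
    ⊛-zeroʳ [] = ≋-refl
    ⊛-zeroʳ (a ∷ p) = ≋-trans (∷-cong refl (⊛-zeroʳ p)) 0∷[]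

    ⊛-∷ : ∀ q a p → q ⊛ (a ∷ p) ≋ scale a q ⊕ (0# ∷ (q ⊛ p))
    ⊛-∷ [] a p = ≋-sym 0∷[]
    ⊛-∷ (b ∷ q) a p = mk≋ λ where
      zero → +-congʳ (*-comm b a)
      (suc k) → begin
        coef (scale b p ⊕ (q ⊛ (a ∷ p))) k
            ≈⟨ trans (coef-⊕ (scale b p) _ k) (+-congˡ (trans (at (⊛-∷ q a p) k) (coef-⊕ (scale a q) _ k))) ⟩
        coef (scale b p) k + (coef (scale a q) k + coef (0# ∷ (q ⊛ p)) k)
          ≈⟨ solve 3 (λ x y z → x :+ (y :+ z) := y :+ (x :+ z)) refl _ _ _ ⟩
        coef (scale a q) k + (coef (scale b p) k + coef (0# ∷ (q ⊛ p)) k)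
          ≈⟨ trans (coef-⊕ (scale a q) _ k) (+-congˡ (coef-⊕ (scale b p) _ k)) ⟨
        coef (scale a q ⊕ ((b ∷ q) ⊛ p)) k ∎

    ⊛-comm : ∀ p q → p ⊛ q ≋ q ⊛ p
    ⊛-comm [] q = ≋-sym (⊛-zeroʳ q)
    ⊛-comm (a ∷ p) q = ≋-trans (⊕-cong (≋-refl {scale a q}) (∷-cong refl (⊛-comm p q))) (≋-sym (⊛-∷ q a p))

    ⊛-cong : ∀ {p p′ q q′} → p ≋ p′ → q ≋ q′ → p ⊛ q ≋ p′ ⊛ q′
    ⊛-cong {p} {p′} {q} {q′} e f = ≋-trans (⊛-congˡ p f)
        (≋-trans (⊛-comm p q′) (≋-trans (⊛-congˡ q′ e) (⊛-comm q′ p′)))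

    ⊕-interchange : ∀ p q r s → (p ⊕ q) ⊕ (r ⊕ s) ≋ (p ⊕ r) ⊕ (q ⊕ s)
    ⊕-interchange p q r s = mk≋ λ k → begin
      coef ((p ⊕ q) ⊕ (r ⊕ s)) k ≈⟨ trans (coef-⊕ (p ⊕ q) _ k) (+-cong (coef-⊕ p q k) (coef-⊕ r s k)) ⟩
      (coef p k + coef q k) + (coef r k + coef s k)
        ≈⟨ solve 4 (λ x y z w → (x :+ y) :+ (z :+ w) := (x :+ z) :+ (y :+ w)) refl _ _ _ _ ⟩
      (coef p k + coef r k) + (coef q k + coef s k)
          ≈⟨ trans (coef-⊕ (p ⊕ r) _ k) (+-cong (coef-⊕ p r k) (coef-⊕ q s k)) ⟨
      coef ((p ⊕ r) ⊕ (q ⊕ s)) k ∎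

    ⊛-distribˡ : ∀ p q r → p ⊛ (q ⊕ r) ≋ p ⊛ q ⊕ p ⊛ r
    ⊛-distribˡ [] q r = ≋-refl
    ⊛-distribˡ (a ∷ p) q r = ≋-trans
      (⊕-cong (scale-⊕ a q r) (≋-trans (∷-cong (sym (+-identityˡ 0#)) (⊛-distribˡ p q r))
          (≋-refl {(0# ∷ p ⊛ q) ⊕ (0# ∷ p ⊛ r)})))
      (⊕-interchange (scale a q) (scale a r) (0# ∷ p ⊛ q) (0# ∷ p ⊛ r))

    ⊛-distribʳ : ∀ r p q → (p ⊕ q) ⊛ r ≋ p ⊛ r ⊕ q ⊛ r
    ⊛-distribʳ r p q = ≋-trans (⊛-comm (p ⊕ q) r) (≋-trans (⊛-distribˡ r p q) (⊕-cong (⊛-comm r p) (⊛-comm r q)))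

    scale-scale : ∀ c d p → scale (c * d) p ≋ scale c (scale d p)
    scale-scale c d p = mk≋ λ k → begin
      coef (scale (c * d) p) k ≈⟨ coef-scale _ p k ⟩
      c * d * coef p k ≈⟨ *-assoc _ _ _ ⟩
      c * (d * coef p k) ≈⟨ trans (coef-scale c (scale d p) k) (*-congˡ (coef-scale d p k)) ⟨
      coef (scale c (scale d p)) k ∎

    scale-⊛ : ∀ c p q → scale c p ⊛ q ≋ scale c (p ⊛ q)
    scale-⊛ c [] q = ≋-refl
    scale-⊛ c (a ∷ p) q = ≋-trans
      (⊕-cong (scale-scale c a q) (∷-cong (sym (zeroʳ c)) (scale-⊛ c p q)))
      (≋-sym (scale-⊕ c (scale a q) (0# ∷ (p ⊛ q))))

    0∷-⊛ : ∀ p q → (0# ∷ p) ⊛ q ≋ 0# ∷ (p ⊛ q)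
    0∷-⊛ p q = mk≋ λ k → trans (coef-⊕ (scale 0# q) _ k)
      (trans (+-congʳ (trans (coef-scale 0# q k) (zeroˡ _))) (+-identityˡ _))

    ⊛-assoc : ∀ p q r → (p ⊛ q) ⊛ r ≋ p ⊛ (q ⊛ r)
    ⊛-assoc [] q r = ≋-refl
    ⊛-assoc (a ∷ p) q r = ≋-trans (⊛-distribʳ r (scale a q) (0# ∷ (p ⊛ q)))
      (⊕-cong (scale-⊛ a q r) (≋-trans (0∷-⊛ (p ⊛ q) r) (∷-cong refl (⊛-assoc p q r))))

    scale-const : ∀ c p → scale c p ≋ const c ⊛ p
    scale-const c p = mk≋ λ k → sym (trans (coef-⊕ (scale c p) _ k) (trans (+-congˡ (at 0∷[] k)) (+-identityʳ _)))

    ⊛-identityˡ : ∀ p → const 1# ⊛ p ≋ p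
    ⊛-identityˡ p = ≋-trans (≋-sym (scale-const 1# p)) (mk≋ λ k → trans (coef-scale 1# p k) (*-identityˡ _))

  polynomialRing : CommutativeRing 0ℓ 0ℓ
  polynomialRing = record
    { Carrier = List Carrier ; _≈_ = _≋_ ; _+_ = _⊕_ ; _*_ = _⊛_ ; -_ = neg ; 0# = [] ; 1# = const 1#
    ; isCommutativeRing = record
      { isRing = record
        { +-isAbelianGroup = record
          { isGroup = record
            { isMonoid = record
              { isSemigroup = record
                { isMagma = record
                  { isEquivalence = record { refl = ≋-refl ; sym = ≋-sym ; trans = ≋-trans }
                  ; ∙-cong = ⊕-cong }
                ; assoc = ⊕-assoc }
              ; identity = ⊕-identityˡ , ⊕-identityʳ }
            ; inverse = ⊕-inverseˡ , ⊕-inverseʳ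
            ; ⁻¹-cong = scale-cong refl }
          ; comm = ⊕-comm }
        ; *-cong = ⊛-cong
        ; *-assoc = ⊛-assoc
        ; *-identity = ⊛-identityˡ , λ p → ≋-trans (⊛-comm p _) (⊛-identityˡ p)
        ; distrib = ⊛-distribˡ , ⊛-distribʳ }
      ; *-comm = ⊛-comm } }

  module P = RingKit polynomialRing

  opaque
    unfolding _⊛_

    ∷-≋ : ∀ a p → a ∷ p ≋ const a ⊕ X ⊛ p
    ∷-≋ a p = ≋-sym (≋-trans
      (⊕-cong (≋-refl {const a}) (≋-trans (0∷-⊛ (const 1#) p) (∷-cong refl (⊛-identityˡ p))))
      (∷-cong (+-identityʳ a) ≋-refl))

    X⊛ : ∀ p → X ⊛ p ≋ 0# ∷ p
    X⊛ p = ≋-trans (0∷-⊛ (const 1#) p) (∷-cong refl (⊛-identityˡ p))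

    const-⊕ : ∀ a b → const (a + b) ≋ const a ⊕ const b
    const-⊕ a b = ≋-refl

    const-⊛ : ∀ a b → const (a * b) ≋ const a ⊛ const b
    const-⊛ a b = scale-const a (const b)

  Bounded : ℕ → List Carrier → Set
  Bounded n p = ∀ k → n ℕ.< k → coef p k ≈ 0#

  -- The degree is a parameter: equality in R need not be decidable, so no degree can be computed
  -- from p.
  record IsMonic (n : ℕ) (p : List Carrier) : Set where
    constructor _,_
    field
      leading≈1 : coef p n ≈ 1#
      monic-bounded : Bounded n p
  open IsMonic public

  IsMonic-cong : ∀ {n p q} → p ≋ q → IsMonic n p → IsMonic n q
  IsMonic-cong e (t , b) = trans (sym (at e _)) t , λ k h → trans (sym (at e k)) (b k h)

  Bounded-cong : ∀ {n p q} → p ≋ q → Bounded n p → Bounded n q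
  Bounded-cong e b = λ k h → trans (sym (at e k)) (b k h)

  opaque
    unfolding _⊛_

    ⊛-top : ∀ m n p q → Bounded m p → Bounded n q →
      coef (p ⊛ q) (m ℕ.+ n) ≈ coef p m * coef q n × Bounded (m ℕ.+ n) (p ⊛ q)
    ⊛-top m n [] q bp bq = sym (zeroˡ _) , λ _ _ → refl
    ⊛-top zero n (a ∷ p) q bp bq = trans (at e n) (coef-scale a q n) ,
      λ k h → trans (at e k) (trans (coef-scale a q k) (trans (*-congˡ (bq k h)) (zeroʳ a)))
      where
      e : (a ∷ p) ⊛ q ≋ scale a q
      e = ≋-trans (⊛-cong {a ∷ p} {const a} {q} (∷-cong refl (mk≋ λ k → bp (suc k) z<s)) (≋-refl {q}))
          (≋-sym (scale-const a q))
    ⊛-top (suc m) n (a ∷ p) q bp bq with ⊛-top m n p q (λ k h → bp (suc k) (s<s h)) bq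
    ... | t , b = trans (coef-⊛-suc a p q _)
        (trans (+-cong (trans (*-congˡ (bq _ (s<s (ℕP.m≤n+m n m)))) (zeroʳ a)) t) (+-identityˡ _)) ,
      λ { (suc k) (s≤s h) → trans (coef-⊛-suc a p q k) (trans (+-cong
          (trans (*-congˡ (bq (suc k) (ℕP.m<n⇒m<1+n (ℕP.≤-<-trans (ℕP.m≤n+m n m) h)))) (zeroʳ a)) (b k h))
              (+-identityˡ _)) }

    ⊛-monic : ∀ {m n p q} → IsMonic m p → IsMonic n q → IsMonic (m ℕ.+ n) (p ⊛ q)
    ⊛-monic {m} {n} {p} {q} (t , b) (t′ , b′) with ⊛-top m n p q b b′
    ... | s , c = trans s (trans (*-cong t t′) (*-identityˡ 1#)) , c

    -- R may have zero divisors, so the leading 1 of f replaces cancellation. The tail of the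
    -- multiplier satisfies the same hypothesis, because a f has no coefficient beyond n; once the
    -- tail vanishes, coefficient n gives a.
    monic-multiple-bounded : ∀ n f s → IsMonic n f → (∀ k → n ℕ.≤ k → coef (s ⊛ f) k ≈ 0#) → s ≋ []
    monic-multiple-bounded n f [] _ _ = ≋-refl
    monic-multiple-bounded n f (a ∷ s) M@(t , b) z = ≋-trans (∷-cong (a≈0 n t z) s≋0) 0∷[]
      where
      s≋0 : s ≋ []
      s≋0 = monic-multiple-bounded n f s M λ k h → begin
        coef (s ⊛ f) k ≈⟨ +-identityˡ _ ⟨
        0# + coef (s ⊛ f) k ≈⟨ +-congʳ (trans (*-congˡ (b (suc k) (s<s h))) (zeroʳ a)) ⟨
        a * coef f (suc k) + coef (s ⊛ f) k ≈⟨ coef-⊛-suc a s f k ⟨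
        coef ((a ∷ s) ⊛ f) (suc k) ≈⟨ z (suc k) (ℕP.m≤n⇒m≤1+n h) ⟩
        0# ∎
      a≈0 : ∀ n → coef f n ≈ 1# → (∀ k → n ℕ.≤ k → coef ((a ∷ s) ⊛ f) k ≈ 0#) → a ≈ 0#
      a≈0 zero t z = trans (sym (*-identityʳ a))
          (trans (*-congˡ (sym t)) (trans (sym (coef-⊛-zero a s f)) (z 0 z≤n)))
      a≈0 (suc n) t z = begin
        a ≈⟨ solve 1 (λ a → a := a :* con (+ 1) :+ con (+ 0)) refl a ⟩
        a * 1# + 0# ≈⟨ +-cong (*-congˡ t) (at (⊛-cong s≋0 (≋-refl {f})) n) ⟨
        a * coef f (suc n) + coef (s ⊛ f) n ≈⟨ coef-⊛-suc a s f n ⟨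
        coef ((a ∷ s) ⊛ f) (suc n) ≈⟨ z (suc n) ℕP.≤-refl ⟩
        0# ∎

  -- The product rule applied to a + x p; `coef-D` gives the usual coefficients.
  D : List Carrier → List Carrier
  D [] = []
  D (a ∷ p) = p ⊕ (0# ∷ D p)

  coef-D : ∀ p k → coef (D p) k ≈ fromℤ (+ suc k) * coef p (suc k)
  coef-D [] k = sym (zeroʳ _)
  coef-D (a ∷ p) zero = trans (coef-⊕ p _ 0) (solve 1 (λ x → x :+ con (+ 0) := con (+ 1) :* x) refl _)
  coef-D (a ∷ p) (suc k) = begin
    coef (p ⊕ (0# ∷ D p)) (suc k) ≈⟨ trans (coef-⊕ p _ (suc k)) (+-congˡ (coef-D p k)) ⟩
    coef p (suc k) + fromℤ (+ suc k) * coef p (suc k)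
      ≈⟨ solve 2 (λ x n → x :+ n :* x := (con (+ 1) :+ n) :* x) refl (coef p (suc k)) (fromℤ (+ suc k)) ⟩
    (1# + fromℤ (+ suc k)) * coef p (suc k) ≈⟨ *-congʳ (fromℤ-+ (+ 1) (+ suc k)) ⟨
    fromℤ (+ suc (suc k)) * coef p (suc k) ∎

  D-cong : ∀ {p q} → p ≋ q → D p ≋ D q
  D-cong {p} {q} e = mk≋ λ k → trans (coef-D p k) (trans (*-congˡ (at e (suc k))) (sym (coef-D q k)))

  D-⊕ : ∀ p q → D (p ⊕ q) ≋ D p ⊕ D q
  D-⊕ p q = mk≋ λ k → begin
    coef (D (p ⊕ q)) k ≈⟨ trans (coef-D (p ⊕ q) k) (*-congˡ (coef-⊕ p q (suc k))) ⟩
    fromℤ (+ suc k) * (coef p (suc k) + coef q (suc k)) ≈⟨ distribˡ _ _ _ ⟩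
    fromℤ (+ suc k) * coef p (suc k) + fromℤ (+ suc k) * coef q (suc k)
        ≈⟨ trans (coef-⊕ (D p) (D q) k) (+-cong (coef-D p k) (coef-D q k)) ⟨
    coef (D p ⊕ D q) k ∎

  D-scale : ∀ c p → D (scale c p) ≋ scale c (D p)
  D-scale c p = mk≋ λ k → begin
    coef (D (scale c p)) k ≈⟨ trans (coef-D (scale c p) k) (*-congˡ (coef-scale c p (suc k))) ⟩
    fromℤ (+ suc k) * (c * coef p (suc k)) ≈⟨ solve 3 (λ x y z → x :* (y :* z) := y :* (x :* z)) refl _ c _ ⟩
    c * (fromℤ (+ suc k) * coef p (suc k)) ≈⟨ trans (coef-scale c (D p) k) (*-congˡ (coef-D p k)) ⟨
    coef (scale c (D p)) k ∎

  opaque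
    unfolding _⊛_

    D-⊛ : ∀ p q → D (p ⊛ q) ≋ D p ⊛ q ⊕ p ⊛ D q
    D-⊛ [] q = ≋-refl
    D-⊛ (a ∷ p) q = P.begin
      D (scale a q ⊕ (0# ∷ (p ⊛ q))) P.≈⟨ D-⊕ (scale a q) _ ⟩
      D (scale a q) ⊕ ((p ⊛ q) ⊕ (0# ∷ D (p ⊛ q)))
        P.≈⟨ ⊕-cong (≋-trans (D-scale a q) (scale-const a (D q)))
            (⊕-cong (≋-refl {p ⊛ q}) (≋-trans (∷-cong refl (D-⊛ p q)) (≋-sym (X⊛ _)))) ⟩
      const a ⊛ D q ⊕ ((p ⊛ q) ⊕ X ⊛ (D p ⊛ q ⊕ p ⊛ D q))
        P.≈⟨ P.solve 6 (λ a x p q dp dq → a P.:* dq P.:+ (p P.:* q P.:+ x P.:* (dp P.:* q P.:+ p P.:* dq))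
               P.:= (p P.:+ x P.:* dp) P.:* q P.:+ (a P.:+ x P.:* p) P.:* dq) ≋-refl (const a) X p q (D p) (D q) ⟩
      (p ⊕ X ⊛ D p) ⊛ q ⊕ (const a ⊕ X ⊛ p) ⊛ D q
        P.≈⟨ ⊕-cong (⊛-cong (⊕-cong (≋-refl {p}) (X⊛ (D p))) (≋-refl {q}))
            (⊛-cong (≋-sym (∷-≋ a p)) (≋-refl {D q})) ⟩
      D (a ∷ p) ⊛ q ⊕ (a ∷ p) ⊛ D q P.∎

  eval : Carrier → List Carrier → Carrier
  eval s [] = 0#
  eval s (a ∷ p) = a + s * eval s p

  eval-zero : ∀ s p → p ≋ [] → eval s p ≈ 0#
  eval-zero s [] e = refl
  eval-zero s (a ∷ p) e = trans (+-cong (at e 0) (*-congˡ (eval-zero s p (mk≋ λ k → at e (suc k)))))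
      (solve 1 (λ s → con (+ 0) :+ s :* con (+ 0) := con (+ 0)) refl s)

  eval-cong : ∀ s {p q} → p ≋ q → eval s p ≈ eval s q
  eval-cong s {[]} {q} e = sym (eval-zero s q (≋-sym e))
  eval-cong s {a ∷ p} {[]} e = eval-zero s (a ∷ p) e
  eval-cong s {a ∷ p} {b ∷ q} e = +-cong (at e 0) (*-congˡ (eval-cong s (tail-≋ e)))

  opaque
    unfolding _⊛_

    eval-⊕ : ∀ s p q → eval s (p ⊕ q) ≈ eval s p + eval s q
    eval-⊕ s [] q = sym (+-identityˡ _)
    eval-⊕ s (a ∷ p) [] = sym (+-identityʳ _)
    eval-⊕ s (a ∷ p) (b ∷ q) = trans (+-congˡ (*-congˡ (eval-⊕ s p q)))
      (solve 5 (λ a b s x y → a :+ b :+ s :* (x :+ y) := a :+ s :* x :+ (b :+ s :* y)) refl a b s _ _)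

    eval-scale : ∀ s c p → eval s (scale c p) ≈ c * eval s p
    eval-scale s c [] = sym (zeroʳ c)
    eval-scale s c (a ∷ p) = trans (+-congˡ (*-congˡ (eval-scale s c p)))
      (solve 4 (λ c a s x → c :* a :+ s :* (c :* x) := c :* (a :+ s :* x)) refl c a s _)

    eval-⊛ : ∀ s p q → eval s (p ⊛ q) ≈ eval s p * eval s q
    eval-⊛ s [] q = sym (zeroˡ _)
    eval-⊛ s (a ∷ p) q = trans (eval-⊕ s (scale a q) _)
        (trans (+-cong (eval-scale s a q) (+-congˡ (*-congˡ (eval-⊛ s p q))))
      (solve 4 (λ a q s p → a :* q :+ (con (+ 0) :+ s :* (p :* q)) := (a :+ s :* p) :* q) refl a _ s _))

  linear : Carrier → List Carrier
  linear a = - a ∷ 1# ∷ []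

  opaque
    unfolding _⊛_

    linear-⊛ : ∀ a p → linear a ⊛ p ≋ scale (- a) p ⊕ (0# ∷ p)
    linear-⊛ a p = ⊕-cong (≋-refl {scale (- a) p}) (∷-cong refl (⊛-identityˡ p))

  syntheticQuotient : Carrier → List Carrier → List Carrier
  syntheticQuotient a [] = []
  syntheticQuotient a (c ∷ p) = eval a p ∷ syntheticQuotient a p

  opaque
    unfolding _⊛_

    syntheticQuotient-spec : ∀ a p → p ≋ linear a ⊛ syntheticQuotient a p ⊕ const (eval a p)
    syntheticQuotient-spec a [] = ≋-sym (≋-trans (⊕-cong (⊛-zeroʳ (linear a)) 0∷[]) ≋-refl)
    syntheticQuotient-spec a (c ∷ p) = mk≋ λ where
        zero → begin
          c ≈⟨ solve 3 (λ a c e → c := :- a :* e :+ (c :+ a :* e)) refl a c (eval a p) ⟩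
          - a * eval a p + (c + a * eval a p) ≈⟨ +-congʳ (coef-⊛-zero (- a) (1# ∷ []) Q) ⟨
          coef (linear a ⊛ Q) 0 + (c + a * eval a p) ≈⟨ coef-⊕ (linear a ⊛ Q) (const (eval a (c ∷ p))) 0 ⟨
          coef (linear a ⊛ Q ⊕ const (eval a (c ∷ p))) 0 ∎
        (suc k) → begin
          coef p k ≈⟨ at (syntheticQuotient-spec a p) k ⟩
          coef (linear a ⊛ q ⊕ const (eval a p)) k
              ≈⟨ trans (coef-⊕ (linear a ⊛ q) _ k)
                  (+-congʳ (trans (at (linear-⊛ a q) k) (coef-⊕ (scale (- a) q) _ k))) ⟩
          coef (scale (- a) q) k + coef (0# ∷ q) k + coef (const (eval a p)) k
              ≈⟨ +-congʳ (+-congʳ (coef-scale (- a) q k)) ⟩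
          - a * coef q k + coef (0# ∷ q) k + coef (const (eval a p)) k ≈⟨ shifted k ⟩
          - a * coef q k + coef Q k ≈⟨ +-congʳ (coef-scale (- a) q k) ⟨
          coef (scale (- a) Q) (suc k) + coef (0# ∷ Q) (suc k)
              ≈⟨ trans (at (linear-⊛ a Q) (suc k)) (coef-⊕ (scale (- a) Q) (0# ∷ Q) (suc k)) ⟨
          coef (linear a ⊛ Q) (suc k) ≈⟨ +-identityʳ _ ⟨
          coef (linear a ⊛ Q) (suc k) + 0# ≈⟨ coef-⊕ (linear a ⊛ Q) (const (eval a (c ∷ p))) (suc k) ⟨
          coef (linear a ⊛ Q ⊕ const (eval a (c ∷ p))) (suc k) ∎
      where
      q : List Carrier
      q = syntheticQuotient a p
      Q : List Carrier
      Q = syntheticQuotient a (c ∷ p)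
      shifted : ∀ k → - a * coef q k + coef (0# ∷ q) k + coef (const (eval a p)) k ≈ - a * coef q k + coef Q k
      shifted zero = solve 2 (λ x y → x :+ con (+ 0) :+ y := x :+ y) refl _ _
      shifted (suc k) = +-identityʳ _

    factor : ∀ a p → eval a p ≈ 0# → p ≋ linear a ⊛ syntheticQuotient a p
    factor a p e = ≋-trans (syntheticQuotient-spec a p)
      (≋-trans (⊕-cong ≋-refl (≋-trans (∷-cong e ≋-refl) 0∷[])) (⊕-identityʳ _))

    syntheticQuotient-bounded : ∀ n a p → Bounded n p → ∀ k → n ℕ.≤ k → coef (syntheticQuotient a p) k ≈ 0#
    syntheticQuotient-bounded n a [] b k h = refl
    syntheticQuotient-bounded zero a (c ∷ p) b zero h = eval-zero a p (mk≋ λ k → b (suc k) z<s)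
    syntheticQuotient-bounded zero a (c ∷ p) b (suc k) h = syntheticQuotient-bounded zero a p
        (λ k h → b (suc k) z<s) k z≤n
    syntheticQuotient-bounded (suc n) a (c ∷ p) b (suc k) (s≤s h) = syntheticQuotient-bounded n a p
        (λ k h → b (suc k) (s<s h)) k h

  opaque
    unfolding _⊛_

    syntheticQuotient-monic : ∀ {n} a p → IsMonic (suc n) p → IsMonic n (syntheticQuotient a p)
    syntheticQuotient-monic {n} a p (t , b) = top , λ k h → bound k h
      where
      bound : ∀ k → suc n ℕ.≤ k → coef (syntheticQuotient a p) k ≈ 0#
      bound = syntheticQuotient-bounded (suc n) a p b
      q : List Carrier
      q = syntheticQuotient a p
      top : coef q n ≈ 1#
      top = begin
        coef q n ≈⟨ solve 2 (λ x a → x := :- a :* con (+ 0) :+ x :+ con (+ 0)) refl (coef q n) a ⟩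
        - a * 0# + coef q n + 0# ≈⟨ +-congʳ
            (+-congʳ (trans (coef-scale (- a) q (suc n)) (*-congˡ (bound (suc n) ℕP.≤-refl)))) ⟨
        coef (scale (- a) q) (suc n) + coef (0# ∷ q) (suc n) + 0#
          ≈⟨ trans (coef-⊕ (linear a ⊛ q) _ (suc n))
              (+-congʳ (trans (at (linear-⊛ a q) (suc n)) (coef-⊕ (scale (- a) q) _ (suc n)))) ⟨
        coef (linear a ⊛ q ⊕ const (eval a p)) (suc n) ≈⟨ at (syntheticQuotient-spec a p) (suc n) ⟨
        coef p (suc n) ≈⟨ t ⟩
        1# ∎

-- Splitting extensions

record RingHom (R S : CommutativeRing 0ℓ 0ℓ) : Set where
  private
    module R = RingKit R
    module S = RingKit S
  field
    ⟦_⟧ : R.Carrier → S.Carrier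
    ⟦⟧-cong : ∀ {x y} → x R.≈ y → ⟦ x ⟧ S.≈ ⟦ y ⟧
    +-homo : ∀ x y → ⟦ x R.+ y ⟧ S.≈ ⟦ x ⟧ S.+ ⟦ y ⟧
    *-homo : ∀ x y → ⟦ x R.* y ⟧ S.≈ ⟦ x ⟧ S.* ⟦ y ⟧
    1-homo : ⟦ R.1# ⟧ S.≈ S.1#

  0-homo : ⟦ R.0# ⟧ S.≈ S.0#
  0-homo = S.x+x≈x⇒x≈0 _ (S.trans (S.sym (+-homo R.0# R.0#)) (⟦⟧-cong (R.+-identityˡ R.0#)))

  -‿homo : ∀ x → ⟦ R.- x ⟧ S.≈ S.- ⟦ x ⟧
  -‿homo x = S.begin
    ⟦ R.- x ⟧ S.≈⟨ S.solve 2 (λ x y → y S.:= (x S.:+ y) S.:- x) S.refl ⟦ x ⟧ ⟦ R.- x ⟧ ⟩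
    (⟦ x ⟧ S.+ ⟦ R.- x ⟧) S.- ⟦ x ⟧
      S.≈⟨ S.+-congʳ (S.trans (S.sym (+-homo x (R.- x))) (S.trans (⟦⟧-cong (R.-‿inverseʳ x)) 0-homo)) ⟩
    S.0# S.- ⟦ x ⟧ S.≈⟨ S.+-identityˡ _ ⟩
    S.- ⟦ x ⟧ S.∎

  Injective : Set
  Injective = ∀ {x y} → ⟦ x ⟧ S.≈ ⟦ y ⟧ → x R.≈ y

idHom : ∀ R → RingHom R R
idHom R = record { ⟦_⟧ = λ x → x ; ⟦⟧-cong = λ e → e ; +-homo = λ _ _ → refl ; *-homo = λ _ _ → refl ; 1-homo =
    refl }
  where open CommutativeRing R

_∘ʰ_ : ∀ {R S T} → RingHom S T → RingHom R S → RingHom R T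
_∘ʰ_ {R} {S} {T} g f = record
  { ⟦_⟧ = λ x → g.⟦ f.⟦ x ⟧ ⟧ ; ⟦⟧-cong = λ e → g.⟦⟧-cong (f.⟦⟧-cong e)
  ; +-homo = λ x y → T.trans (g.⟦⟧-cong (f.+-homo x y)) (g.+-homo _ _)
  ; *-homo = λ x y → T.trans (g.⟦⟧-cong (f.*-homo x y)) (g.*-homo _ _)
  ; 1-homo = T.trans (g.⟦⟧-cong f.1-homo) g.1-homo }
  where
  module g = RingHom g
  module f = RingHom f
  module T = CommutativeRing T

module PolynomialMap {R S : CommutativeRing 0ℓ 0ℓ} (h : RingHom R S) where
  open RingHom h
  private
    module R = RingKit R
    module S = RingKit S
    module RP = Polynomials R
    module SP = Polynomials S

  mapP : List R.Carrier → List S.Carrier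
  mapP = map ⟦_⟧

  coef-map : ∀ p k → SP.coef (mapP p) k S.≈ ⟦ RP.coef p k ⟧
  coef-map [] k = S.sym 0-homo
  coef-map (a ∷ p) zero = S.refl
  coef-map (a ∷ p) (suc k) = coef-map p k

  map-cong : ∀ {p q} → p RP.≋ q → mapP p SP.≋ mapP q
  map-cong {p} {q} e = SP.mk≋ λ k → S.trans (coef-map p k) (S.trans (⟦⟧-cong (RP.at e k)) (S.sym (coef-map q k)))

  opaque
    unfolding Polynomials._⊛_

    map-⊕ : ∀ p q → mapP (p RP.⊕ q) SP.≋ mapP p SP.⊕ mapP q
    map-⊕ [] q = SP.≋-refl
    map-⊕ (a ∷ p) [] = SP.≋-refl
    map-⊕ (a ∷ p) (b ∷ q) = SP.∷-cong (+-homo a b) (map-⊕ p q)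

    map-scale : ∀ c p → mapP (RP.scale c p) SP.≋ SP.scale ⟦ c ⟧ (mapP p)
    map-scale c [] = SP.≋-refl
    map-scale c (a ∷ p) = SP.∷-cong (*-homo c a) (map-scale c p)

    map-⊛ : ∀ p q → mapP (p RP.⊛ q) SP.≋ mapP p SP.⊛ mapP q
    map-⊛ [] q = SP.≋-refl
    map-⊛ (a ∷ p) q = SP.≋-trans (map-⊕ (RP.scale a q) _) (SP.⊕-cong (map-scale a q) (SP.∷-cong 0-homo (map-⊛ p q)))

  map-D : ∀ p → mapP (RP.D p) SP.≋ SP.D (mapP p)
  map-D [] = SP.≋-refl
  map-D (a ∷ p) = SP.≋-trans (map-⊕ p _) (SP.⊕-cong (SP.≋-refl {mapP p}) (SP.∷-cong 0-homo (map-D p)))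

  map-eval : ∀ s p → ⟦ RP.eval s p ⟧ S.≈ SP.eval ⟦ s ⟧ (mapP p)
  map-eval s [] = 0-homo
  map-eval s (a ∷ p) = S.trans (+-homo a _) (S.+-congˡ (S.trans (*-homo s _) (S.*-congˡ (map-eval s p))))

  map-linear : ∀ a → mapP (RP.linear a) SP.≋ SP.linear ⟦ a ⟧
  map-linear a = SP.∷-cong (-‿homo a) (SP.∷-cong 1-homo SP.≋-refl)

  map-monic : ∀ {n p} → RP.IsMonic n p → SP.IsMonic n (mapP p)
  map-monic {n} {p} m = record
    { leading≈1 = S.trans (coef-map p n) (S.trans (⟦⟧-cong (RP.leading≈1 m)) 1-homo)
    ; monic-bounded = λ k k>n → S.trans (coef-map p k) (S.trans (⟦⟧-cong (RP.monic-bounded m k k>n)) 0-homo) }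

module PrincipalQuotient (R : CommutativeRing 0ℓ 0ℓ) (f : CommutativeRing.Carrier R) where
  open RingKit R

  infix 4 _~_
  -- The quotient ring keeps the carrier and the operations of R; only its equality is replaced by
  -- this congruence modulo f.
  record _~_ (x y : Carrier) : Set where
    constructor mk~
    field
      multiplier : Carrier
      difference : x ≈ y + multiplier * f

  ≈⇒~ : ∀ {x y} → x ≈ y → x ~ y
  ≈⇒~ e = mk~ 0# (trans e (solve 2 (λ y f → y := y :+ con (+ 0) :* f) refl _ f))

  ~-sym : ∀ {x y} → x ~ y → y ~ x
  ~-sym {x} {y} (mk~ c e) = mk~ (- c)
      (trans (solve 3 (λ y c f → y := y :+ c :* f :+ :- c :* f) refl y c f) (+-congʳ (sym e)))

  ~-trans : ∀ {x y z} → x ~ y → y ~ z → x ~ z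
  ~-trans {z = z} (mk~ c e) (mk~ d e′) = mk~ (d + c) (trans e (trans (+-congʳ e′)
    (solve 4 (λ z d c f → z :+ d :* f :+ c :* f := z :+ (d :+ c) :* f) refl z d c f)))

  +-cong~ : ∀ {x x′ y y′} → x ~ x′ → y ~ y′ → x + y ~ x′ + y′
  +-cong~ {x′ = x′} {y′ = y′} (mk~ c e) (mk~ d e′) = mk~ (c + d) (trans (+-cong e e′)
    (solve 5 (λ x c y d f → x :+ c :* f :+ (y :+ d :* f) := x :+ y :+ (c :+ d) :* f) refl x′ c y′ d f))

  *-cong~ : ∀ {x x′ y y′} → x ~ x′ → y ~ y′ → x * y ~ x′ * y′
  *-cong~ {x′ = x′} {y′ = y′} (mk~ c e) (mk~ d e′) = mk~ (c * y′ + x′ * d + c * d * f) (trans (*-cong e e′)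
    (solve 5 (λ x c y d f → (x :+ c :* f) :* (y :+ d :* f) := x :* y :+ (c :* y :+ x :* d :+ c :* d :* f) :* f)
        refl x′ c y′ d f))

  -‿cong~ : ∀ {x x′} → x ~ x′ → - x ~ - x′
  -‿cong~ {x′ = x′} (mk~ c e) = mk~ (- c) (trans (-‿cong e)
    (solve 3 (λ x c f → :- (x :+ c :* f) := :- x :+ :- c :* f) refl x′ c f))

  quotientRing : CommutativeRing 0ℓ 0ℓ
  quotientRing = record
    { Carrier = Carrier ; _≈_ = _~_ ; _+_ = _+_ ; _*_ = _*_ ; -_ = -_ ; 0# = 0# ; 1# = 1#
    ; isCommutativeRing = record
      { isRing = record
        { +-isAbelianGroup = record
          { isGroup = record
            { isMonoid = record
              { isSemigroup = record
                { isMagma = record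
                  { isEquivalence = record { refl = ≈⇒~ refl ; sym = ~-sym ; trans = ~-trans }
                  ; ∙-cong = +-cong~ }
                ; assoc = λ x y z → ≈⇒~ (+-assoc x y z) }
              ; identity = (λ x → ≈⇒~ (+-identityˡ x)) , λ x → ≈⇒~ (+-identityʳ x) }
            ; inverse = (λ x → ≈⇒~ (-‿inverseˡ x)) , λ x → ≈⇒~ (-‿inverseʳ x)
            ; ⁻¹-cong = -‿cong~ }
          ; comm = λ x y → ≈⇒~ (+-comm x y) }
        ; *-cong = *-cong~
        ; *-assoc = λ x y z → ≈⇒~ (*-assoc x y z)
        ; *-identity = (λ x → ≈⇒~ (*-identityˡ x)) , λ x → ≈⇒~ (*-identityʳ x)
        ; distrib = (λ x y z → ≈⇒~ (distribˡ x y z)) , λ x y z → ≈⇒~ (distribʳ x y z) }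
      ; *-comm = λ x y → ≈⇒~ (*-comm x y) } }

-- Injectivity is what carries an identity found among the roots back to R.
record Extension (R : CommutativeRing 0ℓ 0ℓ) : Set₁ where
  field
    ring : CommutativeRing 0ℓ 0ℓ
    embedding : RingHom R ring
    injective : RingHom.Injective embedding

module Adjoin (R : CommutativeRing 0ℓ 0ℓ) {n} (f : List (CommutativeRing.Carrier R))
  (monic : Polynomials.IsMonic R (suc n) f) where
  open RingKit R
  open Polynomials R
  open PrincipalQuotient polynomialRing f

  constHom : RingHom R quotientRing
  constHom = record
    { ⟦_⟧ = const ; ⟦⟧-cong = λ e → ≈⇒~ (∷-cong e ≋-refl)
    ; +-homo = λ x y → ≈⇒~ (const-⊕ x y) ; *-homo = λ x y → ≈⇒~ (const-⊛ x y) ; 1-homo = ≈⇒~ ≋-refl }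

  extension : Extension R
  extension = record { ring = quotientRing ; embedding = constHom ; injective = injective }
    where
    injective : ∀ {x y} → const x ~ const y → x ≈ y
    injective {x} {y} (mk~ c e) = trans (at e 0) (trans (coef-⊕ (const y) (c ⊛ f) 0)
      (trans (+-congˡ (at (≋-trans (⊛-cong c≋0 (≋-refl {f})) ([]-⊛ f)) 0)) (+-identityʳ y)))
      where
      c≋0 : c ≋ []
      -- The multiple of f is a difference of constants while f has positive degree, so the
      -- multiplier vanishes. Hence the degree of the form `suc n`.
      c≋0 = monic-multiple-bounded (suc n) f c monic λ { (suc k) _ →
        trans (sym (+-identityˡ _)) (trans (sym (coef-⊕ (const y) (c ⊛ f) (suc k))) (sym (at e (suc k)))) }

  private
    module Q = Polynomials quotientRing

  eval-X : ∀ p → Q.eval X (map const p) ≋ p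
  eval-X [] = ≋-refl
  eval-X (a ∷ p) = ≋-trans (⊕-cong (≋-refl {const a}) (⊛-congˡ X (eval-X p))) (≋-sym (∷-≋ a p))

  -- Evaluating a polynomial at the class of X returns that polynomial, and f is 0 modulo itself.
  root : Q.eval X (map const f) ~ []
  root = mk~ (const 1#) (≋-trans (eval-X f) (≋-sym (≋-trans (⊕-identityˡ _) (⊛-identityˡ f))))

abstract
 adjoinRoot : ∀ R {n} f → Polynomials.IsMonic R (suc n) f →
   Σ (Extension R) λ E → let open Extension E in
     ∃ λ x → CommutativeRing._≈_ ring (Polynomials.eval ring x (map (RingHom.⟦_⟧ embedding) f))
         (CommutativeRing.0# ring)
 adjoinRoot R f monic = extension , Polynomials.X R , root
   where open Adjoin R f monic

_∘ᵉ_ : ∀ {R} (E : Extension R) → Extension (Extension.ring E) → Extension R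
E ∘ᵉ F = record { ring = F.ring ; embedding = F.embedding ∘ʰ E.embedding ; injective = λ e → E.injective
    (F.injective e) }
  where
  module E = Extension E
  module F = Extension F

-- w and v are inverse roots of Φ, and ± r are the corresponding roots of Ψ.
record RootPair (R : CommutativeRing 0ℓ 0ℓ) : Set where
  open RingKit R
  field
    w v r : Carrier
    wv≈1 : w * v ≈ 1#
    r²≈ : r * r ≈ - (w + v + fromℤ (+ 2))

mapRootPair : ∀ {R S} → RingHom R S → RootPair R → RootPair S
mapRootPair {R} {S} h t = record
  { w = ⟦ w ⟧ ; v = ⟦ v ⟧ ; r = ⟦ r ⟧
  ; wv≈1 = S.trans (S.sym (*-homo w v)) (S.trans (⟦⟧-cong wv≈1) 1-homo)
  ; r²≈ = S.trans (S.sym (*-homo r r)) (S.trans (⟦⟧-cong r²≈) (S.trans (-‿homo _)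
      (S.-‿cong (S.trans (+-homo _ _)
          (S.+-cong (+-homo w v) (S.trans (+-homo R.1# R.1#) (S.+-cong 1-homo 1-homo))))))) }
  where
  module R = RingKit R
  module S = RingKit S
  open RingHom h
  open RootPair t

module _ (R : CommutativeRing 0ℓ 0ℓ) where
  open RingKit R
  open Polynomials R

  squareRoots : List (RootPair R) → List Carrier
  squareRoots = map λ t → RootPair.r t * RootPair.r t

  rootProduct : List Carrier → List Carrier
  rootProduct = foldr (λ a → linear a ⊛_) (const 1#)

-- Three adjunctions: a root g of G, a square root r of g, and a root w of x² + (r² + 2) x + 1. The
-- other root v = - (r² + 2) - w of this quadratic is then the inverse of w.
adjoinRootPair : ∀ R {n} G → Polynomials.IsMonic R (suc n) G →
  Σ (Extension R) λ E → let open Extension E in Σ (RootPair ring) λ t → let open RootPair t in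
    CommutativeRing._≈_ ring (Polynomials.eval ring (CommutativeRing._*_ ring r r) (map (RingHom.⟦_⟧ embedding) G))
        (CommutativeRing.0# ring)
adjoinRootPair R {n} G monic = E , t , root
  where
  E₁ = adjoinRoot R G monic
  module E₁ = Extension (proj₁ E₁)
  R₁ = E₁.ring
  g = proj₁ (proj₂ E₁)
  module R₁ = RingKit R₁
  quadratic : (S : CommutativeRing 0ℓ 0ℓ) → (a b : CommutativeRing.Carrier S) → Polynomials.IsMonic S 2
      (a ∷ b ∷ CommutativeRing.1# S ∷ [])
  quadratic S a b = record { leading≈1 = CommutativeRing.refl S ; monic-bounded =
      λ { (suc (suc (suc k))) _ → CommutativeRing.refl S ; (suc (suc zero)) (s≤s (s≤s ())) ; (suc zero) (s≤s ()) } }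
  E₂ = adjoinRoot R₁ (R₁.- g ∷ R₁.0# ∷ R₁.1# ∷ []) (quadratic R₁ (R₁.- g) R₁.0#)
  module E₂ = Extension (proj₁ E₂)
  R₂ = E₂.ring
  module R₂ = RingKit R₂
  r₂ = proj₁ (proj₂ E₂)
  E₃ = adjoinRoot R₂ (R₂.1# ∷ r₂ R₂.* r₂ R₂.+ R₂.fromℤ (+ 2) ∷ R₂.1# ∷ [])
      (quadratic R₂ R₂.1# (r₂ R₂.* r₂ R₂.+ R₂.fromℤ (+ 2)))
  module E₃ = Extension (proj₁ E₃)
  open RingKit E₃.ring
  w = proj₁ (proj₂ E₃)
  module h₂ = RingHom E₂.embedding
  module h₃ = RingHom E₃.embedding
  E = proj₁ E₁ ∘ᵉ (proj₁ E₂ ∘ᵉ proj₁ E₃)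
  r = h₃.⟦ r₂ ⟧
  s = r * r + fromℤ (+ 2)
  r₂²≈g : r₂ R₂.* r₂ R₂.≈ h₂.⟦ g ⟧
  r₂²≈g = R₂.begin
    r₂ R₂.* r₂ R₂.≈⟨ R₂.solve 2
        (λ g r → r R₂.:* r R₂.:= g R₂.:+
            (R₂.:- g R₂.:+ r R₂.:* (R₂.con (+ 0) R₂.:+ r R₂.:* (R₂.con (+ 1) R₂.:+ r R₂.:* R₂.con (+ 0))))) R₂.refl
                h₂.⟦ g ⟧ r₂ ⟩
    h₂.⟦ g ⟧ R₂.+ (R₂.- h₂.⟦ g ⟧ R₂.+ r₂ R₂.* (R₂.0# R₂.+ r₂ R₂.* (R₂.1# R₂.+ r₂ R₂.* R₂.0#)))
      R₂.≈⟨ R₂.+-congˡ (R₂.+-cong (h₂.-‿homo g)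
          (R₂.*-congˡ (R₂.+-cong h₂.0-homo (R₂.*-congˡ (R₂.+-congʳ h₂.1-homo))))) ⟨
    h₂.⟦ g ⟧ R₂.+ Polynomials.eval R₂ r₂ (map h₂.⟦_⟧ (R₁.- g ∷ R₁.0# ∷ R₁.1# ∷ []))
        R₂.≈⟨ R₂.+-congˡ (proj₂ (proj₂ E₂)) ⟩
    h₂.⟦ g ⟧ R₂.+ R₂.0# R₂.≈⟨ R₂.+-identityʳ _ ⟩
    h₂.⟦ g ⟧ R₂.∎
  r²≈g : r * r ≈ h₃.⟦ h₂.⟦ g ⟧ ⟧
  r²≈g = trans (sym (h₃.*-homo r₂ r₂)) (h₃.⟦⟧-cong r₂²≈g)
  s-homo : h₃.⟦ r₂ R₂.* r₂ R₂.+ R₂.fromℤ (+ 2) ⟧ ≈ s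
  s-homo = trans (h₃.+-homo _ _)
      (+-cong (h₃.*-homo r₂ r₂) (trans (h₃.+-homo R₂.1# R₂.1#) (+-cong h₃.1-homo h₃.1-homo)))
  w-root : 1# + w * (s + w * (1# + w * 0#)) ≈ 0#
  w-root = trans (sym (+-cong h₃.1-homo (*-congˡ (+-cong s-homo (*-congˡ (+-congʳ h₃.1-homo)))))) (proj₂ (proj₂ E₃))
  t : RootPair E₃.ring
  t = record
    { w = w ; v = - s - w ; r = r
    ; wv≈1 = trans (solve 2 (λ w s → w :* (:- s :- w) := con (+ 1) :-
        (con (+ 1) :+ w :* (s :+ w :* (con (+ 1) :+ w :* con (+ 0))))) refl w s)
        (trans (+-congˡ (-‿cong w-root)) (solve 0 (con (+ 1) :- con (+ 0) := con (+ 1)) refl))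
    ; r²≈ = solve 2 (λ w r → r :* r := :- (w :+ (:- (r :* r :+ con (+ 2)) :- w) :+ con (+ 2))) refl w r }
  module P = Polynomials E₃.ring
  root : P.eval (r * r) (map (λ a → h₃.⟦ h₂.⟦ RingHom.⟦ E₁.embedding ⟧ a ⟧ ⟧) G) ≈ 0#
  root = begin
    P.eval (r * r) (map (λ a → h₃.⟦ h₂.⟦ RingHom.⟦ E₁.embedding ⟧ a ⟧ ⟧) G)
      ≡⟨ ≡.cong (P.eval (r * r)) (≡.trans (ListP.map-∘ G) (ListP.map-∘ (map (RingHom.⟦_⟧ E₁.embedding) G))) ⟩
    P.eval (r * r) (map h₃.⟦_⟧ (map h₂.⟦_⟧ (map (RingHom.⟦_⟧ E₁.embedding) G)))
        ≈⟨ eval-point (map h₃.⟦_⟧ (map h₂.⟦_⟧ (map (RingHom.⟦_⟧ E₁.embedding) G))) r²≈g ⟩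
    P.eval h₃.⟦ h₂.⟦ g ⟧ ⟧ (map h₃.⟦_⟧ (map h₂.⟦_⟧ (map (RingHom.⟦_⟧ E₁.embedding) G)))
      ≈⟨ trans (h₃.⟦⟧-cong (PolynomialMap.map-eval E₂.embedding g (map (RingHom.⟦_⟧ E₁.embedding) G)))
          (PolynomialMap.map-eval E₃.embedding h₂.⟦ g ⟧ (map h₂.⟦_⟧ (map (RingHom.⟦_⟧ E₁.embedding) G))) ⟨
    h₃.⟦ h₂.⟦ Polynomials.eval R₁ g (map (RingHom.⟦_⟧ E₁.embedding) G) ⟧ ⟧
      ≈⟨ h₃.⟦⟧-cong (h₂.⟦⟧-cong (proj₂ (proj₂ E₁))) ⟩
    h₃.⟦ h₂.⟦ R₁.0# ⟧ ⟧ ≈⟨ trans (h₃.⟦⟧-cong h₂.0-homo) h₃.0-homo ⟩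
    0# ∎
    where
    eval-point : ∀ {x y} p → x ≈ y → P.eval x p ≈ P.eval y p
    eval-point [] e = refl
    eval-point (a ∷ p) e = +-congˡ (*-cong e (eval-point p e))

-- A linear factor is divided out before the next root is adjoined: in a ring with zero divisors, a
-- list of distinct roots would not give a factorisation. Pairs found earlier are mapped into the
-- later extensions.
splitting : ∀ m R G → Polynomials.IsMonic R m G →
  Σ (Extension R) λ E → let open Extension E in
    ∃ λ ts → length ts ≡ m × Polynomials._≋_ ring (map (RingHom.⟦_⟧ embedding) G)
        (rootProduct ring (squareRoots ring ts))
splitting zero R G monic = record { ring = R ; embedding = idHom R ; injective = λ e → e } , [] , ≡.refl ,
  mk≋ λ k → trans (reflexive (≡.cong (λ l → coef l k) (ListP.map-id G))) (constant k)
  where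
  open RingKit R
  open Polynomials R
  constant : ∀ k → coef G k ≈ coef (const 1#) k
  constant zero = leading≈1 monic
  constant (suc k) = monic-bounded monic (suc k) z<s
splitting (suc m) R G monic = E ∘ᵉ F , mapRootPair F.embedding t ∷ ts , ≡.cong suc |ts|≡m , eq
  where
  step = adjoinRootPair R G monic
  E = proj₁ step
  module E = Extension E
  t = proj₁ (proj₂ step)
  a = CommutativeRing._*_ E.ring (RootPair.r t) (RootPair.r t)
  module EP = Polynomials E.ring
  module M = PolynomialMap E.embedding
  G₁ = EP.syntheticQuotient a (M.mapP G)
  rest = splitting m E.ring G₁ (EP.syntheticQuotient-monic a (M.mapP G) (M.map-monic {p = G} monic))
  F = proj₁ rest
  module F = Extension F
  ts = proj₁ (proj₂ rest)
  |ts|≡m = proj₁ (proj₂ (proj₂ rest))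
  module FP = Polynomials F.ring
  module N = PolynomialMap F.embedding
  module FR = CommutativeRing F.ring
  eq : map (λ x → RingHom.⟦ F.embedding ⟧ (RingHom.⟦ E.embedding ⟧ x)) G FP.≋ rootProduct F.ring
      (squareRoots F.ring (mapRootPair F.embedding t ∷ ts))
  eq = FP.≋-trans (FP.mk≋ λ k → FR.reflexive (≡.cong (λ l → FP.coef l k) (ListP.map-∘ G)))
    (FP.≋-trans (N.map-cong (EP.factor a (M.mapP G) (proj₂ (proj₂ step))))
    (FP.≋-trans (N.map-⊛ (EP.linear a) G₁)
    (FP.⊛-cong (FP.≋-trans (N.map-linear a) (FP.∷-cong (FR.-‿cong (RingHom.*-homo F.embedding _ _)) FP.≋-refl))
      (proj₂ (proj₂ (proj₂ rest))))))

-- Substitutions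

module Substitutions (R : CommutativeRing 0ℓ 0ℓ) where
  open RingKit R
  open Polynomials R

  -- p(x²)
  sq : List Carrier → List Carrier
  sq [] = []
  sq (a ∷ p) = a ∷ 0# ∷ sq p

  sq-zero : ∀ p → p ≋ [] → sq p ≋ []
  sq-zero [] e = ≋-refl
  sq-zero (a ∷ p) e = mk≋ λ where
    zero → at e 0
    (suc zero) → refl
    (suc (suc k)) → at (sq-zero p (mk≋ λ k → at e (suc k))) k

  sq-cong : ∀ p q → p ≋ q → sq p ≋ sq q
  sq-cong [] q e = ≋-sym (sq-zero q (≋-sym e))
  sq-cong (a ∷ p) [] e = sq-zero (a ∷ p) e
  sq-cong (a ∷ p) (b ∷ q) e = ∷-cong (at e 0) (∷-cong refl (sq-cong p q (tail-≋ e)))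

  sq-injective-zero : ∀ p → sq p ≋ [] → p ≋ []
  sq-injective-zero [] e = ≋-refl
  sq-injective-zero (a ∷ p) e = mk≋ λ where
    zero → at e 0
    (suc k) → at (sq-injective-zero p (mk≋ λ k → at e (suc (suc k)))) k

  opaque
    unfolding _⊛_

    sq-⊕ : ∀ p q → sq (p ⊕ q) ≋ sq p ⊕ sq q
    sq-⊕ [] q = ≋-refl
    sq-⊕ (a ∷ p) [] = ≋-refl
    sq-⊕ (a ∷ p) (b ∷ q) = ∷-cong refl (∷-cong (sym (+-identityˡ 0#)) (sq-⊕ p q))

    sq-scale : ∀ c p → sq (scale c p) ≋ scale c (sq p)
    sq-scale c [] = ≋-refl
    sq-scale c (a ∷ p) = ∷-cong refl (∷-cong (sym (zeroʳ c)) (sq-scale c p))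

    sq-⊛ : ∀ p q → sq (p ⊛ q) ≋ sq p ⊛ sq q
    sq-⊛ [] q = ≋-refl
    sq-⊛ (a ∷ p) q = ≋-trans (sq-⊕ (scale a q) (0# ∷ (p ⊛ q)))
      (⊕-cong (sq-scale a q) (∷-cong refl (≋-trans (∷-cong refl (sq-⊛ p q)) (≋-sym (0∷-⊛ (sq p) (sq q))))))

  sq-bounded : ∀ n p → Bounded n p → Bounded (n ℕ.+ n) (sq p)
  sq-bounded n [] b k h = refl
  sq-bounded n (a ∷ p) b (suc zero) h = refl
  sq-bounded zero (a ∷ p) b (suc (suc k)) h = at (sq-zero p (mk≋ λ k → b (suc k) z<s)) k
  sq-bounded (suc n) (a ∷ p) b (suc (suc k)) (s≤s h) = sq-bounded n p (λ k h → b (suc k) (s<s h)) k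
    (ℕ.s≤s⁻¹ (≡.subst (ℕ._< suc k) (ℕP.+-suc n n) h))

  sq-bounded-below : ∀ n p → (∀ k → n ℕ.≤ k → coef p k ≈ 0#) → ∀ k → n ℕ.+ n ℕ.≤ k → coef (sq p) k ≈ 0#
  sq-bounded-below zero p b k h = at (sq-zero p (mk≋ λ k → b k z≤n)) k
  sq-bounded-below (suc n) p b k h = sq-bounded n p b k (ℕP.<-≤-trans (s<s (ℕP.+-monoʳ-≤ n (ℕP.n≤1+n n))) h)

  coef-sq : ∀ n p → coef (sq p) (n ℕ.+ n) ≈ coef p n
  coef-sq n [] = refl
  coef-sq zero (a ∷ p) = refl
  coef-sq (suc n) (a ∷ p) = trans (reflexive (≡.cong (coef (0# ∷ sq p)) (ℕP.+-suc n n))) (coef-sq n p)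

  sq-monic : ∀ {n} p → IsMonic n p → IsMonic (n ℕ.+ n) (sq p)
  sq-monic {n} p (t , b) = trans (coef-sq n p) t , sq-bounded n p b

  [x+1]² negX : List Carrier
  [x+1]² = 1# ∷ 1# + 1# ∷ 1# ∷ []
  negX = 0# ∷ - 1# ∷ []

  infixr 8 _^ᵖ_
  _^ᵖ_ : List Carrier → ℕ → List Carrier
  p ^ᵖ zero = const 1#
  p ^ᵖ suc n = p ⊛ p ^ᵖ n

  ^ᵖ-+ : ∀ p m n → p ^ᵖ (m ℕ.+ n) ≋ p ^ᵖ m ⊛ p ^ᵖ n
  ^ᵖ-+ p zero n = ≋-sym (⊛-identityˡ _)
  ^ᵖ-+ p (suc m) n = ≋-trans (⊛-congˡ p (^ᵖ-+ p m n)) (≋-sym (⊛-assoc p _ _))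

  -- (-x)ᵐ F(-(x + 1)² / x): it sends y - (z - z⁻¹)² to (x - w) (x - w⁻¹) with w = -z².
  homog : ℕ → (ℕ → Carrier) → List Carrier
  homog zero F = const (F 0)
  homog (suc m) F = scale (F 0) (negX ^ᵖ suc m) ⊕ [x+1]² ⊛ homog m (λ k → F (suc k))

  homog-cong : ∀ m {F G} → (∀ k → F k ≈ G k) → homog m F ≋ homog m G
  homog-cong zero e = ∷-cong (e 0) ≋-refl
  homog-cong (suc m) e = ⊕-cong (scale-cong (e 0) (≋-refl {negX ^ᵖ suc m}))
      (⊛-congˡ [x+1]² (homog-cong m λ k → e (suc k)))

  scale-+ : ∀ c d p → scale (c + d) p ≋ scale c p ⊕ scale d p
  scale-+ c d p = mk≋ λ k → trans (coef-scale (c + d) p k) (trans (distribʳ _ c d)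
    (sym (trans (coef-⊕ (scale c p) _ k) (+-cong (coef-scale c p k) (coef-scale d p k)))))

  homog-+ : ∀ m F G → homog m (λ k → F k + G k) ≋ homog m F ⊕ homog m G
  homog-+ zero F G = const-⊕ (F 0) (G 0)
  homog-+ (suc m) F G = ≋-trans
    (⊕-cong (scale-+ (F 0) (G 0) (negX ^ᵖ suc m))
        (≋-trans (⊛-congˡ [x+1]² (homog-+ m _ _)) (⊛-distribˡ [x+1]² (homog m _) (homog m _))))
    (⊕-interchange (scale (F 0) (negX ^ᵖ suc m)) (scale (G 0) (negX ^ᵖ suc m)) ([x+1]² ⊛ homog m _)
        ([x+1]² ⊛ homog m _))

  homog-* : ∀ m c F → homog m (λ k → c * F k) ≋ scale c (homog m F)
  homog-* zero c F = ≋-trans (const-⊛ c (F 0)) (≋-sym (scale-const c (const (F 0))))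
  homog-* (suc m) c F = ≋-trans
    (⊕-cong (scale-scale c (F 0) (negX ^ᵖ suc m)) (≋-trans (⊛-congˡ [x+1]² (homog-* m c _))
      (≋-trans (⊛-comm [x+1]² _) (≋-trans (scale-⊛ c _ [x+1]²) (scale-cong refl (⊛-comm _ [x+1]²))))))
    (≋-sym (scale-⊕ c _ ([x+1]² ⊛ homog m _)))

  homog-0 : ∀ m F → (∀ k → F k ≈ 0#) → homog m F ≋ []
  homog-0 zero F z = ≋-trans (∷-cong (z 0) ≋-refl) 0∷[]
  homog-0 (suc m) F z = ≋-trans
    (⊕-cong (mk≋ λ k → trans (coef-scale (F 0) (negX ^ᵖ suc m) k) (trans (*-congʳ (z 0)) (zeroˡ _)))
      (≋-trans (⊛-congˡ [x+1]² (homog-0 m _ λ k → z (suc k))) (⊛-zeroʳ [x+1]²)))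
    (⊕-identityˡ [])

  -- The degree is a formal argument, and each vanishing leading coefficient included in it costs a
  -- factor -x.
  homog-raise : ∀ m n F → (∀ k → n ℕ.< k → F k ≈ 0#) → homog (m ℕ.+ n) F ≋ negX ^ᵖ m ⊛ homog n F
  homog-raise m (suc n) F b = ≋-trans (mk≋ λ k → reflexive (≡.cong (λ j → coef (homog j F) k) (ℕP.+-suc m n)))
      (P.begin
    scale (F 0) (negX ⊛ negX ^ᵖ (m ℕ.+ n)) ⊕ [x+1]² ⊛ homog (m ℕ.+ n) (λ k → F (suc k))
      P.≈⟨ ⊕-cong (≋-trans (scale-const (F 0) _) (⊛-congˡ (const (F 0)) (⊛-congˡ negX (^ᵖ-+ negX m n))))
             (⊛-congˡ [x+1]² (homog-raise m n _ λ k h → b (suc k) (s<s h))) ⟩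
    const (F 0) ⊛ (negX ⊛ (negX ^ᵖ m ⊛ negX ^ᵖ n)) ⊕ [x+1]² ⊛ (negX ^ᵖ m ⊛ homog n _)
      P.≈⟨ P.solve 6 (λ c b bm bn a h → c P.:* (b P.:* (bm P.:* bn)) P.:+ a P.:* (bm P.:* h)
             P.:= bm P.:* (c P.:* (b P.:* bn) P.:+ a P.:* h)) ≋-refl (const (F 0)) negX (negX ^ᵖ m) (negX ^ᵖ n)
                 [x+1]² (homog n _) ⟩
    negX ^ᵖ m ⊛ (const (F 0) ⊛ (negX ⊛ negX ^ᵖ n) ⊕ [x+1]² ⊛ homog n _)
      P.≈⟨ ⊛-congˡ (negX ^ᵖ m) (⊕-cong (≋-sym (scale-const (F 0) (negX ⊛ negX ^ᵖ n)))
          (≋-refl {[x+1]² ⊛ homog n _})) ⟩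
    negX ^ᵖ m ⊛ homog (suc n) F P.∎)
  homog-raise zero zero F b = ≋-sym (⊛-identityˡ _)
  homog-raise (suc m) zero F b = ≋-trans
      (mk≋ λ k → reflexive (≡.cong (λ j → coef (homog j F) k) (ℕP.+-identityʳ (suc m)))) (≋-trans
    (⊕-cong (≋-trans (scale-const (F 0) _) (⊛-comm (const (F 0)) _))
        (≋-trans (⊛-congˡ [x+1]² (homog-0 m _ λ k → b (suc k) z<s)) (⊛-zeroʳ [x+1]²)))
    (⊕-identityʳ (negX ^ᵖ suc m ⊛ const (F 0))))

  -- Homogenisation is multiplicative for formal degrees, so bounds on the degrees suffice. In the
  -- recursion on p, `homog-raise` treats the constant coefficient.
  homog-⊛ : ∀ m n p q → Bounded m p → Bounded n q →
    homog (m ℕ.+ n) (coef (p ⊛ q)) ≋ homog m (coef p) ⊛ homog n (coef q)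
  homog-⊛ m n [] q bp bq = ≋-trans (homog-0 (m ℕ.+ n) _ λ k → at ([]-⊛ q) k)
    (≋-sym (≋-trans (⊛-cong (homog-0 m (coef []) λ k → refl) (≋-refl {homog n (coef q)})) ([]-⊛ _)))
  homog-⊛ zero n (a ∷ p) q bp bq = ≋-trans
    (homog-cong n {G = λ k → a * coef q k} λ k → trans
        (at (⊛-cong {a ∷ p} {const a} {q} (∷-cong refl (mk≋ λ k → bp (suc k) z<s)) (≋-refl {q})) k)
      (trans (at (≋-sym (scale-const a q)) k) (coef-scale a q k)))
    (≋-trans (homog-* n a (coef q)) (scale-const a _))
  homog-⊛ (suc m) n (a ∷ p) q bp bq = P.begin
    homog (suc m ℕ.+ n) (coef ((a ∷ p) ⊛ q))
      P.≈⟨ homog-cong (suc m ℕ.+ n) (λ k → coef-⊛ a p q k) ⟩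
    homog (suc m ℕ.+ n) (λ k → a * coef q k + coef (0# ∷ (p ⊛ q)) k)
      P.≈⟨ homog-+ (suc m ℕ.+ n) (λ k → a * coef q k) (coef (0# ∷ (p ⊛ q))) ⟩
    homog (suc m ℕ.+ n) (λ k → a * coef q k) ⊕ homog (suc m ℕ.+ n) (coef (0# ∷ (p ⊛ q)))
      P.≈⟨ ⊕-cong
        (≋-trans (homog-* (suc m ℕ.+ n) a (coef q))
            (≋-trans (scale-cong refl (homog-raise (suc m) n (coef q) bq))
                (≋-sym (scale-⊛ a (negX ^ᵖ suc m) (homog n (coef q))))))
        (≋-trans (⊕-cong {q = [x+1]² ⊛ homog (m ℕ.+ n) (coef (p ⊛ q))}
            (mk≋ λ k → trans (coef-scale 0# (negX ^ᵖ suc (m ℕ.+ n)) k) (zeroˡ _)) ≋-refl)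
          (≋-trans (⊕-identityˡ _) (≋-trans (⊛-congˡ [x+1]² (homog-⊛ m n p q (λ k h → bp (suc k) (s<s h)) bq))
              (≋-sym (⊛-assoc [x+1]² _ _))))) ⟩
    scale a (negX ^ᵖ suc m) ⊛ homog n (coef q) ⊕ [x+1]² ⊛ homog m (coef p) ⊛ homog n (coef q)
      P.≈⟨ ⊛-distribʳ (homog n (coef q)) (scale a (negX ^ᵖ suc m)) ([x+1]² ⊛ homog m (coef p)) ⟨
    homog (suc m) (coef (a ∷ p)) ⊛ homog n (coef q) P.∎

  negX^-bounded : ∀ m → Bounded m (negX ^ᵖ m)
  negX^-bounded zero (suc k) _ = refl
  negX^-bounded (suc m) = proj₂
      (⊛-top 1 m negX (negX ^ᵖ m) (λ { (suc (suc k)) _ → refl ; (suc zero) (s≤s ()) }) (negX^-bounded m))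

  -- Among the terms (-x)ᵐ⁻ᵏ (x + 1)²ᵏ, of degree m + k, only the one with k = m reaches degree 2m.
  homog-monic : ∀ m F → F m ≈ 1# → IsMonic (m ℕ.+ m) (homog m F)
  homog-monic zero F e = e , λ { (suc k) _ → refl }
  homog-monic (suc m) F e rewrite ℕP.+-suc m m with ⊛-monic {2} {m ℕ.+ m} {[x+1]²} {homog m (λ k → F (suc k))}
      (refl , λ { (suc (suc (suc k))) _ → refl ; (suc (suc zero)) (s≤s (s≤s ())) ; (suc zero) (s≤s ()) })
          (homog-monic m (λ k → F (suc k)) e)
  ... | t , b = trans (coef-⊕ (scale (F 0) (negX ^ᵖ suc m)) _ _)
      (trans (+-cong (low _ (s<s (s≤s (ℕP.m≤m+n m m)))) t) (+-identityˡ _)) ,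
      λ k h → trans (coef-⊕ (scale (F 0) (negX ^ᵖ suc m)) _ k)
          (trans (+-cong (low k (ℕP.<-trans (s<s (s≤s (ℕP.m≤m+n m m))) h)) (b k h)) (+-identityˡ _))
    where
    low : ∀ k → suc m ℕ.< k → coef (scale (F 0) (negX ^ᵖ suc m)) k ≈ 0#
    low k h = trans (coef-scale (F 0) (negX ^ᵖ suc m) k) (trans (*-congˡ (negX^-bounded (suc m) k h)) (zeroʳ _))

module SubstitutionMap {R S : CommutativeRing 0ℓ 0ℓ} (h : RingHom R S) where
  open RingHom h
  open PolynomialMap h
  private
    module R = RingKit R
    module S = RingKit S
    module RP = Polynomials R
    module SP = Polynomials S
    module RT = Substitutions R
    module ST = Substitutions S

  map-sq : ∀ p → mapP (RT.sq p) SP.≋ ST.sq (mapP p)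
  map-sq [] = SP.≋-refl
  map-sq (a ∷ p) = SP.∷-cong S.refl (SP.∷-cong 0-homo (map-sq p))

  map-negX^ : ∀ m → mapP (RT.negX RT.^ᵖ m) SP.≋ ST.negX ST.^ᵖ m
  map-negX^ zero = SP.∷-cong 1-homo SP.≋-refl
  map-negX^ (suc m) = SP.≋-trans (map-⊛ RT.negX (RT.negX RT.^ᵖ m))
    (SP.⊛-cong (SP.∷-cong 0-homo (SP.∷-cong (S.trans (-‿homo R.1#) (S.-‿cong 1-homo)) SP.≋-refl)) (map-negX^ m))

  map-homog : ∀ m F → mapP (RT.homog m F) SP.≋ ST.homog m (λ k → ⟦ F k ⟧)
  map-homog zero F = SP.≋-refl
  map-homog (suc m) F = SP.≋-trans (map-⊕ (RP.scale (F 0) (RT.negX RT.^ᵖ suc m)) _)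
    (SP.⊕-cong (SP.≋-trans (map-scale (F 0) (RT.negX RT.^ᵖ suc m)) (SP.scale-cong S.refl (map-negX^ (suc m))))
      (SP.≋-trans (map-⊛ RT.[x+1]² (RT.homog m _))
        (SP.⊛-cong (SP.∷-cong 1-homo
            (SP.∷-cong (S.trans (+-homo _ _) (S.+-cong 1-homo 1-homo)) (SP.∷-cong 1-homo SP.≋-refl)))
                (map-homog m _))))

-- Resultants from roots

module RootProducts (R : CommutativeRing 0ℓ 0ℓ) where
  open RingKit R
  open Polynomials R
  open Determinants R hiding (Bounded)
  open Substitutions R

  rootProduct-monic : ∀ as → IsMonic (length as) (rootProduct R as)
  rootProduct-monic [] = refl , λ { (suc k) _ → refl }
  rootProduct-monic (a ∷ as) = ⊛-monic {1} {length as} {linear a}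
      (refl , λ { (suc (suc k)) _ → refl ; (suc zero) (s≤s ()) }) (rootProduct-monic as)

  eval-linear : ∀ b a → eval b (linear a) ≈ b - a
  eval-linear b a = solve 2 (λ b a → :- a :+ b :* (con (+ 1) :+ b :* con (+ 0)) := b :- a) refl b a

  eval-D-linear-⊛ : ∀ b a p → eval b (D (linear a ⊛ p)) ≈ eval b p + (b - a) * eval b (D p)
  eval-D-linear-⊛ b a p = begin
    eval b (D (linear a ⊛ p)) ≈⟨ eval-cong b (D-⊛ (linear a) p) ⟩
    eval b (D (linear a) ⊛ p ⊕ linear a ⊛ D p)
        ≈⟨ trans (eval-⊕ b (D (linear a) ⊛ p) _) (+-cong (eval-⊛ b (D (linear a)) p) (eval-⊛ b (linear a) (D p))) ⟩
    eval b (D (linear a)) * eval b p + eval b (linear a) * eval b (D p)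
      ≈⟨ +-cong (*-congʳ (trans (eval-⊕ b (1# ∷ []) _) (+-congˡ (+-congˡ (*-congˡ (eval-⊕ b [] (0# ∷ [])))))))
           (*-congʳ (eval-linear b a)) ⟩
    (1# + b * 0# + (0# + b * (0# + (0# + b * 0#)))) * eval b p + (b - a) * eval b (D p)
      ≈⟨ solve 4 (λ b a p d → (con (+ 1) :+ b :* con (+ 0) :+
          (con (+ 0) :+ b :* (con (+ 0) :+ (con (+ 0) :+ b :* con (+ 0))))) :* p :+ (b :- a) :* d
           := p :+ (b :- a) :* d) refl b a (eval b p) (eval b (D p)) ⟩
    eval b p + (b - a) * eval b (D p) ∎

  eval-linear-⊛ : ∀ b a p → eval b (linear a ⊛ p) ≈ (b - a) * eval b p
  eval-linear-⊛ b a p = trans (eval-⊛ b (linear a) p) (*-congʳ (eval-linear b a))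

  eval-rootProduct : ∀ b as → eval b (rootProduct R as) ≈ product (map (λ a → b - a) as)
  eval-rootProduct b [] = solve 1 (λ b → con (+ 1) :+ b :* con (+ 0) := con (+ 1)) refl b
  eval-rootProduct b (a ∷ as) = trans (eval-linear-⊛ b a _) (*-congˡ (eval-rootProduct b as))

  roots : ∀ as → All (λ b → eval b (rootProduct R as) ≈ 0#) as
  roots [] = []
  roots (a ∷ as) = trans (eval-linear-⊛ a a _) (trans (*-congʳ (-‿inverseʳ a)) (zeroˡ _)) ∷
    All.map (λ {b} e → trans (eval-linear-⊛ b a _) (trans (*-congˡ e) (zeroʳ _))) (roots as)

  product-map-* : ∀ {f g h : Carrier → Carrier} {bs} → All (λ b → f b ≈ g b * h b) bs →
    product (map f bs) ≈ product (map g bs) * product (map h bs)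
  product-map-* [] = sym (*-identityˡ 1#)
  product-map-* {f} {g} {h} {b ∷ bs} (e ∷ es) = trans (*-cong e (product-map-* es))
    (solve 4 (λ g h x y → g :* h :* (x :* y) := g :* x :* (h :* y)) refl (g b) (h b) _ _)

  -- For p = ∏ (x - a) this is Res(p, p′), that is, ± the discriminant.
  derivativeProduct : List Carrier → Carrier
  derivativeProduct as = product (map (λ a → eval a (D (rootProduct R as))) as)

  cross : Carrier → List Carrier → Carrier
  cross a as = product (map (λ b → (a - b) * (b - a)) as)

  -- By the product rule, adding a root a multiplies p′(b) at each old root b by b - a, while the
  -- new root contributes ∏ (a - b). Both orders of each difference occur, so no sign has to be
  -- tracked.
  derivativeProduct-∷ : ∀ a as → derivativeProduct (a ∷ as) ≈ cross a as * derivativeProduct as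
  derivativeProduct-∷ a as = begin
    eval a (D (linear a ⊛ p)) * product (map (λ b → eval b (D (linear a ⊛ p))) as)
      ≈⟨ *-cong
           (trans (eval-D-linear-⊛ a a p)
               (trans (solve 3 (λ a x y → x :+ (a :- a) :* y := x) refl a _ _) (eval-rootProduct a as)))
           (product-map-* {g = λ b → b - a} {h = λ b → eval b (D p)}
             (All.map (λ {b} e → trans (eval-D-linear-⊛ b a p) (trans (+-congʳ e) (+-identityˡ _))) (roots as))) ⟩
    product (map (λ b → a - b) as) * (product (map (λ b → b - a) as) * derivativeProduct as) ≈⟨ *-assoc _ _ _ ⟨
    product (map (λ b → a - b) as) * product (map (λ b → b - a) as) * derivativeProduct as
      ≈⟨ *-congʳ (product-map-* {f = λ b → (a - b) * (b - a)} (All.universal (λ b → refl) as)) ⟨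
    cross a as * derivativeProduct as ∎
    where
    p = rootProduct R as

  linear-⊛-linear : ∀ a b → linear a ⊛ linear b ≋ a * b ∷ - (a + b) ∷ 1# ∷ []
  linear-⊛-linear a b = ≋-trans (linear-⊛ a (linear b)) (mk≋ λ where
    zero → trans (coef-⊕ _ (0# ∷ linear b) 0)
        (trans (+-congʳ (coef-scale (- a) (linear b) 0))
            (solve 2 (λ a b → :- a :* :- b :+ con (+ 0) := a :* b) refl a b))
    (suc zero) → trans (coef-⊕ _ (0# ∷ linear b) 1)
        (trans (+-congʳ (coef-scale (- a) (linear b) 1))
            (solve 2 (λ a b → :- a :* con (+ 1) :+ :- b := :- (a :+ b)) refl a b))
    (suc (suc zero)) → trans (coef-⊕ _ (0# ∷ linear b) 2)
        (trans (+-congʳ (coef-scale (- a) (linear b) 2))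
            (solve 1 (λ a → :- a :* con (+ 0) :+ con (+ 1) := con (+ 1)) refl a))
    (suc (suc (suc k))) → trans (coef-⊕ _ (0# ∷ linear b) (3 ℕ.+ k))
        (trans (+-congʳ (coef-scale (- a) (linear b) (3 ℕ.+ k)))
            (solve 1 (λ a → :- a :* con (+ 0) :+ con (+ 0) := con (+ 0)) refl a)))

  ψ-roots φ-roots : List (RootPair R) → List Carrier
  ψ-roots [] = []
  ψ-roots (t ∷ ts) = r ∷ - r ∷ ψ-roots ts where open RootPair t
  φ-roots [] = []
  φ-roots (t ∷ ts) = w ∷ v ∷ φ-roots ts where open RootPair t

  length-ψ-roots : ∀ ts → length (ψ-roots ts) ≡ length ts ℕ.+ length ts
  length-ψ-roots [] = ≡.refl
  length-ψ-roots (t ∷ ts) = ≡.cong suc (≡.trans (≡.cong suc (length-ψ-roots ts)) (≡.sym (ℕP.+-suc _ _)))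

  length-φ-roots : ∀ ts → length (φ-roots ts) ≡ length ts ℕ.+ length ts
  length-φ-roots [] = ≡.refl
  length-φ-roots (t ∷ ts) = ≡.cong suc (≡.trans (≡.cong suc (length-φ-roots ts)) (≡.sym (ℕP.+-suc _ _)))

  ψ-rootProduct : ∀ ts → rootProduct R (ψ-roots ts) ≋ sq (rootProduct R (squareRoots R ts))
  ψ-rootProduct [] = mk≋ λ { zero → refl ; (suc zero) → refl ; (suc (suc k)) → refl }
  ψ-rootProduct (t ∷ ts) = ≋-trans (≋-sym (⊛-assoc (linear r) (linear (- r)) _)) (≋-trans
    (⊛-cong {q = rootProduct R (ψ-roots ts)} (≋-trans (linear-⊛-linear r (- r)) quadratic) (ψ-rootProduct ts))
        (≋-sym (sq-⊛ (linear (r * r)) _)))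
    where
    open RootPair t
    quadratic : r * - r ∷ - (r - r) ∷ 1# ∷ [] ≋ sq (linear (r * r))
    quadratic = mk≋ λ where
      zero → sym (-‿distribʳ-* r r)
      (suc zero) → solve 1 (λ r → :- (r :- r) := con (+ 0)) refl r
      (suc (suc zero)) → refl
      (suc (suc (suc zero))) → refl
      (suc (suc (suc (suc k)))) → refl

  -- A factor y - r² is sent to (x + 1)² + r² x = x² - (w + v) x + 1 = (x - w) (x - v), and
  -- `homog-⊛` multiplies these images.
  φ-rootProduct : ∀ ts → rootProduct R (φ-roots ts) ≋ homog (length ts) (coef (rootProduct R (squareRoots R ts)))
  φ-rootProduct [] = ≋-refl
  φ-rootProduct (t ∷ ts) = ≋-trans (≋-sym (⊛-assoc (linear w) (linear v) _)) (≋-trans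
    (⊛-cong {q = rootProduct R (φ-roots ts)} (≋-trans (linear-⊛-linear w v) (≋-sym quadratic)) (φ-rootProduct ts))
    (≋-sym (homog-⊛ 1 (length ts) (linear (r * r)) (rootProduct R (squareRoots R ts))
      (λ { (suc (suc k)) _ → refl ; (suc zero) (s≤s ()) })
      (≡.subst (λ n → Bounded n (rootProduct R (squareRoots R ts))) (ListP.length-map _ ts)
          (monic-bounded (rootProduct-monic (squareRoots R ts)))))))
    where
    open RootPair t
    coefs : ∀ k → coef (homog 1 (coef (linear (r * r)))) k ≈ - (r * r) * coef negX k + coef [x+1]² k
    coefs k = trans (coef-⊕ (scale (- (r * r)) (negX ^ᵖ 1)) _ k)
      (+-cong (trans (coef-scale (- (r * r)) (negX ^ᵖ 1) k) (*-congˡ (at (P.*-identityʳ negX) k)))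
          (at (P.*-identityʳ [x+1]²) k))
    quadratic : homog 1 (coef (linear (r * r))) ≋ w * v ∷ - (w + v) ∷ 1# ∷ []
    quadratic = mk≋ λ where
      zero → trans (coefs 0) (trans (solve 1 (λ x → :- x :* con (+ 0) :+ con (+ 1) := con (+ 1)) refl (r * r))
          (sym wv≈1))
      (suc zero) → trans (coefs 1) (trans (+-congʳ (*-congʳ (-‿cong r²≈)))
        (solve 1 (λ s → :- :- (s :+ con (+ 2)) :* :- con (+ 1) :+ (con (+ 1) :+ con (+ 1)) := :- s) refl (w + v)))
      (suc (suc zero)) → trans (coefs 2) (solve 1 (λ x → :- x :* con (+ 0) :+ con (+ 1) := con (+ 1)) refl (r * r))
      (suc (suc (suc k))) → trans (coefs (3 ℕ.+ k))
          (solve 1 (λ x → :- x :* con (+ 0) :+ con (+ 0) := con (+ 0)) refl (r * r))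

  pairSum : RootPair R → Carrier
  pairSum t = w + v where open RootPair t

  -- Fourth powers appear because `cross` takes each difference of roots in both orders.
  crossPairs : RootPair R → List (RootPair R) → Carrier
  crossPairs t [] = 1#
  crossPairs t (t′ ∷ ts) = (d * d) * (d * d) * crossPairs t ts where d = pairSum t - pairSum t′

  -- Put h = w + v and h′ = w′ + v′. As w v = 1 = w′ v′, the product (w - w′) (v - w′) equals w′ (h′
  -- - h), and similarly with v′ for w′; the extra factors w′ and v′ multiply to 1.
  cross-φ : ∀ t ts → cross (RootPair.w t) (φ-roots ts) * cross (RootPair.v t) (φ-roots ts) ≈ crossPairs t ts
  cross-φ t [] = *-identityˡ 1#
  cross-φ t (t′ ∷ ts) = begin
    (w - w′) * (w′ - w) * ((w - v′) * (v′ - w) * cross w ρ) *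
        ((v - w′) * (w′ - v) * ((v - v′) * (v′ - v) * cross v ρ))
      ≈⟨ solve 6 (λ w v w′ v′ x y → (w :- w′) :* (w′ :- w) :* ((w :- v′) :* (v′ :- w) :* x) :*
          ((v :- w′) :* (w′ :- v) :* ((v :- v′) :* (v′ :- v) :* y))
           := let p = (w :- w′) :* (v :- w′) ; q = (w :- v′) :* (v :- v′) in p :* p :* (q :* q) :* (x :* y)) refl w v w′ v′ _ _ ⟩
    (w - w′) * (v - w′) * ((w - w′) * (v - w′)) * ((w - v′) * (v - v′) * ((w - v′) * (v - v′))) *
        (cross w ρ * cross v ρ)
      ≈⟨ *-cong (*-cong (*-cong pw pw) (*-cong pv pv)) (cross-φ t ts) ⟩
    w′ * d * (w′ * d) * (v′ * d * (v′ * d)) * crossPairs t ts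
      ≈⟨ solve 4 (λ w′ v′ d k → w′ :* d :* (w′ :* d) :* (v′ :* d :* (v′ :* d)) :* k := w′ :* v′ :* (w′ :* v′) :*
          (d :* d :* (d :* d) :* k)) refl w′ v′ d _ ⟩
    w′ * v′ * (w′ * v′) * (d * d * (d * d) * crossPairs t ts) ≈⟨ *-congʳ (*-cong wv′≈1 wv′≈1) ⟩
    1# * 1# * (d * d * (d * d) * crossPairs t ts)
      ≈⟨ solve 3 (λ s s′ k → let d = s′ :- s ; e = s :- s′ in con (+ 1) :* con (+ 1) :* (d :* d :* (d :* d) :* k) := e :* e :* (e :* e) :* k) refl (w + v) (w′ + v′) _ ⟩
    crossPairs t (t′ ∷ ts) ∎
    where
    open RootPair t
    open RootPair t′ using () renaming (w to w′; v to v′; wv≈1 to wv′≈1)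
    ρ = φ-roots ts
    d = (w′ + v′) - (w + v)
    pw : (w - w′) * (v - w′) ≈ w′ * d
    pw = trans (solve 3 (λ w v w′ → (w :- w′) :* (v :- w′) := w :* v :+ (w′ :* w′ :- (w :+ v) :* w′)) refl w v w′)
      (trans (+-congʳ (trans wv≈1 (sym wv′≈1)))
          (solve 4 (λ w v w′ v′ → w′ :* v′ :+ (w′ :* w′ :- (w :+ v) :* w′) := w′ :* (w′ :+ v′ :- (w :+ v))) refl w
              v w′ v′))
    pv : (w - v′) * (v - v′) ≈ v′ * d
    pv = trans (solve 3 (λ w v w′ → (w :- w′) :* (v :- w′) := w :* v :+ (w′ :* w′ :- (w :+ v) :* w′)) refl w v v′)
      (trans (+-congʳ (trans wv≈1 (sym wv′≈1)))
          (solve 4 (λ w v w′ v′ → w′ :* v′ :+ (v′ :* v′ :- (w :+ v) :* v′) := v′ :* (w′ :+ v′ :- (w :+ v))) refl w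
              v w′ v′))

  cross-ψ : ∀ t ts → cross (RootPair.r t) (ψ-roots ts) * cross (- RootPair.r t) (ψ-roots ts) ≈ crossPairs t ts
  cross-ψ t [] = *-identityˡ 1#
  cross-ψ t (t′ ∷ ts) = begin
    (r - r′) * (r′ - r) * ((r - - r′) * (- r′ - r) * cross r ρ) *
        ((- r - r′) * (r′ - - r) * ((- r - - r′) * (- r′ - - r) * cross (- r) ρ))
      ≈⟨ solve 4 (λ r r′ x y → (r :- r′) :* (r′ :- r) :* ((r :- :- r′) :* (:- r′ :- r) :* x) :*
          ((:- r :- r′) :* (r′ :- :- r) :* ((:- r :- :- r′) :* (:- r′ :- :- r) :* y))
           := let d = r′ :* r′ :- r :* r in d :* d :* (d :* d) :* (x :* y)) refl r r′ _ _ ⟩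
    d * d * (d * d) * (cross r ρ * cross (- r) ρ) ≈⟨ *-cong (*-cong (*-cong d≈ d≈) (*-cong d≈ d≈)) (cross-ψ t ts) ⟩
    crossPairs t (t′ ∷ ts) ∎
    where
    open RootPair t
    open RootPair t′ using () renaming (w to w′; v to v′; r to r′; r²≈ to r′²≈)
    ρ = ψ-roots ts
    d = r′ * r′ - r * r
    d≈ : d ≈ w + v - (w′ + v′)
    d≈ = trans (+-cong r′²≈ (-‿cong r²≈))
        (solve 2 (λ s s′ → :- (s′ :+ con (+ 2)) :- :- (s :+ con (+ 2)) := s :- s′) refl (w + v) (w′ + v′))

  -- With h = w + v, one pair contributes - 4 r² = 4 (h + 2) through ± r and 2 - h through the value
  -- at 1. Since w v = 1, the factor 4 - h² is (w - v) (v - w), the contribution of w and v.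
  derivativeProduct-transfer : ∀ ts →
    derivativeProduct (ψ-roots ts) * eval 1# (rootProduct R (φ-roots ts)) ≈ fromℤ (+ (4 ℕ.^ length ts)) *
        derivativeProduct (φ-roots ts)
  derivativeProduct-transfer [] = solve 0
      (con (+ 1) :* (con (+ 1) :+ con (+ 1) :* con (+ 0)) := con (+ 1) :* con (+ 1)) refl
  derivativeProduct-transfer (t ∷ ts) = begin
    derivativeProduct (r ∷ - r ∷ ψ-roots ts) * eval 1# (linear w ⊛ (linear v ⊛ rootProduct R (φ-roots ts)))
      ≈⟨ *-cong (trans (derivativeProduct-∷ r (- r ∷ ψ-roots ts))
          (*-congˡ (derivativeProduct-∷ (- r) (ψ-roots ts))))
           (trans (eval-linear-⊛ 1# w _) (*-congˡ (eval-linear-⊛ 1# v _))) ⟩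
    (r - - r) * (- r - r) * cross r (ψ-roots ts) * (cross (- r) (ψ-roots ts) * dψ) * ((1# - w) * ((1# - v) * e))
      ≈⟨ solve 7 (λ r w v x y d e → (r :- :- r) :* (:- r :- r) :* x :* (y :* d) :*
          ((con (+ 1) :- w) :* ((con (+ 1) :- v) :* e))
           := (:- con (+ 4) :* (r :* r)) :* (con (+ 1) :- (w :+ v) :+ w :* v) :* (x :* y) :* (d :* e)) refl r w v _
               _ dψ e ⟩
    (- fromℤ (+ 4) * (r * r)) * (1# - (w + v) + w * v) * (cross r (ψ-roots ts) * cross (- r) (ψ-roots ts)) *
        (dψ * e)
      ≈⟨ *-cong (*-cong (*-cong (*-congˡ r²≈) (+-congˡ wv≈1)) (cross-ψ t ts)) (derivativeProduct-transfer ts) ⟩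
    (- fromℤ (+ 4) * - (w + v + fromℤ (+ 2))) * (1# - (w + v) + 1#) * crossPairs t ts * (4^ * dφ)
      ≈⟨ solve 4 (λ s k f d → (:- con (+ 4) :* :- (s :+ con (+ 2))) :* (con (+ 1) :- s :+ con (+ 1)) :* k :*
          (f :* d)
           := con (+ 4) :* f :* ((con (+ 4) :* con (+ 1) :- s :* s) :* k :* d)) refl (w + v) _ 4^ dφ ⟩
    fromℤ (+ 4) * 4^ * ((fromℤ (+ 4) * 1# - (w + v) * (w + v)) * crossPairs t ts * dφ)
      ≈⟨ *-cong (trans (reflexive (≡.cong fromℤ (ℤP.pos-* 4 (4 ℕ.^ length ts))))
          (fromℤ-* (+ 4) (+ (4 ℕ.^ length ts)))) (*-congʳ (*-cong (+-congʳ (*-congˡ wv≈1)) (cross-φ t ts))) ⟨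
    fromℤ (+ (4 ℕ.^ length (t ∷ ts))) *
        ((fromℤ (+ 4) * (w * v) - (w + v) * (w + v)) * (cross w (φ-roots ts) * cross v (φ-roots ts)) * dφ)
      ≈⟨ *-congˡ (solve 5 (λ w v x y d → (con (+ 4) :* (w :* v) :- (w :+ v) :* (w :+ v)) :* (x :* y) :* d :=
          (w :- v) :* (v :- w) :* x :* (y :* d)) refl w v _ _ dφ) ⟩
    fromℤ (+ (4 ℕ.^ length (t ∷ ts))) * ((w - v) * (v - w) * cross w (φ-roots ts) * (cross v (φ-roots ts) * dφ))
      ≈⟨ *-congˡ (trans (derivativeProduct-∷ w (v ∷ φ-roots ts)) (*-congˡ (derivativeProduct-∷ v (φ-roots ts)))) ⟨
    fromℤ (+ (4 ℕ.^ length (t ∷ ts))) * derivativeProduct (w ∷ v ∷ φ-roots ts) ∎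
    where
    open RootPair t
    dψ = derivativeProduct (ψ-roots ts)
    dφ = derivativeProduct (φ-roots ts)
    e = eval 1# (rootProduct R (φ-roots ts))
    4^ = fromℤ (+ (4 ℕ.^ length ts))

  -- The guard matters: `n ∸ k` stays 0 for k > n and would repeat the constant coefficient.
  reversed : ℕ → List Carrier → ℕ → Carrier
  reversed n p k = pick k (suc n) (coef p (n ∸ k)) 0#

  -- Res(p, p′) for p monic of degree n ≥ 1.
  derivativeResultant : ℕ → List Carrier → Carrier
  derivativeResultant n p = det ((n ∸ 1) ℕ.+ n) (sylvester (n ∸ 1) (reversed n p) (reversed (n ∸ 1) (D p)))

  reversed-rootProduct : ∀ as k → reversed (length as) (rootProduct R as) k ≈ reversed-roots as k
  reversed-rootProduct [] zero = refl
  reversed-rootProduct [] (suc k) = refl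
  reversed-rootProduct (a ∷ as) zero = begin
    coef (linear a ⊛ p) (suc n) ≈⟨ trans (at (linear-⊛ a p) (suc n)) (coef-⊕ (scale (- a) p) _ (suc n)) ⟩
    coef (scale (- a) p) (suc n) + coef p n
        ≈⟨ +-congʳ (trans (coef-scale (- a) p (suc n))
            (trans (*-congˡ (monic-bounded (rootProduct-monic as) (suc n) (ℕP.n<1+n n))) (zeroʳ _))) ⟩
    0# + coef p n ≈⟨ +-identityˡ _ ⟩
    coef p n ≈⟨ reversed-rootProduct as 0 ⟩
    reversed-roots as 0 ∎
    where
    n = length as
    p = rootProduct R as
  reversed-rootProduct (a ∷ as) (suc c) = trans step
      (+-cong (reversed-rootProduct as (suc c)) (-‿cong (*-congˡ (reversed-rootProduct as c))))
    where
    n = length as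
    p = rootProduct R as
    expand : ∀ j → coef (linear a ⊛ p) j ≈ coef (0# ∷ p) j - a * coef p j
    expand j = trans (at (linear-⊛ a p) j) (trans (coef-⊕ (scale (- a) p) _ j) (trans (+-comm _ _)
      (+-congˡ (trans (coef-scale (- a) p j) (sym (-‿distribˡ-* a _))))))
    step : reversed (suc n) (linear a ⊛ p) (suc c) ≈ reversed n p (suc c) - a * reversed n p c
    step with ℕP.<-cmp c n
    ... | tri< c<n _ _ = begin
      pick c (suc n) (coef (linear a ⊛ p) (n ∸ c)) 0# ≡⟨ pick-< (ℕP.m<n⇒m<1+n c<n) ⟩
      coef (linear a ⊛ p) (n ∸ c) ≈⟨ expand (n ∸ c) ⟩
      coef (0# ∷ p) (n ∸ c) - a * coef p (n ∸ c)
          ≡⟨ ≡.cong (λ j → coef (0# ∷ p) j - a * coef p (n ∸ c)) (ℕP.+-∸-assoc 1 c<n) ⟩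
      coef p (n ∸ suc c) - a * coef p (n ∸ c)
        ≡⟨ ≡.cong₂ (λ x y → x - a * y) (pick-< c<n) (pick-< (ℕP.m<n⇒m<1+n c<n)) ⟨
      reversed n p (suc c) - a * reversed n p c ∎
    ... | tri≈ _ ≡.refl _ = begin
      pick n (suc n) (coef (linear a ⊛ p) (n ∸ n)) 0# ≡⟨ pick-< (ℕP.n<1+n n) ⟩
      coef (linear a ⊛ p) (n ∸ n) ≈⟨ expand (n ∸ n) ⟩
      coef (0# ∷ p) (n ∸ n) - a * coef p (n ∸ n)
          ≡⟨ ≡.cong (λ j → coef (0# ∷ p) j - a * coef p (n ∸ n)) (ℕP.n∸n≡0 n) ⟩
      0# - a * coef p (n ∸ n)
        ≡⟨ ≡.cong₂ (λ x y → x - a * y) (pick-≥ {r = n} ℕP.≤-refl) (pick-< (ℕP.n<1+n n)) ⟨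
      reversed n p (suc n) - a * reversed n p n ∎
    ... | tri> _ _ n<c = begin
      pick c (suc n) (coef (linear a ⊛ p) (n ∸ c)) 0# ≡⟨ pick-≥ n<c ⟩
      0# ≈⟨ solve 1 (λ a → con (+ 0) := con (+ 0) :- a :* con (+ 0)) refl a ⟩
      0# - a * 0# ≡⟨ ≡.cong₂ (λ x y → x - a * y) (pick-≥ (ℕP.<⇒≤ n<c)) (pick-≥ n<c) ⟨
      reversed n p (suc c) - a * reversed n p c ∎

  reversed-bounded : ∀ n p k → n ℕ.< k → reversed n p k ≈ 0#
  reversed-bounded n p k n<k = reflexive (pick-≥ n<k)

  reversed-cong : ∀ n {p q} → p ≋ q → ∀ k → reversed n p k ≈ reversed n q k
  reversed-cong n {p} {q} e k with k ℕ.<? suc n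
  ... | yes k< = trans (reflexive (pick-< k<)) (trans (at e (n ∸ k)) (reflexive (≡.sym (pick-< k<))))
  ... | no k≮ = trans (reflexive (pick-≥ (ℕP.≮⇒≥ k≮))) (reflexive (≡.sym (pick-≥ (ℕP.≮⇒≥ k≮))))

  horner-cong : ∀ {F G} a n → (∀ k → k ℕ.≤ n → F k ≈ G k) → horner F a n ≈ horner G a n
  horner-cong a zero e = e 0 z≤n
  horner-cong a (suc n) e = +-cong (*-congˡ (horner-cong a n λ k h → e k (ℕP.m≤n⇒m≤1+n h))) (e (suc n) ℕP.≤-refl)

  horner-reversed : ∀ n p a → Bounded n p → horner (reversed n p) a n ≈ eval a p
  horner-reversed n [] a b = trans (horner-cong a n λ k h → reflexive (pick-< (s≤s h))) (zeros n)
    where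
    zeros : ∀ n → horner (λ _ → 0#) a n ≈ 0#
    zeros zero = refl
    zeros (suc n) = trans (+-congʳ (*-congˡ (zeros n)))
        (solve 1 (λ a → a :* con (+ 0) :+ con (+ 0) := con (+ 0)) refl a)
  horner-reversed zero (c ∷ p) a b = sym (trans (+-congˡ (*-congˡ (eval-zero a p (mk≋ λ k → b (suc k) z<s))))
    (solve 2 (λ c a → c :+ a :* con (+ 0) := c) refl c a))
  horner-reversed (suc n) (c ∷ p) a b = begin
    a * horner (reversed (suc n) (c ∷ p)) a n + reversed (suc n) (c ∷ p) (suc n)
      ≈⟨ +-cong (*-congˡ (horner-cong a n lower))
          (reflexive (≡.trans (pick-< (ℕP.n<1+n (suc n))) (≡.cong (coef (c ∷ p)) (ℕP.n∸n≡0 n)))) ⟩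
    a * horner (reversed n p) a n + c
        ≈⟨ trans (+-comm _ _) (+-congˡ (*-congˡ (horner-reversed n p a λ k h → b (suc k) (s<s h)))) ⟩
    c + a * eval a p ∎
    where
    lower : ∀ k → k ℕ.≤ n → reversed (suc n) (c ∷ p) k ≈ reversed n p k
    lower k h = reflexive (≡.trans (pick-< (ℕP.m<n⇒m<1+n (s≤s h)))
        (≡.trans (≡.cong (coef (c ∷ p)) (ℕP.+-∸-assoc 1 h)) (≡.sym (pick-< (s≤s h)))))

  shift-sylvester-cong : ∀ n {F F′ G G′} → (∀ k → F k ≈ F′ k) → (∀ k → G k ≈ G′ k) → ∀ r c → sylvester n F G r c ≈
      sylvester n F′ G′ r c
  shift-sylvester-cong n e e′ r c with r ℕ.<? n
  ... | yes r<n = trans (reflexive (pick-< r<n)) (trans (shift-cong r e c) (reflexive (≡.sym (pick-< r<n))))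
  ... | no r≮n = trans (reflexive (pick-≥ (ℕP.≮⇒≥ r≮n)))
      (trans (shift-cong (r ∸ n) e′ c) (reflexive (≡.sym (pick-≥ (ℕP.≮⇒≥ r≮n)))))

  derivativeResultant-cong : ∀ n {p q} → p ≋ q → derivativeResultant n p ≈ derivativeResultant n q
  derivativeResultant-cong n e = det-cong _ λ r c _ _ →
    shift-sylvester-cong (n ∸ 1) (reversed-cong n e) (reversed-cong (n ∸ 1) (D-cong e)) r c

  D-bounded : ∀ n p → Bounded n p → Bounded (n ∸ 1) (D p)
  D-bounded zero p b k h = trans (coef-D p k) (trans (*-congˡ (b (suc k) z<s)) (zeroʳ _))
  D-bounded (suc n) p b k h = trans (coef-D p k) (trans (*-congˡ (b (suc k) (s<s h))) (zeroʳ _))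

  derivativeResultant-roots : ∀ n as → length as ≡ n → derivativeResultant n (rootProduct R as) ≈ derivativeProduct
      as
  derivativeResultant-roots n as ≡.refl = begin
    derivativeResultant n p
      ≈⟨ det-cong _ (λ r c _ _ → shift-sylvester-cong (n ∸ 1) (reversed-rootProduct as) (λ _ → refl) r c) ⟩
    det ((n ∸ 1) ℕ.+ n) (sylvester (n ∸ 1) (reversed-roots as) G)
      ≈⟨ det-sylvester-roots (n ∸ 1) G (reversed-bounded (n ∸ 1) (D p)) as ⟩
    product (map (λ a → horner G a (n ∸ 1)) as)
      ≈⟨ products as ⟩
    derivativeProduct as ∎
    where
    p = rootProduct R as
    G = reversed (n ∸ 1) (D p)
    products : ∀ bs → product (map (λ a → horner G a (n ∸ 1)) bs) ≈ product (map (λ a → eval a (D p)) bs)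
    products [] = refl
    products (b ∷ bs) = *-cong
        (horner-reversed (n ∸ 1) (D p) b (D-bounded n p (monic-bounded (rootProduct-monic as)))) (products bs)

-- Resultants under ring homomorphisms

module DeterminantMap {R S : CommutativeRing 0ℓ 0ℓ} (h : RingHom R S) where
  open RingHom h
  open PolynomialMap h
  private
    module R = RingKit R
    module S = RingKit S
    module RD = Determinants R
    module SD = Determinants S
    module RP = Polynomials R
    module SP = Polynomials S
    module RR = RootProducts R
    module SR = RootProducts S

  sgn-homo : ∀ k → ⟦ RD.sgn k ⟧ S.≈ SD.sgn k
  sgn-homo zero = 1-homo
  sgn-homo (suc k) = S.trans (-‿homo _) (S.-‿cong (sgn-homo k))

  opaque
    unfolding Determinants.∑

    ∑-homo : ∀ n f → ⟦ RD.∑ n f ⟧ S.≈ SD.∑ n (λ i → ⟦ f i ⟧)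
    ∑-homo zero f = 0-homo
    ∑-homo (suc n) f = S.trans (+-homo _ _) (S.+-congˡ (∑-homo n _))

  opaque
    unfolding Determinants.det

    det-homo : ∀ n M → ⟦ RD.det n M ⟧ S.≈ SD.det n (λ r c → ⟦ M r c ⟧)
    det-homo zero M = 1-homo
    det-homo (suc n) M = S.trans (∑-homo (suc n) _) (SD.∑-cong (suc n) λ j _ →
      S.trans (*-homo _ _) (S.*-cong (S.trans (*-homo _ _) (S.*-congʳ (sgn-homo j))) (det-homo n (RD.minor j M))))

  pick-homo : ∀ r k x y → ⟦ pick r k x y ⟧ ≡ pick r k ⟦ x ⟧ ⟦ y ⟧
  pick-homo r zero x y = ≡.refl
  pick-homo zero (suc k) x y = ≡.refl
  pick-homo (suc r) (suc k) x y = pick-homo r k x y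

  shift-homo : ∀ i F c → ⟦ RD.shift i F c ⟧ S.≈ SD.shift i (λ k → ⟦ F k ⟧) c
  shift-homo zero F c = S.refl
  shift-homo (suc i) F zero = 0-homo
  shift-homo (suc i) F (suc c) = shift-homo i F c

  pick-cong : ∀ r k {x x′ y y′} → x S.≈ x′ → y S.≈ y′ → pick r k x y S.≈ pick r k x′ y′
  pick-cong r zero e e′ = e′
  pick-cong zero (suc k) e e′ = e
  pick-cong (suc r) (suc k) e e′ = pick-cong r k e e′

  reversed-homo : ∀ n p k → ⟦ RR.reversed n p k ⟧ S.≈ SR.reversed n (mapP p) k
  reversed-homo n p k = S.trans (S.reflexive (pick-homo k (suc n) _ _))
      (pick-cong k (suc n) (S.sym (coef-map p (n ∸ k))) 0-homo)

  derivativeResultant-homo : ∀ n p → ⟦ RR.derivativeResultant n p ⟧ S.≈ SR.derivativeResultant n (mapP p)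
  derivativeResultant-homo n p = S.trans (det-homo _ _) (SD.det-cong _ λ r c _ _ →
    S.trans (S.reflexive (pick-homo r (n ∸ 1) _ _)) (pick-cong r (n ∸ 1)
      (S.trans (shift-homo r (RR.reversed n p) c) (SD.shift-cong r (reversed-homo n p) c))
      (S.trans (shift-homo (r ∸ (n ∸ 1)) (RR.reversed (n ∸ 1) (RP.D p)) c)
        (SD.shift-cong (r ∸ (n ∸ 1))
            (λ k → S.trans (reversed-homo (n ∸ 1) (RP.D p) k) (SR.reversed-cong (n ∸ 1) (map-D p) k)) c))))

  fromℤ-homo : ∀ n → ⟦ R.fromℤ (+ n) ⟧ S.≈ S.fromℤ (+ n)
  fromℤ-homo zero = 0-homo
  fromℤ-homo (suc n) = S.trans (⟦⟧-cong (R.fromℤ-+ (+ 1) (+ n)))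
    (S.trans (+-homo _ _) (S.trans (S.+-cong 1-homo (fromℤ-homo n)) (S.sym (S.fromℤ-+ (+ 1) (+ n)))))

-- Every ingredient commutes with ring homomorphisms, so the identity may be checked in the
-- splitting extension of G, where both polynomials are products of linear factors.
derivativeResultant-transfer : ∀ R m G → Polynomials.IsMonic R m G →
  let open RingKit R ; open Polynomials R ; open Substitutions R ; open RootProducts R in
  derivativeResultant (m ℕ.+ m) (sq G) * eval 1# (homog m (coef G)) ≈
    fromℤ (+ (4 ℕ.^ m)) * derivativeResultant (m ℕ.+ m) (homog m (coef G))
derivativeResultant-transfer R m G monic = injective (begin
  ⟦ RR.derivativeResultant (m ℕ.+ m) (RT.sq G) R.* RP.eval R.1# Φ ⟧
    ≈⟨ trans (*-homo _ _) (*-cong (derivativeResultant-homo (m ℕ.+ m) (RT.sq G))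
         (trans (map-eval R.1# Φ) (trans (eval-cong _ map-Φ) (eval-at-1 (rootProduct ring (φ-roots ts)))))) ⟩
  derivativeResultant (m ℕ.+ m) (mapP (RT.sq G)) * eval 1# (rootProduct ring (φ-roots ts))
    ≈⟨ *-congʳ (trans (derivativeResultant-cong (m ℕ.+ m) map-Ψ)
        (derivativeResultant-roots (m ℕ.+ m) (ψ-roots ts)
            (≡.trans (length-ψ-roots ts) (≡.cong₂ ℕ._+_ |ts|≡m |ts|≡m)))) ⟩
  derivativeProduct (ψ-roots ts) * eval 1# (rootProduct ring (φ-roots ts)) ≈⟨ derivativeProduct-transfer ts ⟩
  fromℤ (+ (4 ℕ.^ length ts)) * derivativeProduct (φ-roots ts)
    ≈⟨ *-cong (trans (fromℤ-homo (4 ℕ.^ m)) (reflexive (≡.cong (λ k → fromℤ (+ (4 ℕ.^ k))) (≡.sym |ts|≡m))))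
         (trans (derivativeResultant-cong (m ℕ.+ m) map-Φ)
             (derivativeResultant-roots (m ℕ.+ m) (φ-roots ts)
                 (≡.trans (length-φ-roots ts) (≡.cong₂ ℕ._+_ |ts|≡m |ts|≡m)))) ⟨
  ⟦ R.fromℤ (+ (4 ℕ.^ m)) ⟧ * derivativeResultant (m ℕ.+ m) (mapP Φ)
    ≈⟨ trans (*-homo _ _) (*-congˡ (derivativeResultant-homo (m ℕ.+ m) Φ)) ⟨
  ⟦ R.fromℤ (+ (4 ℕ.^ m)) R.* RR.derivativeResultant (m ℕ.+ m) Φ ⟧ ∎)
  where
  module R = RingKit R
  module RP = Polynomials R
  module RT = Substitutions R
  module RR = RootProducts R
  split = splitting m R G monic
  open Extension (proj₁ split)
  ts = proj₁ (proj₂ split)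
  |ts|≡m = proj₁ (proj₂ (proj₂ split))
  open RingKit ring hiding (ring)
  open Polynomials ring
  open Substitutions ring
  open RootProducts ring
  open RingHom embedding
  open PolynomialMap embedding
  open SubstitutionMap embedding
  open DeterminantMap embedding
  Φ = RT.homog m (RP.coef G)
  map-Ψ : mapP (RT.sq G) ≋ rootProduct ring (ψ-roots ts)
  map-Ψ = ≋-trans (map-sq G) (≋-trans (sq-cong _ _ (proj₂ (proj₂ (proj₂ split)))) (≋-sym (ψ-rootProduct ts)))
  map-Φ : mapP Φ ≋ rootProduct ring (φ-roots ts)
  map-Φ = ≋-trans (map-homog m (RP.coef G))
      (≋-trans (homog-cong m λ k → trans (sym (coef-map G k)) (at (proj₂ (proj₂ (proj₂ split))) k))
    (≋-trans (mk≋ λ k → reflexive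
        (≡.cong (λ j → coef (homog j (coef (rootProduct ring (squareRoots ring ts)))) k) (≡.sym |ts|≡m)))
            (≋-sym (φ-rootProduct ts))))
  eval-at-1 : ∀ p → eval ⟦ R.1# ⟧ p ≈ eval 1# p
  eval-at-1 [] = refl
  eval-at-1 (a ∷ p) = +-congˡ (*-cong 1-homo (eval-at-1 p))

-- Products over divisors

module BigProduct (M : CommutativeMonoid 0ℓ 0ℓ) where
  open CommutativeMonoid M
  open import Relation.Binary.Reasoning.Setoid setoid

  -- f 1 ∙ … ∙ f k
  ∏ : ℕ → (ℕ → Carrier) → Carrier
  ∏ zero f = ε
  ∏ (suc k) f = f (suc k) ∙ ∏ k f

  ∏-cong : ∀ k {f g} → (∀ d → 1 ℕ.≤ d → d ℕ.≤ k → f d ≈ g d) → ∏ k f ≈ ∏ k g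
  ∏-cong zero e = refl
  ∏-cong (suc k) e = ∙-cong (e (suc k) (s≤s z≤n) ℕP.≤-refl) (∏-cong k λ d h h′ → e d h (ℕP.m≤n⇒m≤1+n h′))

  ∏-∙ : ∀ k f g → ∏ k (λ d → f d ∙ g d) ≈ ∏ k f ∙ ∏ k g
  ∏-∙ zero f g = sym (identityˡ ε)
  ∏-∙ (suc k) f g = begin
    f (suc k) ∙ g (suc k) ∙ ∏ k (λ d → f d ∙ g d) ≈⟨ ∙-congˡ (∏-∙ k f g) ⟩
    f (suc k) ∙ g (suc k) ∙ (∏ k f ∙ ∏ k g) ≈⟨ interchange (f (suc k)) (g (suc k)) (∏ k f) (∏ k g) ⟩
    f (suc k) ∙ ∏ k f ∙ (g (suc k) ∙ ∏ k g) ∎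
    where open import Algebra.Properties.CommutativeSemigroup commutativeSemigroup using (interchange)

  ∏-ε : ∀ k {f} → (∀ d → 1 ℕ.≤ d → d ℕ.≤ k → f d ≈ ε) → ∏ k f ≈ ε
  ∏-ε zero e = refl
  ∏-ε (suc k) e = trans (∙-cong (e (suc k) (s≤s z≤n) ℕP.≤-refl) (∏-ε k λ d h h′ → e d h (ℕP.m≤n⇒m≤1+n h′)))
      (identityˡ ε)

  ∏-single : ∀ k e {f} → 1 ℕ.≤ e → e ℕ.≤ k → (∀ d → 1 ℕ.≤ d → d ≢ e → f d ≈ ε) → ∏ k f ≈ f e
  ∏-single zero e 1≤e e≤0 _ = ⊥-elim (ℕP.<⇒≱ 1≤e e≤0)
  ∏-single (suc k) e {f} 1≤e e≤k h with ℕP.m≤n⇒m<n∨m≡n e≤k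
  ... | inj₂ ≡.refl = trans (∙-congˡ (∏-ε k λ d 1≤d d≤k → h d 1≤d λ { ≡.refl → ℕP.<-irrefl ≡.refl d≤k }))
      (identityʳ _)
  ... | inj₁ (s≤s e≤k′) = trans
      (∙-cong (h (suc k) (s≤s z≤n) λ { ≡.refl → ℕP.<-irrefl ≡.refl e≤k′ }) (∏-single k e 1≤e e≤k′ h)) (identityˡ _)

  ∏-extend : ∀ j k {f} → (∀ d → k ℕ.< d → f d ≈ ε) → ∏ (j ℕ.+ k) f ≈ ∏ k f
  ∏-extend zero k h = refl
  ∏-extend (suc j) k h = trans (∙-cong (h _ (s≤s (ℕP.m≤n+m k j))) (∏-extend j k h)) (identityˡ _)

  ∏-extend-≤ : ∀ {k l} → k ℕ.≤ l → ∀ {f} → (∀ d → k ℕ.< d → f d ≈ ε) → ∏ l f ≈ ∏ k f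
  ∏-extend-≤ {k} {l} k≤l {f} h = trans (reflexive (≡.cong (λ n → ∏ n f) (≡.sym (ℕP.m∸n+n≡m k≤l))))
      (∏-extend (l ∸ k) k h)

  ∏-swap : ∀ k l (f : ℕ → ℕ → Carrier) → ∏ k (λ i → ∏ l (f i)) ≈ ∏ l (λ j → ∏ k (λ i → f i j))
  ∏-swap zero l f = sym (∏-ε l λ _ _ _ → refl)
  ∏-swap (suc k) l f = trans (∙-congˡ (∏-swap k l f)) (sym (∏-∙ l _ _))

  -- With ε at the other indices, a product over divisors runs over an interval, which can be
  -- extended, split and interchanged with another one.
  at-divisor : ℕ → (ℕ → Carrier) → ℕ → Carrier
  at-divisor n f d with d ∣? n
  ... | yes _ = f d
  ... | no _ = ε

  at-divisor-∣ : ∀ {n f d} → d ∣ n → at-divisor n f d ≡ f d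
  at-divisor-∣ {n} {f} {d} h with d ∣? n
  ... | yes _ = ≡.refl
  ... | no h′ = ⊥-elim (h′ h)

  at-divisor-∤ : ∀ {n f d} → ¬ d ∣ n → at-divisor n f d ≡ ε
  at-divisor-∤ {n} {f} {d} h with d ∣? n
  ... | yes h′ = ⊥-elim (h h′)
  ... | no _ = ≡.refl

  at-divisor-elim : ∀ n f d (Q : Carrier → Set) → (d ∣ n → Q (f d)) → Q ε → Q (at-divisor n f d)
  at-divisor-elim n f d Q q q′ with d ∣? n
  ... | yes h = q h
  ... | no _ = q′

  at-divisor-cong : ∀ n {f g} d → (d ∣ n → f d ≈ g d) → at-divisor n f d ≈ at-divisor n g d
  at-divisor-cong n d e with d ∣? n
  ... | yes h = e h
  ... | no _ = refl

  at-divisor-∙ : ∀ n f g d → at-divisor n (λ d → f d ∙ g d) d ≈ at-divisor n f d ∙ at-divisor n g d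
  at-divisor-∙ n f g d with d ∣? n
  ... | yes _ = refl
  ... | no _ = sym (identityˡ ε)

  ∏∣ : ℕ → (ℕ → Carrier) → Carrier
  ∏∣ n f = ∏ n (at-divisor n f)

  ∏∣-∙ : ∀ n f g → ∏∣ n (λ d → f d ∙ g d) ≈ ∏∣ n f ∙ ∏∣ n g
  ∏∣-∙ n f g = trans (∏-cong n λ d _ _ → at-divisor-∙ n f g d) (∏-∙ n _ _)

  ∏∣-single : ∀ n e {f} → 1 ℕ.≤ e → e ∣ suc n → (∀ d → 1 ℕ.≤ d → d ≢ e → f d ≈ ε) → ∏∣ (suc n) f ≈ f e
  ∏∣-single n e {f} 1≤e e∣n h = trans (∏-single (suc n) e 1≤e (∣⇒≤ e∣n) λ d 1≤d d≢e →
    at-divisor-elim (suc n) f d (_≈ ε) (λ _ → h d 1≤d d≢e) refl) (reflexive (at-divisor-∣ e∣n))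

  ∏∣-ε : ∀ n {f} → (∀ d → 1 ℕ.≤ d → d ∣ n → f d ≈ ε) → ∏∣ n f ≈ ε
  ∏∣-ε n {f} h = ∏-ε n λ d 1≤d _ → at-divisor-elim n f d (_≈ ε) (h d 1≤d) refl

  new-divisor : ℕ → ℕ → (ℕ → Carrier) → ℕ → Carrier
  new-divisor g n f d with d ∣? g
  ... | yes _ = ε
  ... | no _ = at-divisor n f d

  at-divisor-split : ∀ {g n} f d → g ∣ n → at-divisor n f d ≈ at-divisor g f d ∙ new-divisor g n f d
  at-divisor-split {g} {n} f d g∣n with d ∣? g
  ... | yes d∣g = trans (reflexive (at-divisor-∣ (∣-trans d∣g g∣n))) (sym (identityʳ _))
  ... | no _ = sym (identityˡ _)

  ∏-divisors-split : ∀ {g n} k f → 1 ℕ.≤ g → g ∣ n → g ℕ.≤ k → ∏ k (at-divisor n f) ≈ ∏∣ g f ∙ ∏ k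
      (new-divisor g n f)
  ∏-divisors-split {suc g} {n} k f _ g∣n g≤k = trans (∏-cong k λ d _ _ → at-divisor-split f d g∣n)
      (trans (∏-∙ k _ _)
    (∙-congʳ (∏-extend-≤ g≤k λ d g<d → reflexive (at-divisor-∤ λ d∣g → ℕP.<⇒≱ g<d (∣⇒≤ d∣g)))))

  ∏∣-last : ∀ n f → ∏∣ (suc n) f ≈ f (suc n) ∙ ∏ n (at-divisor (suc n) f)
  ∏∣-last n f = ∙-congʳ (reflexive (at-divisor-∣ {suc n} {f} ∣-refl))

-- Functions with prescribed products over divisors

m<n*m : ∀ m n .{{_ : ℕ.NonZero m}} → 1 ℕ.< n → m ℕ.< n ℕ.* m
m<n*m m n 1<n = ≡.subst (m ℕ.<_) (ℕP.*-comm m n) (ℕP.m<m*n m n 1<n)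

divisor-positive : ∀ {g n} → 1 ℕ.≤ n → g ∣ n → 1 ℕ.≤ g
divisor-positive {zero} 1≤n (divides q e) = ⊥-elim (ℕP.<⇒≱ 1≤n (ℕP.≤-reflexive (≡.trans e (ℕP.*-zeroʳ q))))
divisor-positive {suc g} _ _ = s≤s z≤n

prime-power-divisor : ∀ {p} → Prime p → ∀ k q → q ∣ p ℕ.^ k → q ≡ 1 ⊎ p ∣ q
prime-power-divisor pp zero q h = inj₁ (∣1⇒≡1 h)
prime-power-divisor {p} pp (suc k) q h with p ∣? q
... | yes p∣q = inj₂ p∣q
... | no p∤q = prime-power-divisor pp k q (coprime-divisor coprime h)
  where
  coprime : Coprime q p
  coprime (d∣q , d∣p) with prime⇒irreducible pp d∣p
  ... | inj₁ d≡1 = d≡1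
  ... | inj₂ ≡.refl = ⊥-elim (p∤q d∣q)

module DivisorProducts (u : ℕ → ℕ) (product-u : ∀ n → BigProduct.∏∣ ℕP.*-1-commutativeMonoid (suc n) u ≡ suc n) where
  open BigProduct ℕP.*-1-commutativeMonoid

  product-u′ : ∀ n → 1 ℕ.≤ n → ∏∣ n u ≡ n
  product-u′ (suc n) _ = product-u n

  u-1 : u 1 ≡ 1
  u-1 = ≡.trans (≡.sym (ℕP.*-identityʳ (u 1))) (≡.trans (≡.sym (∏∣-last 0 u)) (product-u 0))

  -- All proper divisors of n + 1 are divisors of g, and over these the product is g.
  one-new-divisor : ∀ n g → 1 ℕ.≤ g → g ∣ suc n → g ℕ.≤ n → (∀ d → d ℕ.≤ n → d ∣ suc n → d ∣ g) → suc n ≡ u (suc n)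
      ℕ.* g
  one-new-divisor n g 1≤g g∣n g≤n h = ≡.trans (≡.sym (product-u n)) (≡.trans (∏∣-last n u) (≡.cong (u (suc n) ℕ.*_)
    (≡.trans (∏-divisors-split n u 1≤g g∣n g≤n)
        (≡.trans (≡.cong (∏∣ g u ℕ.*_) (∏-ε n λ d _ d≤n → none d d≤n))
            (≡.trans (ℕP.*-identityʳ _) (product-u′ g 1≤g))))))
    where
    none : ∀ d → d ℕ.≤ n → new-divisor g (suc n) u d ≡ 1
    none d d≤n with d ∣? g
    ... | yes _ = ≡.refl
    ... | no d∤g = at-divisor-∤ λ d∣n → d∤g (h d d≤n d∣n)

  -- The function u is the exponential of the von Mangoldt function. The proper divisors of pᵅ⁺¹ are
  -- those of pᵅ, whence pᵅ⁺¹ = u(pᵅ⁺¹) pᵅ.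
  u-prime-power : ∀ p α → Prime p → u (p ℕ.^ suc α) ≡ p
  u-prime-power p α pp = go (p ℕ.^ suc α) ≡.refl
    where
    instance
      p≢0 : ℕ.NonZero p
      p≢0 = prime⇒nonZero pp
      p^≢0 : ℕ.NonZero (p ℕ.^ α)
      p^≢0 = ℕP.m^n≢0 p α
    1<p : 1 ℕ.< p
    1<p = ℕ.nonTrivial⇒n>1 p {{prime⇒nonTrivial pp}}
    go : ∀ N → N ≡ p ℕ.^ suc α → u N ≡ p
    go zero e = ⊥-elim (ℕP.<⇒≢ (ℕ.>-nonZero⁻¹ (p ℕ.^ suc α) {{ℕP.m^n≢0 p (suc α)}}) e)
    go (suc n) e = ℕP.*-cancelʳ-≡ (u (suc n)) p (p ℕ.^ α) (≡.trans (≡.sym (one-new-divisor n (p ℕ.^ α)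
        (ℕ.>-nonZero⁻¹ (p ℕ.^ α)) (divides p e)
            (ℕ.s≤s⁻¹ (≡.subst (p ℕ.^ α ℕ.<_) (≡.sym e) (m<n*m (p ℕ.^ α) p 1<p))) divisor)) e)
      where
      divisor : ∀ d → d ℕ.≤ n → d ∣ suc n → d ∣ p ℕ.^ α
      divisor d d≤n (divides q e′) with prime-power-divisor pp (suc α) q
          (divides d (≡.trans (≡.sym e) (≡.trans e′ (ℕP.*-comm q d))))
      ... | inj₁ ≡.refl = ⊥-elim (ℕP.<⇒≢ (s≤s d≤n) (≡.sym (≡.trans e′ (ℕP.+-identityʳ d))))
      ... | inj₂ (divides q′ ≡.refl) = divides q′
          (ℕP.*-cancelˡ-≡ (p ℕ.^ α) (q′ ℕ.* d) p (≡.trans (≡.sym e) (≡.trans e′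
          (≡.trans (≡.cong (ℕ._* d) (ℕP.*-comm q′ p)) (ℕP.*-assoc p q′ d)))))

  -- The divisors of a and of b have only 1 in common and already contribute a b.
  u-coprime-product : ∀ a b → 1 ℕ.< a → 1 ℕ.< b → (∀ d → d ∣ a → d ∣ b → d ≡ 1) → u (a ℕ.* b) ≡ 1
  u-coprime-product a b 1<a 1<b coprime = go (a ℕ.* b) ≡.refl
    where
    instance
      a≢0 : ℕ.NonZero a
      a≢0 = ℕ.>-nonZero (ℕP.<-trans (s≤s z≤n) 1<a)
      b≢0 : ℕ.NonZero b
      b≢0 = ℕ.>-nonZero (ℕP.<-trans (s≤s z≤n) 1<b)
    go : ∀ N → N ≡ a ℕ.* b → u N ≡ 1
    go zero e = ⊥-elim (ℕP.<⇒≢ (ℕ.>-nonZero⁻¹ (a ℕ.* b) {{ℕP.m*n≢0 a b}}) e)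
    go (suc n) e = ℕP.m*n≡1⇒m≡1 (u (suc n)) (∏ n rest) (ℕP.*-cancelˡ-≡ (u (suc n) ℕ.* ∏ n rest) 1 (suc n) (begin
      suc n ℕ.* (u (suc n) ℕ.* ∏ n rest) ≡⟨ ≡.cong (ℕ._* (u (suc n) ℕ.* ∏ n rest)) e ⟩
      a ℕ.* b ℕ.* (u (suc n) ℕ.* ∏ n rest)
          ≡⟨ NS.solve 4 (λ a b u r → a NS.:* b NS.:* (u NS.:* r) NS.:= u NS.:* (a NS.:* (b NS.:* r))) ≡.refl a b
              (u (suc n)) (∏ n rest) ⟩
      u (suc n) ℕ.* (a ℕ.* (b ℕ.* ∏ n rest))
          ≡⟨ ≡.cong (u (suc n) ℕ.*_)
              (≡.cong₂ ℕ._*_ (product-u′ a (ℕP.<⇒≤ 1<a)) (≡.cong (ℕ._* ∏ n rest) (product-u′ b (ℕP.<⇒≤ 1<b)))) ⟨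
      u (suc n) ℕ.* (∏∣ a u ℕ.* (∏∣ b u ℕ.* ∏ n rest))
          ≡⟨ ≡.cong (λ x → u (suc n) ℕ.* (∏∣ a u ℕ.* (x ℕ.* ∏ n rest)))
              (∏-extend-≤ b≤n (λ d b<d → at-divisor-∤ λ d∣b → ℕP.<⇒≱ b<d (∣⇒≤ d∣b))) ⟨
      u (suc n) ℕ.* (∏∣ a u ℕ.* (∏ n (at-divisor b u) ℕ.* ∏ n rest))
          ≡⟨ ≡.cong (λ x → u (suc n) ℕ.* (∏∣ a u ℕ.* x))
              (≡.trans (≡.sym (∏-∙ n (at-divisor b u) rest)) (∏-cong n λ d _ _ → ≡.sym (split d))) ⟩
      u (suc n) ℕ.* (∏∣ a u ℕ.* ∏ n (new-divisor a (suc n) u))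
          ≡⟨ ≡.cong (u (suc n) ℕ.*_) (∏-divisors-split n u (ℕP.<⇒≤ 1<a) a∣n a≤n) ⟨
      u (suc n) ℕ.* ∏ n (at-divisor (suc n) u) ≡⟨ ∏∣-last n u ⟨
      ∏∣ (suc n) u ≡⟨ product-u n ⟩
      suc n ≡⟨ ℕP.*-identityʳ (suc n) ⟨
      suc n ℕ.* 1 ∎))
      where
      open ≡.≡-Reasoning
      a∣n : a ∣ suc n
      a∣n = divides b (≡.trans e (ℕP.*-comm a b))
      b∣n : b ∣ suc n
      b∣n = divides a e
      a≤n : a ℕ.≤ n
      a≤n = ℕ.s≤s⁻¹ (≡.subst (a ℕ.<_) (≡.sym e) (ℕP.m<m*n a b 1<b))
      b≤n : b ℕ.≤ n
      b≤n = ℕ.s≤s⁻¹ (≡.subst (b ℕ.<_) (≡.sym e) (m<n*m b a 1<a))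
      -- Only the divisors dividing neither a nor b keep their value here.
      rest : ℕ → ℕ
      rest d with d ∣? a
      ... | yes _ = 1
      ... | no _ = new-divisor b (suc n) u d
      split : ∀ d → new-divisor a (suc n) u d ≡ at-divisor b u d ℕ.* rest d
      split d with d ∣? a
      ... | no _ = at-divisor-split u d b∣n
      ... | yes d∣a with d ∣? b
      ...   | no _ = ≡.refl
      ...   | yes d∣b = ≡.sym (≡.trans (ℕP.*-identityʳ (u d)) (≡.trans (≡.cong u (coprime d d∣a d∣b)) u-1))

extractPrime : ∀ p → Prime p → ∀ fuel m → 1 ℕ.≤ m → m ℕ.≤ fuel → ∃ λ α → ∃ λ r → m ≡ p ℕ.^ α ℕ.* r × ¬ p ∣ r
extractPrime p pp zero (suc m) _ ()
extractPrime p pp (suc fuel) m 1≤m m≤ with p ∣? m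
... | no p∤m = 0 , m , ≡.sym (ℕP.*-identityˡ m) , p∤m
... | yes (divides q ≡.refl) with extractPrime p pp fuel q 1≤q
    (ℕ.s≤s⁻¹ (ℕP.≤-trans (ℕP.m<m*n q p {{ℕ.>-nonZero 1≤q}} (ℕ.nonTrivial⇒n>1 p {{prime⇒nonTrivial pp}})) m≤))
  where
  positive : ∀ q → 1 ℕ.≤ q ℕ.* p → 1 ℕ.≤ q
  positive (suc q) _ = s≤s z≤n
  1≤q : 1 ℕ.≤ q
  1≤q = positive q 1≤m
...   | α , r , e , p∤r = suc α , r , ≡.trans (ℕP.*-comm q p)
    (≡.trans (≡.cong (p ℕ.*_) e) (≡.sym (ℕP.*-assoc p (p ℕ.^ α) r))) , p∤r

primeDivisor : ∀ n → 2 ℕ.≤ n → ∃ λ p → Prime p × p ∣ n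
primeDivisor n 2≤n with factorise n {{ℕ.>-nonZero (ℕP.<-trans (s≤s z≤n) 2≤n)}}
... | record { factors = [] ; isFactorisation = e } = ⊥-elim (ℕP.<⇒≢ 2≤n (≡.sym e))
... | record { factors = p ∷ ps ; isFactorisation = e ; factorsPrime = pp ∷ _ } = p , pp , divides
    (ListN.product ps) (≡.trans e (ℕP.*-comm p _))

PrimePower : ℕ → Set
PrimePower n = ∃ λ p → ∃ λ α → Prime p × 1 ℕ.≤ α × n ≡ p ℕ.^ α

-- Euler's totient function summed over divisors

module TotientSum where
  open BigProduct ℕP.+-0-commutativeMonoid

  ind : {A : Set} → Dec A → ℕ
  ind (yes _) = 1
  ind (no _) = 0

  ind-yes : {A : Set} (a? : Dec A) → A → ind a? ≡ 1
  ind-yes (yes _) _ = ≡.refl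
  ind-yes (no ¬a) a = ⊥-elim (¬a a)

  ind-no : {A : Set} (a? : Dec A) → ¬ A → ind a? ≡ 0
  ind-no (yes a) ¬a = ⊥-elim (¬a a)
  ind-no (no _) _ = ≡.refl

  ind-cong : {A B : Set} (a? : Dec A) (b? : Dec B) → (A → B) → (B → A) → ind a? ≡ ind b?
  ind-cong (yes a) b? f g = ≡.sym (ind-yes b? (f a))
  ind-cong (no ¬a) b? f g = ≡.sym (ind-no b? λ b → ¬a (g b))

  count-≡ : ∀ n k → Defs.countCoprime n k ≡ ∏ k (λ s → ind (gcd s n ℕ.≟ 1))
  count-≡ n zero = ≡.refl
  count-≡ n (suc k) with gcd (suc k) n ℕ.≟ 1
  ... | yes _ = ≡.cong suc (count-≡ n k)
  ... | no _ = count-≡ n k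

  ∏-1 : ∀ n → ∏ n (λ _ → 1) ≡ n
  ∏-1 zero = ≡.refl
  ∏-1 (suc n) = ≡.cong suc (∏-1 n)

  -- The divisor in question is (n + 1) / gcd(s, n + 1). Summing over s and interchanging the sums
  -- counts the s class by class.
  one-divisor : ∀ n s → ∏∣ (suc n) (λ d → ind (gcd s (suc n) ℕ.* d ℕ.≟ suc n)) ≡ 1
  one-divisor n s with gcd[m,n]∣n s (suc n)
  ... | divides q e = ≡.trans
    (∏∣-single n q (divisor-positive (s≤s z≤n) q∣) q∣ λ d _ d≢q → ind-no _ λ e′ → d≢q
        (cancel (gcd s (suc n)) d e′ (≡.trans e′ (≡.trans e (ℕP.*-comm q _)))))
    (ind-yes (gcd s (suc n) ℕ.* q ℕ.≟ suc n) (≡.trans (ℕP.*-comm _ q) (≡.sym e)))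
    where
    q∣ : q ∣ suc n
    q∣ = divides (gcd s (suc n)) (≡.trans e (ℕP.*-comm q _))
    cancel : ∀ g d → g ℕ.* d ≡ suc n → g ℕ.* d ≡ g ℕ.* q → d ≡ q
    cancel (suc g) d _ e″ = ℕP.*-cancelˡ-≡ d q (suc g) e″

  ∏-block : ∀ g k f → (∀ j → 1 ℕ.≤ j → j ℕ.< suc g → f (j ℕ.+ k) ≡ 0) → ∏ (g ℕ.+ k) f ≡ ∏ k f
  ∏-block zero k f z = ≡.refl
  ∏-block (suc g) k f z = ≡.trans (≡.cong (ℕ._+ ∏ (g ℕ.+ k) f) (z (suc g) (s≤s z≤n) ℕP.≤-refl))
    (∏-block g k f λ j 1≤j j<g → z j 1≤j (ℕP.m<n⇒m<1+n j<g))

  ∏-multiples : ∀ g d f → (∀ s → ¬ suc g ∣ s → f s ≡ 0) → ∏ (d ℕ.* suc g) f ≡ ∏ d (λ t → f (t ℕ.* suc g))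
  ∏-multiples g zero f z = ≡.refl
  ∏-multiples g (suc d) f z = ≡.cong₂ ℕ._+_ ≡.refl (≡.trans
    (∏-block g (d ℕ.* suc g) f λ j 1≤j j<g → z _ λ h → ℕP.<⇒≱ j<g
        (∣⇒≤′ 1≤j (∣m+n∣m⇒∣n (≡.subst (suc g ∣_) (ℕP.+-comm j _) h) (divides d ≡.refl))))
    (∏-multiples g d f z))
    where
    ∣⇒≤′ : ∀ {a b} → 1 ℕ.≤ b → a ∣ b → a ℕ.≤ b
    ∣⇒≤′ {b = suc b} _ h = ∣⇒≤ h

  -- The s ≤ n with n / gcd(s, n) = d are the multiples t n/d with t ≤ d coprime to d.
  count-gcd : ∀ n d → d ∣ suc n → ∏ (suc n) (λ s → ind (gcd s (suc n) ℕ.* d ℕ.≟ suc n)) ≡ Defs.φ d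
  count-gcd n d (divides zero ())
  count-gcd n zero (divides (suc g) e) = ⊥-elim (ℕP.0≢1+n (≡.sym (≡.trans e (ℕP.*-zeroʳ g))))
  count-gcd n d@(suc d′) (divides (suc g) e) = ≡.trans (≡.cong (λ k → ∏ k f) (≡.trans e (ℕP.*-comm (suc g) d)))
    (≡.trans (∏-multiples g d f zero-off)
        (≡.trans (∏-cong d λ t _ _ → ind-cong _ _ (to t) (from t)) (≡.sym (count-≡ d d))))
    where
    f : ℕ → ℕ
    f s = ind (gcd s (suc n) ℕ.* d ℕ.≟ suc n)
    is-g : ∀ s → gcd s (suc n) ℕ.* d ≡ suc n → gcd s (suc n) ≡ suc g
    is-g s h = ℕP.*-cancelʳ-≡ (gcd s (suc n)) (suc g) d (≡.trans h e)
    zero-off : ∀ s → ¬ suc g ∣ s → f s ≡ 0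
    zero-off s h = ind-no _ λ h′ → h (≡.subst (_∣ s) (is-g s h′) (gcd[m,n]∣m s (suc n)))
    gcd-scale : ∀ t → gcd (t ℕ.* suc g) (suc n) ≡ suc g ℕ.* gcd t d
    gcd-scale t = ≡.trans (≡.cong₂ gcd (ℕP.*-comm t (suc g)) e) (≡.sym (c*gcd[m,n]≡gcd[cm,cn] (suc g) t d))
    to : ∀ t → gcd (t ℕ.* suc g) (suc n) ℕ.* d ≡ suc n → gcd t d ≡ 1
    to t h = ℕP.*-cancelˡ-≡ (gcd t d) 1 (suc g)
        (≡.trans (≡.sym (gcd-scale t)) (≡.trans (is-g (t ℕ.* suc g) h) (≡.sym (ℕP.*-identityʳ (suc g)))))
    from : ∀ t → gcd t d ≡ 1 → gcd (t ℕ.* suc g) (suc n) ℕ.* d ≡ suc n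
    from t h = ≡.trans (≡.cong (ℕ._* d)
        (≡.trans (gcd-scale t) (≡.trans (≡.cong (suc g ℕ.*_) h) (ℕP.*-identityʳ (suc g))))) (≡.sym e)

  totient-sum : ∀ n → ∏∣ (suc n) Defs.φ ≡ suc n
  totient-sum n = ≡.sym (≡.trans (≡.sym (∏-1 (suc n))) (≡.trans
    (∏-cong (suc n) λ s _ _ → ≡.sym (one-divisor n s))
    (≡.trans (∏-swap (suc n) (suc n) (λ s → at-divisor (suc n) (f s))) (∏-cong (suc n) λ d _ _ → column d))))
    where
    f : ℕ → ℕ → ℕ
    f s d = ind (gcd s (suc n) ℕ.* d ℕ.≟ suc n)
    column : ∀ d → ∏ (suc n) (λ s → at-divisor (suc n) (f s) d) ≡ at-divisor (suc n) Defs.φ d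
    column d with d ∣? suc n
    ... | yes d∣n = count-gcd n d d∣n
    ... | no _ = ∏-ε (suc n) λ _ _ _ → ≡.refl

  ∏∣-determines : ∀ {f g} → (∀ n → ∏∣ (suc n) f ≡ ∏∣ (suc n) g) → ∀ N n → 1 ℕ.≤ n → n ℕ.< N → f n ≡ g n
  ∏∣-determines {f} {g} e (suc N) (suc n) _ (s≤s n<N) = ℕP.+-cancelʳ-≡ (∏ n (at-divisor (suc n) f)) (f (suc n))
      (g (suc n))
    (≡.trans (≡.sym (∏∣-last n f)) (≡.trans (e n) (≡.trans (∏∣-last n g) (≡.cong (g (suc n) ℕ.+_) (≡.sym
      (∏-cong n λ d 1≤d d≤n → at-divisor-cong (suc n) d λ _ → ∏∣-determines e N d 1≤d
          (ℕP.<-≤-trans (s≤s d≤n) n<N)))))))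

-- Integer polynomials

ℤR : CommutativeRing 0ℓ 0ℓ
ℤR = ℤP.+-*-commutativeRing

module ℤr = RingKit ℤR
open Polynomials ℤR
open Substitutions ℤR
open P using (solve; con; _:+_; _:*_; _:-_; :-_; _:=_)
open Determinants ℤR using (det; shift; sylvester; ∑; sgn; minor; det-cong)
open RootProducts ℤR using (reversed; derivativeResultant)

-- Agreement with the given coefficient-list definitions

coef-≡ : ∀ p k → Defs.coef p k ≡ coef p k
coef-≡ [] k = ≡.refl
coef-≡ (a ∷ p) zero = ≡.refl
coef-≡ (a ∷ p) (suc k) = coef-≡ p k

opaque
  unfolding _⊛_

  ⊕-≡ : ∀ p q → p Defs.⊕ q ≡ p ⊕ q
  ⊕-≡ [] q = ≡.refl
  ⊕-≡ (a ∷ p) [] = ≡.refl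
  ⊕-≡ (a ∷ p) (b ∷ q) = ≡.cong (a ℤ.+ b ∷_) (⊕-≡ p q)

  scale-≡ : ∀ c p → Defs.scale c p ≡ scale c p
  scale-≡ c [] = ≡.refl
  scale-≡ c (a ∷ p) = ≡.cong (c ℤ.* a ∷_) (scale-≡ c p)

  ⊛-≡ : ∀ p q → p Defs.⊛ q ≡ p ⊛ q
  ⊛-≡ [] q = ≡.refl
  ⊛-≡ (a ∷ p) q = ≡.trans (⊕-≡ (Defs.scale a q) _) (≡.cong₂ (λ x y → x ⊕ (+ 0 ∷ y)) (scale-≡ a q) (⊛-≡ p q))

⊖-≡ : ∀ p q → p Defs.⊖ q ≡ p P.- q
⊖-≡ p q = ≡.trans (⊕-≡ p (Defs.neg q)) (≡.cong (p ⊕_) (scale-≡ (ℤ.- + 1) q))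

normCons : ℤ → List ℤ → List ℤ
normCons a [] with a ℤP.≟ + 0
... | yes _ = []
... | no _ = a ∷ []
normCons a (b ∷ q) = a ∷ b ∷ q

norm-∷ : ∀ a p → Defs.norm (a ∷ p) ≡ normCons a (Defs.norm p)
norm-∷ a p with Defs.norm p
... | [] with a ℤP.≟ + 0
...   | yes _ = ≡.refl
...   | no _ = ≡.refl
norm-∷ a p | b ∷ q = ≡.refl

normCons-≋ : ∀ a p → normCons a p ≋ a ∷ p
normCons-≋ a [] with a ℤP.≟ + 0
... | yes ≡.refl = ≋-sym 0∷[]
... | no _ = ≋-refl
normCons-≋ a (b ∷ p) = ≋-refl

norm-≋ : ∀ p → Defs.norm p ≋ p
norm-≋ [] = ≋-refl
norm-≋ (a ∷ p) = ≋-trans (≡.subst (λ l → l ≋ a ∷ Defs.norm p) (≡.sym (norm-∷ a p)) (normCons-≋ a (Defs.norm p)))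
    (∷-cong ≡.refl (norm-≋ p))

≈⇒≋ : ∀ {p q} → p Defs.≈ q → p ≋ q
≈⇒≋ {p} {q} e = ≋-trans (≋-sym (norm-≋ p)) (≡.subst (_≋ q) (≡.sym e) (norm-≋ q))

norm-zero : ∀ p → p ≋ [] → Defs.norm p ≡ []
norm-zero [] e = ≡.refl
norm-zero (a ∷ p) e = ≡.trans (norm-∷ a p)
    (≡.trans (≡.cong₂ normCons (at e 0) (norm-zero p (mk≋ λ k → at e (suc k)))) ≡.refl)

≋⇒≈ : ∀ {p q} → p ≋ q → p Defs.≈ q
≋⇒≈ {[]} {q} e = ≡.sym (norm-zero q (≋-sym e))
≋⇒≈ {a ∷ p} {[]} e = norm-zero (a ∷ p) e
≋⇒≈ {a ∷ p} {b ∷ q} e = ≡.trans (norm-∷ a p)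
    (≡.trans (≡.cong₂ normCons (at e 0) (≋⇒≈ (tail-≋ e))) (≡.sym (norm-∷ b q)))

record HasDegree (n : ℕ) (p : List ℤ) : Set where
  constructor hasDegree
  field
    leading≢0 : coef p n ≢ + 0
    bounded : Bounded n p
open HasDegree public

degree-unique : ∀ {m n p} → HasDegree m p → HasDegree n p → m ≡ n
degree-unique {m} {n} (hasDegree l b) (hasDegree l′ b′) with ℕP.<-cmp m n
... | tri< h _ _ = ⊥-elim (l′ (b n h))
... | tri≈ _ e _ = e
... | tri> _ _ h = ⊥-elim (l (b′ m h))

monic⇒degree : ∀ {n p} → IsMonic n p → HasDegree n p
monic⇒degree (t , b) = hasDegree (λ e → case (≡.trans (≡.sym t) e)) b
  where
  case : + 1 ≢ + 0
  case ()

degree-cong : ∀ {n p q} → p ≋ q → HasDegree n p → HasDegree n q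
degree-cong e (hasDegree l b) = hasDegree (λ z → l (≡.trans (at e _) z)) (Bounded-cong e b)

data NormView (p : List ℤ) : Set where
  isZero : p ≋ [] → Defs.norm p ≡ [] → NormView p
  nonZero : ∀ n → HasDegree n p → length (Defs.norm p) ≡ suc n → Defs.lc p ≡ coef p n → NormView p

normView : ∀ p → NormView p
normView p = view p (Defs.norm p) ≡.refl
  where
  last : ∀ (a : ℤ) q → ∃ λ n → length (a ∷ q) ≡ suc n × Defs.lastℤ (a ∷ q) ≡ coef (a ∷ q) n × Bounded n (a ∷ q)
  last a [] = 0 , ≡.refl , ≡.refl , λ { (suc k) _ → ≡.refl }
  last a (b ∷ q) with last b q
  ... | n , e , e′ , bd = suc n , ≡.cong suc e , e′ , λ { (suc k) (s≤s h) → bd k h }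
  tail-norm : ∀ p a b q → Defs.norm p ≡ a ∷ b ∷ q → ∃ λ p′ → Defs.norm p′ ≡ b ∷ q
  tail-norm (c ∷ p) a b q e with Defs.norm p in eq | ≡.trans (≡.sym (norm-∷ c p)) e
  ... | [] | e′ with c ℤP.≟ + 0
  tail-norm (c ∷ p) a b q e | [] | () | yes _
  tail-norm (c ∷ p) a b q e | [] | () | no _
  tail-norm (c ∷ p) a b q e | x ∷ y | ≡.refl = p , eq
  last≢0 : ∀ p a q → Defs.norm p ≡ a ∷ q → Defs.lastℤ (a ∷ q) ≢ + 0
  last≢0 p a (b ∷ q) e with tail-norm p a b q e
  ... | p′ , e′ = last≢0 p′ b q e′
  last≢0 (c ∷ p) a [] e with Defs.norm p | ≡.trans (≡.sym (norm-∷ c p)) e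
  ... | [] | e′ with c ℤP.≟ + 0
  last≢0 (c ∷ p) a [] e | [] | () | yes _
  last≢0 (c ∷ p) .c [] e | [] | ≡.refl | no h = h
  view : ∀ p l → Defs.norm p ≡ l → NormView p
  view p [] e = isZero (≋-trans (≋-sym (norm-≋ p)) (≡.subst (_≋ []) (≡.sym e) ≋-refl)) e
  view p (a ∷ q) e with last a q
  ... | n , len , lst , bd = nonZero n
    (degree-cong p≋ (hasDegree (λ z → last≢0 p a q e (≡.trans lst z)) bd))
    (≡.trans (≡.cong length e) len) (≡.trans (≡.cong Defs.lastℤ e) (≡.trans lst (at p≋ n)))
    where
    p≋ : a ∷ q ≋ p
    p≋ = ≡.subst (_≋ p) e (norm-≋ p)

zero-or-degree : ∀ p → p ≋ [] ⊎ ∃ λ n → HasDegree n p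
zero-or-degree p with normView p
... | isZero z _ = inj₁ z
... | nonZero n d _ _ = inj₂ (n , d)

norm-degree : ∀ {n p} → HasDegree n p → length (Defs.norm p) ≡ suc n × Defs.lc p ≡ coef p n
norm-degree {n} {p} d with normView p
... | isZero z _ = ⊥-elim (leading≢0 d (at z n))
... | nonZero m d′ len l with degree-unique d d′
...   | ≡.refl = len , l

deg-≡ : ∀ {n p} → HasDegree n p → Defs.deg p ≡ n
deg-≡ d = ≡.cong (_∸ 1) (proj₁ (norm-degree d))

monic-deg : ∀ p → Defs.Monic p → IsMonic (Defs.deg p) p
monic-deg p m with normView p
... | isZero z e = ⊥-elim (case (≡.trans (≡.sym m) (≡.cong Defs.lastℤ e)))
  where
  case : + 1 ≢ + 0
  case ()
... | nonZero n d len l rewrite len = ≡.trans (≡.sym l) m , bounded d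

monic⇒Monic : ∀ {n p} → IsMonic n p → Defs.Monic p
monic⇒Monic m = ≡.trans (proj₂ (norm-degree (monic⇒degree m))) (leading≈1 m)

fromℤ-≡ : ∀ n → ℤr.fromℤ (+ n) ≡ + n
fromℤ-≡ zero = ≡.refl
fromℤ-≡ (suc n) = ≡.trans (ℤr.fromℤ-+ (+ 1) (+ n)) (≡.cong (ℤ._+_ (+ 1)) (fromℤ-≡ n))

deriv-≋ : ∀ p → Defs.deriv p ≋ D p
deriv-≋ [] = ≋-refl
deriv-≋ (a ∷ p) = mk≋ λ k → ≡.trans (from 1 p k)
    (≡.sym (≡.trans (coef-D (a ∷ p) k) (≡.cong (ℤ._* coef p k) (fromℤ-≡ (suc k)))))
  where
  from : ∀ i p k → coef (Defs.derivFrom i p) k ≡ + (i ℕ.+ k) ℤ.* coef p k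
  from i [] k = ≡.sym (ℤP.*-zeroʳ (+ (i ℕ.+ k)))
  from i (a ∷ p) zero = ≡.cong (λ j → + j ℤ.* a) (≡.sym (ℕP.+-identityʳ i))
  from i (a ∷ p) (suc k) = ≡.trans (from (suc i) p k) (≡.cong (λ j → + j ℤ.* coef p k) (≡.sym (ℕP.+-suc i k)))

opaque
  unfolding det ∑

  Σᶠ-≡ : ∀ n (f : Fin n → ℤ) g → (∀ i → f i ≡ g (toℕ i)) → Defs.Σᶠ f ≡ ∑ n g
  Σᶠ-≡ zero f g e = ≡.refl
  Σᶠ-≡ (suc n) f g e = ≡.cong₂ ℤ._+_ (e Fin.zero) (Σᶠ-≡ n _ _ λ i → e (Fin.suc i))

  sign-≡ : ∀ k → Defs.signℕ k ≡ sgn k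
  sign-≡ zero = ≡.refl
  sign-≡ (suc k) = ≡.cong ℤ.-_ (sign-≡ k)

  toℕ-punchIn : ∀ {n} (j : Fin (suc n)) (c : Fin n) → toℕ (punchIn j c) ≡ skip (toℕ j) (toℕ c)
  toℕ-punchIn Fin.zero c = ≡.refl
  toℕ-punchIn (Fin.suc j) Fin.zero = ≡.refl
  toℕ-punchIn (Fin.suc j) (Fin.suc c) = ≡.cong suc (toℕ-punchIn j c)

  det-≡ : ∀ n M M′ → (∀ r c → M r c ≡ M′ (toℕ r) (toℕ c)) → Defs.det n M ≡ det n M′
  det-≡ zero M M′ e = ≡.refl
  det-≡ (suc n) M M′ e = Σᶠ-≡ (suc n) _ (λ j → sgn j ℤ.* M′ 0 j ℤ.* det n (minor j M′)) λ j → ≡.cong₂ ℤ._*_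
      (≡.cong₂ ℤ._*_ (sign-≡ (toℕ j)) (e Fin.zero j))
    (det-≡ n _ (minor (toℕ j) M′) λ r c → ≡.trans (e (Fin.suc r) (punchIn j c))
        (≡.cong (M′ (suc (toℕ r))) (toℕ-punchIn j c)))

shift-< : ∀ {i j} F → j ℕ.< i → shift i F j ≡ + 0
shift-< {suc i} {zero} F h = ≡.refl
shift-< {suc i} {suc j} F (s≤s h) = shift-< F h

shift-≥ : ∀ {i j} F → i ℕ.≤ j → shift i F j ≡ F (j ∸ i)
shift-≥ {zero} F h = ≡.refl
shift-≥ {suc i} {suc j} F (s≤s h) = shift-≥ F h

band-≡ : ∀ f m i j → Defs.band f m i j ≡ shift i (reversed m f) j
band-≡ f m i j with i ℕ.≤? j
... | no h = ≡.sym (shift-< (reversed m f) (ℕP.≰⇒> h))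
... | yes h with (j ∸ i) ℕ.≤? m
...   | yes h′ = ≡.trans (coef-≡ f _) (≡.sym (≡.trans (shift-≥ (reversed m f) h) (pick-< (s≤s h′))))
...   | no h′ = ≡.sym (≡.trans (shift-≥ (reversed m f) h) (pick-≥ (ℕP.≰⇒> h′)))

sylvester-≡ : ∀ f g r c → Defs.sylvester f g r c ≡ sylvester (Defs.deg g) (reversed (Defs.deg f) f)
    (reversed (Defs.deg g) g) (toℕ r) (toℕ c)
sylvester-≡ f g r c with toℕ r ℕ.<ᵇ Defs.deg g in eq
... | true = ≡.trans (band-≡ f (Defs.deg f) (toℕ r) (toℕ c))
    (≡.sym (pick-< (ℕP.<ᵇ⇒< (toℕ r) (Defs.deg g) (≡.subst T (≡.sym eq) _))))
... | false = ≡.trans (band-≡ g (Defs.deg g) (toℕ r ∸ Defs.deg g) (toℕ c))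
  (≡.sym (pick-≥ {r = toℕ r} (ℕP.≮⇒≥ {toℕ r} {Defs.deg g} λ h → ≡.subst T eq (ℕP.<⇒<ᵇ h))))

D-degree : ∀ {n p} → IsMonic (suc n) p → HasDegree n (D p)
D-degree {n} {p} (t , b) = hasDegree
  (λ e → case (≡.trans (≡.sym
      (≡.trans (coef-D p n) (≡.trans (≡.cong₂ ℤ._*_ (fromℤ-≡ (suc n)) t) (ℤP.*-identityʳ (+ suc n))))) e))
  λ k h → ≡.trans (coef-D p k)
      (≡.trans (≡.cong (ℤ._*_ (ℤr.fromℤ (+ suc k))) (b (suc k) (s<s h))) (ℤP.*-zeroʳ (ℤr.fromℤ (+ suc k))))
  where
  case : + suc n ≢ + 0
  case ()

divLc-1 : ∀ a → Defs.divLc a (+ 1) ≡ a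
divLc-1 a = ≡.sym (≡.trans (a≡a%n+[a/n]*n a (+ 1))
    (≡.trans (≡.cong (λ r → + r ℤ.+ Defs.divLc a (+ 1) ℤ.* + 1) (ℕP.n<1⇒n≡0 (n%d<d a (+ 1))))
  (≡.trans (ℤP.+-identityˡ (Defs.divLc a (+ 1) ℤ.* + 1)) (ℤP.*-identityʳ (Defs.divLc a (+ 1))))))

disc-≡ : ∀ {n p} → IsMonic (suc n) p → Defs.disc p ≡ Defs.signℕ ((suc n ℕ.* n) ℕ./ 2) ℤ.* derivativeResultant
    (suc n) p
disc-≡ {n} {p} m = ≡.trans
    (≡.cong₂ Defs.divLc (≡.cong₂ (λ x y → Defs.signℕ ((x ℕ.* (x ∸ 1)) ℕ./ 2) ℤ.* y) deg-p res) (monic⇒Monic m))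
        (divLc-1 _)
  where
  deg-p : Defs.deg p ≡ suc n
  deg-p = deg-≡ (monic⇒degree m)
  deg-p′ : Defs.deg (Defs.deriv p) ≡ n
  deg-p′ = deg-≡ (degree-cong (≋-sym (deriv-≋ p)) (D-degree m))
  res : Defs.resultant p (Defs.deriv p) ≡ derivativeResultant (suc n) p
  res = ≡.trans (det-≡ _ _ _ (sylvester-≡ p (Defs.deriv p))) (≡.trans
    (≡.cong₂ (λ d e → det (d ℕ.+ e) (sylvester e (reversed d p) (reversed e (Defs.deriv p)))) deg-p deg-p′)
    (≡.trans (≡.cong (λ k → det k (sylvester n (reversed (suc n) p) (reversed n (Defs.deriv p))))
        (ℕP.+-comm (suc n) n))
      (det-cong (n ℕ.+ suc n) λ r c _ _ → RootProducts.shift-sylvester-cong ℤR n {reversed (suc n) p}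
          (λ _ → ≡.refl) (RootProducts.reversed-cong ℤR n (deriv-≋ p)) r c)))

-- Divisibility and division with remainder over the integers

infix 4 _∣ᵖ_
_∣ᵖ_ : List ℤ → List ℤ → Set
p ∣ᵖ q = ∃ λ c → p ⊛ c ≋ q

∣ₚ⇒∣ᵖ : ∀ {p q} → p Defs.∣ₚ q → p ∣ᵖ q
∣ₚ⇒∣ᵖ {p} {q} (c , e) = c , ≡.subst (_≋ q) (⊛-≡ p c) (≈⇒≋ e)

∣ᵖ⇒∣ₚ : ∀ {p q} → p ∣ᵖ q → p Defs.∣ₚ q
∣ᵖ⇒∣ₚ {p} {q} (c , e) = c , ≋⇒≈ (≡.subst (_≋ q) (≡.sym (⊛-≡ p c)) e)

∣ᵖ-cong : ∀ {p p′ q q′} → p ≋ p′ → q ≋ q′ → p ∣ᵖ q → p′ ∣ᵖ q′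
∣ᵖ-cong {q = q} e e′ (c , d) = c , ≋-trans (⊛-cong (≋-sym e) (≋-refl {c})) (≋-trans d e′)

∣ᵖ-refl : ∀ {p} → p ∣ᵖ p
∣ᵖ-refl = const (+ 1) , P.*-identityʳ _

∣ᵖ-trans : ∀ {p q r} → p ∣ᵖ q → q ∣ᵖ r → p ∣ᵖ r
∣ᵖ-trans {p} {q} {r} (c , e) (d , f) = c ⊛ d , ≋-trans (≋-sym (⊛-assoc p c d)) (≋-trans (⊛-cong e (≋-refl {d})) f)

∣ᵖ-⊕ : ∀ {p q r} → p ∣ᵖ q → p ∣ᵖ r → p ∣ᵖ q ⊕ r
∣ᵖ-⊕ {p} (c , e) (d , f) = c ⊕ d , ≋-trans (⊛-distribˡ p c d) (⊕-cong e f)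

∣ᵖ-⊛ : ∀ {p q} r → p ∣ᵖ q → p ∣ᵖ r ⊛ q
∣ᵖ-⊛ {p} {q} r (c , e) = c ⊛ r , ≋-trans (≋-sym (⊛-assoc p c r)) (≋-trans (⊛-cong e (≋-refl {r})) (⊛-comm q r))

∣ᵖ-⊛ˡ : ∀ p q → p ∣ᵖ p ⊛ q
∣ᵖ-⊛ˡ p q = q , ≋-refl

-≋0⇒≋ : ∀ {p q} → p ⊕ neg q ≋ [] → p ≋ q
-≋0⇒≋ {p} {q} e = ≋-trans (solve 2 (λ p q → p := (p :- q) :+ q) ≋-refl p q)
    (≋-trans (⊕-cong e (≋-refl {q})) (⊕-identityˡ q))

degree-⊛ : ∀ {m n p q} → HasDegree m p → HasDegree n q → HasDegree (m ℕ.+ n) (p ⊛ q)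
degree-⊛ {m} {n} {p} {q} (hasDegree l b) (hasDegree l′ b′) with ⊛-top m n p q b b′
... | t , bd = hasDegree (λ e → case (ℤP.i*j≡0⇒i≡0∨j≡0 (coef p m) (≡.trans (≡.sym t) e))) bd
  where
  case : coef p m ≡ + 0 ⊎ coef q n ≡ + 0 → ⊥
  case (inj₁ e) = l e
  case (inj₂ e) = l′ e

degree≢0 : ∀ {n p} → HasDegree n p → ¬ p ≋ []
degree≢0 d e = leading≢0 d (at e _)

zero-product : ∀ p q → p ⊛ q ≋ [] → p ≋ [] ⊎ q ≋ []
zero-product p q e with zero-or-degree p | zero-or-degree q
... | inj₁ z | _ = inj₁ z
... | inj₂ _ | inj₁ z = inj₂ z
... | inj₂ (m , d) | inj₂ (n , d′) = ⊥-elim (degree≢0 (degree-⊛ d d′) e)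

⊛-cancelˡ : ∀ g {p q} → ¬ g ≋ [] → g ⊛ p ≋ g ⊛ q → p ≋ q
⊛-cancelˡ g {p} {q} g≢0 e = [ (λ z → ⊥-elim (g≢0 z)) , -≋0⇒≋ ]′ (zero-product g (p ⊕ neg q) (≋-trans
  (solve 3 (λ g p q → g :* (p :- q) := g :* p :- g :* q) ≋-refl g p q)
  (≋-trans (⊕-cong e (≋-refl {neg (g ⊛ q)})) (⊕-inverseʳ (g ⊛ q)))))

monic≢0 : ∀ {n p} → IsMonic n p → ¬ p ≋ []
monic≢0 m = degree≢0 (monic⇒degree m)

const-degree : ∀ {c} → c ≢ + 0 → HasDegree 0 (const c)
const-degree c≢0 = hasDegree c≢0 λ { (suc k) _ → ≡.refl }

monic-1 : IsMonic 0 (const (+ 1))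
monic-1 = ≡.refl , λ { (suc k) _ → ≡.refl }

BoundedBelow : ℕ → List ℤ → Set
BoundedBelow n p = ∀ k → n ℕ.≤ k → coef p k ≡ + 0

-- In `pseudoDivide` the scalar is a power of the leading coefficient of d. The field `scalar≡1`
-- makes division by a monic polynomial a special case.
record PseudoDivision (e : ℕ) (d p : List ℤ) : Set where
  field
    scalar : ℤ
    scalar≢0 : scalar ≢ + 0
    scalar≡1 : coef d e ≡ + 1 → scalar ≡ + 1
    quotient remainder : List ℤ
    division : const scalar ⊛ p ≋ d ⊛ quotient ⊕ remainder
    remainder-bounded : BoundedBelow e remainder

-- Horner-style recursion: x times the remainder of the tail, plus a constant, has degree at most e,
-- and a multiple of d by a constant removes the coefficient at e.
pseudoDivide : ∀ e d → HasDegree e d → ∀ p → PseudoDivision e d p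
pseudoDivide e d deg [] = record
  { scalar = + 1 ; scalar≢0 = λ () ; scalar≡1 = λ _ → ≡.refl ; quotient = [] ; remainder = []
  ; division = ≋-trans (⊛-zeroʳ (const (+ 1))) (≋-sym (≋-trans (⊕-cong (⊛-zeroʳ d) (≋-refl {[]})) (⊕-identityˡ [])))
  ; remainder-bounded = λ _ _ → ≡.refl }
pseudoDivide e d deg (a ∷ p) = record
  { scalar = c ℤ.* ℓ
  ; scalar≢0 = λ z → case (ℤP.i*j≡0⇒i≡0∨j≡0 c z)
  ; scalar≡1 = λ c≡1 → ≡.trans (≡.cong₂ ℤ._*_ c≡1 (scalar≡1 c≡1)) ≡.refl
  ; quotient = C ⊛ (X ⊛ s) ⊕ B
  ; remainder = C ⊛ r₁ ⊕ neg (d ⊛ B)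
  ; division = P.begin
      const (c ℤ.* ℓ) ⊛ (a ∷ p) P.≈⟨ ⊛-cong (const-⊛ c ℓ) (∷-≋ a p) ⟩
      (C ⊛ L) ⊛ (const a ⊕ X ⊛ p)
        P.≈⟨ solve 5 (λ C L a x p → (C :* L) :* (a :+ x :* p) := C :* (L :* a) :+ C :* (x :* (L :* p))) ≋-refl C L
            (const a) X p ⟩
      C ⊛ (L ⊛ const a) ⊕ C ⊛ (X ⊛ (L ⊛ p))
          P.≈⟨ ⊕-cong (⊛-congˡ C (≋-sym (const-⊛ ℓ a))) (⊛-congˡ C (⊛-congˡ X division)) ⟩
      C ⊛ const (ℓ ℤ.* a) ⊕ C ⊛ (X ⊛ (d ⊛ s ⊕ r))
        P.≈⟨ solve 7 (λ C a x d s r b → C :* a :+ C :* (x :* (d :* s :+ r))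
               := d :* (C :* (x :* s) :+ b) :+ (C :* (x :* r :+ a) :- d :* b)) ≋-refl C (const (ℓ ℤ.* a)) X d s r
                   B ⟩
      d ⊛ (C ⊛ (X ⊛ s) ⊕ B) ⊕ (C ⊛ r₁ ⊕ neg (d ⊛ B)) P.∎
  ; remainder-bounded = bound }
  where
  open PseudoDivision (pseudoDivide e d deg p) renaming (scalar to ℓ; quotient to s; remainder to r)
  c = coef d e
  C = const c
  L = const ℓ
  r₁ = X ⊛ r ⊕ const (ℓ ℤ.* a)
  b = coef r₁ e
  B = const b
  case : c ≡ + 0 ⊎ ℓ ≡ + 0 → ⊥
  case (inj₁ z) = leading≢0 deg z
  case (inj₂ z) = scalar≢0 z
  coefs : ∀ k → coef (C ⊛ r₁ ⊕ neg (d ⊛ B)) k ≡ c ℤ.* coef r₁ k ℤ.+ ℤ.- (b ℤ.* coef d k)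
  coefs k = ≡.trans (coef-⊕ (C ⊛ r₁) _ k) (≡.cong₂ ℤ._+_
    (≡.trans (≡.sym (at (scale-const c r₁) k)) (coef-scale c r₁ k))
    (≡.trans (coef-neg (d ⊛ B) k)
        (≡.cong ℤ.-_ (≡.trans (at (⊛-comm d B) k) (≡.trans (≡.sym (at (scale-const b d) k)) (coef-scale b d k))))))
  bound : BoundedBelow e (C ⊛ r₁ ⊕ neg (d ⊛ B))
  bound k e≤k with ℕP.m≤n⇒m<n∨m≡n e≤k
  ... | inj₂ ≡.refl = ≡.trans (coefs e)
      (≡.trans (≡.cong (λ x → x ℤ.+ ℤ.- (b ℤ.* c)) (ℤP.*-comm c b)) (ℤP.+-inverseʳ (b ℤ.* c)))
  ... | inj₁ e<k = ≡.trans (coefs k)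
      (≡.trans (≡.cong₂ (λ x y → c ℤ.* x ℤ.+ ℤ.- (b ℤ.* y)) (high k e<k) (bounded deg k e<k))
      (≡.cong₂ (λ x y → x ℤ.+ ℤ.- y) (ℤP.*-zeroʳ c) (ℤP.*-zeroʳ b)))
    where
    high : ∀ k → e ℕ.< k → coef r₁ k ≡ + 0
    high (suc k) (s≤s h) = ≡.trans (coef-⊕ (X ⊛ r) (const (ℓ ℤ.* a)) (suc k))
        (≡.trans (ℤP.+-identityʳ _) (≡.trans (at (X⊛ r) (suc k)) (remainder-bounded k h)))

record MonicDivision (e : ℕ) (g p : List ℤ) : Set where
  field
    quotient remainder : List ℤ
    division : p ≋ g ⊛ quotient ⊕ remainder
    remainder-bounded : BoundedBelow e remainder

monicDivide : ∀ {e g} → IsMonic e g → ∀ p → MonicDivision e g p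
monicDivide {e} {g} m p = record
  { quotient = quotient ; remainder = remainder ; remainder-bounded = remainder-bounded
  ; division = ≋-trans (≋-sym
      (≋-trans (⊛-cong (∷-cong (scalar≡1 (leading≈1 m)) ≋-refl) (≋-refl {p})) (⊛-identityˡ p))) division }
  where open PseudoDivision (pseudoDivide e g (monic⇒degree m) p)

monic-small-multiple : ∀ {e g p} → IsMonic e g → g ∣ᵖ p → BoundedBelow e p → p ≋ []
monic-small-multiple {e} {g} {p} m (c , d) b = ≋-trans (≋-sym d) (≋-trans (⊛-congˡ g c≋0) (⊛-zeroʳ g))
  where
  c≋0 : c ≋ []
  c≋0 = monic-multiple-bounded e g c m λ k h → ≡.trans (at (⊛-comm c g) k) (≡.trans (at d k) (b k h))

∣-remainder : ∀ {g p q r} → g ∣ᵖ p → p ≋ g ⊛ q ⊕ r → g ∣ᵖ r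
∣-remainder {g} {p} {q} {r} (c , d) e = c ⊕ neg q , ≋-trans
  (solve 3 (λ g c q → g :* (c :- q) := g :* c :- g :* q) ≋-refl g c q)
  (≋-trans (⊕-cong (≋-trans d e) (≋-refl {neg (g ⊛ q)}))
    (solve 2 (λ x r → (x :+ r) :- x := r) ≋-refl (g ⊛ q) r))

-- Divide s by g. Then c times the remainder is a multiple of g of smaller degree, hence 0, and ℤ[x]
-- has no zero divisors.
monic-∣-scalar : ∀ {e g} → IsMonic e g → ∀ c s → c ≢ + 0 → g ∣ᵖ const c ⊛ s → g ∣ᵖ s
monic-∣-scalar {e} {g} m c s c≢0 h = quotient , ≋-sym
    (≋-trans division (≋-trans (⊕-cong (≋-refl {g ⊛ quotient}) r≋0) (⊕-identityʳ _)))
  where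
  open MonicDivision (monicDivide m s)
  cr≋0 : const c ⊛ remainder ≋ []
  cr≋0 = monic-small-multiple m
    (∣-remainder {q = const c ⊛ quotient} h (≋-trans (⊛-congˡ (const c) division)
      (solve 4 (λ c g q r → c :* (g :* q :+ r) := g :* (c :* q) :+ c :* r) ≋-refl (const c) g quotient remainder)))
    λ k h → ≡.trans (≡.sym (at (scale-const c remainder) k))
        (≡.trans (coef-scale c remainder k) (≡.trans (≡.cong (ℤ._*_ c) (remainder-bounded k h)) (ℤP.*-zeroʳ c)))
  r≋0 : remainder ≋ []
  r≋0 = [ (λ z → ⊥-elim (c≢0 (at z 0))) , (λ z → z) ]′ (zero-product (const c) remainder cr≋0)

monic-quotient : ∀ {a b f g h} → IsMonic a f → IsMonic b g → f ≋ g ⊛ h → ∃ λ c → a ≡ b ℕ.+ c × IsMonic c h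
monic-quotient {a} {b} {f} {g} {h} mf mg e with zero-or-degree h
... | inj₁ z = ⊥-elim (monic≢0 mf (≋-trans e (≋-trans (⊛-congˡ g z) (⊛-zeroʳ g))))
... | inj₂ (c , d) = c , a≡b+c , record { leading≈1 = top ; monic-bounded = bounded d }
  where
  a≡b+c : a ≡ b ℕ.+ c
  a≡b+c = degree-unique (degree-cong e (monic⇒degree mf)) (degree-⊛ (monic⇒degree mg) d)
  top : coef h c ≡ + 1
  top = ≡.trans (≡.sym (ℤP.*-identityˡ _)) (≡.trans (≡.cong (ℤ._* coef h c) (≡.sym (leading≈1 mg)))
    (≡.trans (≡.sym (proj₁ (⊛-top b c g h (monic-bounded mg) (bounded d))))
        (≡.trans (≡.sym (at e (b ℕ.+ c))) (≡.trans (≡.cong (coef f) (≡.sym a≡b+c)) (leading≈1 mf)))))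

monomial-top : ∀ c k → coef (Defs.monomial c k) k ≡ c × Bounded k (Defs.monomial c k)
monomial-top c zero = ≡.refl , λ { (suc k) _ → ≡.refl }
monomial-top c (suc k) with monomial-top c k
... | t , b = t , λ { (suc j) (s≤s h) → b j h }

norm-length : ∀ p → length (Defs.norm p) ℕ.≤ length p
norm-length [] = z≤n
norm-length (a ∷ p) = ≡.subst (λ l → length l ℕ.≤ suc (length p)) (≡.sym (norm-∷ a p))
    (ℕP.≤-trans (step (Defs.norm p)) (s≤s (norm-length p)))
  where
  step : ∀ l → length (normCons a l) ℕ.≤ suc (length l)
  step [] with a ℤP.≟ + 0
  ... | yes _ = z≤n
  ... | no _ = ℕP.≤-refl
  step (b ∷ l) = ℕP.≤-refl

norm-length-bounded : ∀ n p → BoundedBelow n p → length (Defs.norm p) ℕ.≤ n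
norm-length-bounded n p b with normView p
... | isZero _ e = ≡.subst (ℕ._≤ n) (≡.sym (≡.cong length e)) z≤n
... | nonZero m d len _ = ≡.subst (ℕ._≤ n) (≡.sym len) (ℕP.≰⇒> λ n≤m → leading≢0 d (b m n≤m))

-- The invariant is exactness: after one round the dividend is g times h minus the monomial just
-- found. Its normalised length has dropped, so the fuel suffices.
quotFuel-correct : ∀ {e} g → IsMonic e g → ∀ fuel f h → length (Defs.norm f) ℕ.< fuel → f ≋ g ⊛ h → Defs.quotFuel
    fuel f g ≋ h
quotFuel-correct {e} g m (suc fuel) f h lt f≋gh with Defs.norm f in eq
... | [] with zero-product g h
    (≋-trans (≋-sym f≋gh) (≋-trans (≋-sym (norm-≋ f)) (≡.subst (_≋ []) (≡.sym eq) ≋-refl)))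
...   | inj₁ z = ⊥-elim (monic≢0 m z)
...   | inj₂ z = ≋-sym z
quotFuel-correct {e} g m (suc fuel) f h lt f≋gh | a ∷ f′ with length (a ∷ f′) ℕ.<ᵇ length (Defs.norm g) in eq′
    | zero-or-degree f | zero-or-degree h
... | _ | inj₁ z | _ = ⊥-elim (case (≡.trans (≡.sym eq) (norm-zero f z)))
  where
  case : a ∷ f′ ≢ []
  case ()
... | _ | inj₂ (n , d) | inj₁ z = ⊥-elim (degree≢0 d (≋-trans f≋gh (≋-trans (⊛-congˡ g z) (⊛-zeroʳ g))))
... | true | inj₂ (n , d) | inj₂ (k , d′) = ⊥-elim (ℕP.<⇒≱ n<e (≡.subst (e ℕ.≤_) (≡.sym n≡e+k) (ℕP.m≤m+n e k)))
  where
  n≡e+k : n ≡ e ℕ.+ k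
  n≡e+k = degree-unique (degree-cong f≋gh d) (degree-⊛ (monic⇒degree m) d′)
  n<e : n ℕ.< e
  n<e = ℕ.s≤s⁻¹ (≡.subst₂ ℕ._<_ (≡.trans (≡.cong length (≡.sym eq)) (proj₁ (norm-degree d)))
      (proj₁ (norm-degree (monic⇒degree m)))
    (ℕP.<ᵇ⇒< (length (a ∷ f′)) (length (Defs.norm g)) (≡.subst T (≡.sym eq′) _)))
... | false | inj₂ (n , d) | inj₂ (k , d′) = ≋-trans (≡.subst (_≋ t ⊕ rest) (≡.sym (⊕-≡ t rest)) ≋-refl)
    (≋-trans (⊕-cong (≋-refl {t}) (quotFuel-correct g m fuel f₁ (h ⊕ neg t) fuel-enough f₁≋))
      (solve 2 (λ t h → t :+ (h :- t) := h) ≋-refl t h))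
  where
  t = Defs.monomial (Defs.lc (a ∷ f′)) (Defs.deg (a ∷ f′) ∸ Defs.deg g)
  f₁ = (a ∷ f′) Defs.⊖ (t Defs.⊛ g)
  rest = Defs.quotFuel fuel f₁ g
  norm≋ : a ∷ f′ ≋ f
  norm≋ = ≡.subst (_≋ f) eq (norm-≋ f)
  n≡e+k : n ≡ e ℕ.+ k
  n≡e+k = degree-unique (degree-cong f≋gh d) (degree-⊛ (monic⇒degree m) d′)
  dn : HasDegree n (a ∷ f′)
  dn = degree-cong (≋-sym norm≋) d
  t≡ : t ≡ Defs.monomial (coef f n) k
  t≡ = ≡.cong₂ Defs.monomial (≡.trans (proj₂ (norm-degree dn)) (at norm≋ n))
    (≡.trans (≡.cong₂ _∸_ (≡.trans (deg-≡ dn) n≡e+k) (deg-≡ (monic⇒degree m))) (ℕP.m+n∸m≡n e k))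
  f₁≡ : f₁ ≋ f ⊕ neg (t ⊛ g)
  f₁≡ = ≡.subst (_≋ f ⊕ neg (t ⊛ g))
      (≡.sym (≡.trans (⊖-≡ (a ∷ f′) (t Defs.⊛ g)) (≡.cong (λ x → (a ∷ f′) ⊕ neg x) (⊛-≡ t g))))
    (⊕-cong norm≋ (≋-refl {neg (t ⊛ g)}))
  f₁≋ : f₁ ≋ g ⊛ (h ⊕ neg t)
  f₁≋ = ≋-trans f₁≡ (≋-trans (⊕-cong f≋gh (≋-refl {neg (t ⊛ g)}))
    (solve 3 (λ g h t → g :* h :- t :* g := g :* (h :- t)) ≋-refl g h t))
  tg : coef (t ⊛ g) n ≡ coef f n × Bounded n (t ⊛ g)
  tg with ⊛-top k e (Defs.monomial (coef f n) k) g (proj₂ (monomial-top (coef f n) k)) (monic-bounded m)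
  ... | top , bd rewrite t≡ | ≡.trans n≡e+k (ℕP.+-comm e k) =
    ≡.trans top (≡.trans (≡.cong₂ ℤ._*_ (proj₁ (monomial-top _ k)) (leading≈1 m)) (ℤP.*-identityʳ _)) , bd
  f₁-bounded : BoundedBelow n f₁
  f₁-bounded j n≤j = ≡.trans (at f₁≡ j)
      (≡.trans (coef-⊕ f (neg (t ⊛ g)) j)
          (≡.trans (≡.cong (ℤ._+_ (coef f j)) (coef-neg (t ⊛ g) j)) (cancel (ℕP.m≤n⇒m<n∨m≡n n≤j))))
    where
    cancel : n ℕ.< j ⊎ n ≡ j → coef f j ℤ.+ ℤ.- coef (t ⊛ g) j ≡ + 0
    cancel (inj₁ n<j) = ≡.cong₂ (λ x y → x ℤ.+ ℤ.- y) (bounded d j n<j) (proj₂ tg j n<j)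
    cancel (inj₂ ≡.refl) = ≡.trans (≡.cong (λ y → coef f n ℤ.+ ℤ.- y) (proj₁ tg)) (ℤP.+-inverseʳ (coef f n))
  fuel-enough : length (Defs.norm f₁) ℕ.< fuel
  fuel-enough = ℕP.≤-<-trans (norm-length-bounded n f₁ f₁-bounded)
    (≡.subst (ℕ._≤ fuel) (≡.trans (≡.cong length (≡.sym eq)) (proj₁ (norm-degree d))) (ℕ.s≤s⁻¹ lt))

quotMonic-correct : ∀ {e g f h} → IsMonic e g → f ≋ g ⊛ h → Defs.quotMonic f g ≋ h
quotMonic-correct {g = g} {f} {h} m e = quotFuel-correct g m (suc (length f)) f h (s≤s (norm-length f)) e

-- Fibonacci polynomials

F : ℕ → List ℤ
F zero = []
F (suc zero) = const (+ 1)
F (suc (suc n)) = X ⊛ F (suc n) ⊕ F n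

Fib-≡ : ∀ n → Defs.Fib n ≡ F n
Fib-≡ zero = ≡.refl
Fib-≡ (suc zero) = ≡.refl
Fib-≡ (suc (suc n)) = ≡.trans (⊕-≡ (X Defs.⊛ Defs.Fib (suc n)) (Defs.Fib n))
  (≡.cong₂ _⊕_ (≡.trans (⊛-≡ X (Defs.Fib (suc n))) (≡.cong (X ⊛_) (Fib-≡ (suc n)))) (Fib-≡ n))

F-+ : ∀ m n → F (m ℕ.+ suc n) ≋ F (suc m) ⊛ F (suc n) ⊕ F m ⊛ F n
F-+ zero n = ≋-sym (≋-trans (⊕-cong (⊛-identityˡ _) ([]-⊛ _)) (⊕-identityʳ _))
F-+ (suc m) n = P.begin
  F (suc m ℕ.+ suc n) P.≡⟨ ≡.cong F (ℕP.+-suc m (suc n)) ⟨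
  F (m ℕ.+ suc (suc n)) P.≈⟨ F-+ m (suc n) ⟩
  F (suc m) ⊛ (X ⊛ F (suc n) ⊕ F n) ⊕ F m ⊛ F (suc n)
    P.≈⟨ solve 5 (λ a x b c d → a :* (x :* b :+ c) :+ d :* b := (x :* a :+ d) :* b :+ a :* c) ≋-refl (F (suc m)) X
        (F (suc n)) (F n) (F m) ⟩
  F (suc (suc m)) ⊛ F (suc n) ⊕ F (suc m) ⊛ F n P.∎

-- This is ± 1, so Fₙ and Fₙ₊₁ are invertible modulo each other.
cassini : ℕ → List ℤ
cassini n = F (suc n) ⊛ F (suc n) P.- X ⊛ (F (suc n) ⊛ F n) P.- F n ⊛ F n

-- `cassini (suc n)` is the negative of `cassini n`; squaring hides the alternating sign.
cassini² : ∀ n → cassini n ⊛ cassini n ≋ const (+ 1)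
cassini² zero = ≋-trans (solve 1 (λ x → let c = con (+ 1) :* con (+ 1) :- x :* (con (+ 1) :* con (+ 0)) :- con (+ 0) :* con (+ 0) in c :* c := con (+ 1)) ≋-refl X) ≋-refl
cassini² (suc n) = ≋-trans
  (solve 3 (λ x a b → let a′ = x :* a :+ b ; c = a′ :* a′ :- x :* (a′ :* a) :- a :* a ; d = a :* a :- x :* (a :* b) :- b :* b in c :* c := d :* d) ≋-refl X (F (suc n)) (F n))
  (cassini² n)

-- Ideals containing Fibonacci polynomials

record Ideal : Set₁ where
  field
    _∋_ : List ℤ → Set
    ∋-cong : ∀ {p q} → p ≋ q → _∋_ p → _∋_ q
    ∋-⊕ : ∀ {p q} → _∋_ p → _∋_ q → _∋_ (p ⊕ q)
    ∋-⊛ : ∀ a {p} → _∋_ p → _∋_ (a ⊛ p)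

  infix 4 _∋_

  ∋-neg : ∀ {p} → _∋_ p → _∋_ (neg p)
  ∋-neg {p} h = ∋-cong (solve 1 (λ p → :- con (+ 1) :* p := :- p) ≋-refl p) (∋-⊛ (neg (const (+ 1))) h)

-- The ideal quotient (q) : s. Finding a nonzero integer in it means that q divides an integer
-- multiple of s, so a monic q divides s.
colon : List ℤ → List ℤ → Ideal
colon q s = record
  { _∋_ = λ c → q ∣ᵖ c ⊛ s
  ; ∋-cong = λ e → ∣ᵖ-cong ≋-refl (⊛-cong e (≋-refl {s}))
  ; ∋-⊕ = λ {p} {p′} h h′ → ∣ᵖ-cong ≋-refl (≋-sym (⊛-distribʳ s p p′)) (∣ᵖ-⊕ h h′)
  ; ∋-⊛ = λ a {p} h → ∣ᵖ-cong ≋-refl (≋-sym (⊛-assoc a p s)) (∣ᵖ-⊛ a h) }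

multiples : List ℤ → Ideal
multiples q = record
  { _∋_ = q ∣ᵖ_ ; ∋-cong = ∣ᵖ-cong ≋-refl ; ∋-⊕ = ∣ᵖ-⊕ ; ∋-⊛ = λ r h → ∣ᵖ-⊛ r h }

module _ (I : Ideal) where
  open Ideal I

  ∋-cassini : ∀ n a → I Ideal.∋ cassini n ⊛ a → I Ideal.∋ a
  ∋-cassini n a h = ∋-cong
    (≋-trans (≋-sym (⊛-assoc (cassini n) (cassini n) a))
        (≋-trans (⊛-cong (cassini² n) (≋-refl {a})) (⊛-identityˡ a)))
    (∋-⊛ (cassini n) h)

  -- The addition formula puts `F m ⊛ F n` into the ideal. Modulo `F (suc n)` the factor `F n` is
  -- invertible, since the negative of its square is there `cassini n`.
  ∋-F-cancel : ∀ m n → I Ideal.∋ F (m ℕ.+ suc n) → I Ideal.∋ F (suc n) → I Ideal.∋ F m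
  ∋-F-cancel m n h h′ = ∋-cassini n (F m) (∋-cong
    (solve 4 (λ x a b m → m :* (a :- x :* b) :* a :- b :* (m :* b) := (a :* a :- x :* (a :* b) :- b :* b) :* m)
        ≋-refl X (F (suc n)) (F n) (F m))
    (∋-⊕ (∋-⊛ (F m ⊛ (F (suc n) ⊕ neg (X ⊛ F n))) h′) (∋-neg (∋-⊛ (F n) mn))))
    where
    mn : I Ideal.∋ F m ⊛ F n
    mn = ∋-cong (≋-trans (⊕-cong (F-+ m n) (≋-refl {neg (F (suc m) ⊛ F (suc n))}))
        (solve 2 (λ a b → a :+ b :- a := b) ≋-refl (F (suc m) ⊛ F (suc n)) (F m ⊛ F n)))
      (∋-⊕ h (∋-neg (∋-⊛ (F (suc m)) h′)))

  -- The subtractive Euclidean algorithm on the indices, each subtraction being one use of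
  -- `∋-F-cancel`; the fuel bounds their sum.
  ∋-F-gcd : ∀ fuel m n → m ℕ.+ n ℕ.≤ fuel → I Ideal.∋ F m → I Ideal.∋ F n → ∃ λ g → g ∣ m × g ∣ n × I Ideal.∋ F g
  ∋-F-gcd _ zero n _ _ h = n , n ∣0 , ∣-refl , h
  ∋-F-gcd _ (suc m) zero _ h _ = suc m , ∣-refl , suc m ∣0 , h
  ∋-F-gcd (suc fuel) (suc m) (suc n) (s≤s le) h h′ with ℕP.≤-total m n
  ... | inj₁ m≤n =
    let g , g∣k , g∣m , i = ∋-F-gcd fuel (n ∸ m) (suc m) (ℕP.≤-trans (ℕP.≤-reflexive eq) (ℕP.≤-trans (ℕP.m≤n+m (suc n) m) le))
          (∋-F-cancel (n ∸ m) m (≡.subst (λ k → I Ideal.∋ F k) (≡.sym eq) h′) h) h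
    in g , g∣m , ≡.subst (g ∣_) eq (∣m∣n⇒∣m+n g∣k g∣m) , i
    where
    eq : n ∸ m ℕ.+ suc m ≡ suc n
    eq = ≡.trans (ℕP.+-suc (n ∸ m) m) (≡.cong suc (ℕP.m∸n+n≡m m≤n))
  ... | inj₂ n≤m =
    let g , g∣k , g∣n , i = ∋-F-gcd fuel (m ∸ n) (suc n) (ℕP.≤-trans (ℕP.≤-reflexive eq) (ℕP.≤-trans (ℕP.≤-trans (s≤s (ℕP.m≤m+n m n)) (ℕP.≤-reflexive (≡.sym (ℕP.+-suc m n)))) le))
          (∋-F-cancel (m ∸ n) n (≡.subst (λ k → I Ideal.∋ F k) (≡.sym eq) h) h′) h′
    in g , ≡.subst (g ∣_) eq (∣m∣n⇒∣m+n g∣k g∣n) , g∣n , i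
    where
    eq : m ∸ n ℕ.+ suc n ≡ suc m
    eq = ≡.trans (ℕP.+-suc (m ∸ n) n) (≡.cong suc (ℕP.m∸n+n≡m n≤m))

F-∣ : ∀ {d n} → d ∣ n → F d ∣ᵖ F n
F-∣ {zero} {n} (divides q e) = ≡.subst (λ k → F 0 ∣ᵖ F k) (≡.sym (≡.trans e (ℕP.*-zeroʳ q))) ∣ᵖ-refl
F-∣ {suc d} {n} (divides q e) = ≡.subst (λ k → F (suc d) ∣ᵖ F k) (≡.sym e) (multiple q)
  where
  multiple : ∀ q → F (suc d) ∣ᵖ F (q ℕ.* suc d)
  multiple zero = [] , ⊛-zeroʳ _
  multiple (suc q) = ≡.subst (λ k → F (suc d) ∣ᵖ F k) (ℕP.+-comm (q ℕ.* suc d) (suc d))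
    (∣ᵖ-cong ≋-refl (≋-sym (F-+ (q ℕ.* suc d) d))
      (∣ᵖ-⊕ (∣ᵖ-⊛ (F (suc (q ℕ.* suc d))) ∣ᵖ-refl)
          (∣ᵖ-cong ≋-refl (⊛-comm (F d) (F (q ℕ.* suc d))) (∣ᵖ-⊛ (F d) (multiple q)))))

const-suc : ∀ n → const (+ suc n) ≋ const (+ 1) ⊕ const (+ n)
const-suc n = const-⊕ (+ 1) (+ n)

D-const : ∀ c → D (const c) ≋ []
D-const c = ≋-trans (⊕-identityˡ _) 0∷[]

D-X⊛ : ∀ p → D (X ⊛ p) ≋ p ⊕ X ⊛ D p
D-X⊛ p = ≋-trans (D-cong (X⊛ p)) (⊕-cong (≋-refl {p}) (≋-sym (X⊛ (D p))))

-- Differentiating Binet's formula gives (x² + 4) Fₙ′ = n Lₙ - x Fₙ for the Lucas polynomial Lₙ = 2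
-- Fₙ₊₁ - x Fₙ. Eliminating Lₙ leaves a relation that follows by induction from the recursion of
-- `F`.
F-derivative : ∀ n → (X ⊛ X ⊕ P.fromℤ (+ 4)) ⊛ D (F n) ≋ P.fromℤ (+ 2) ⊛ (const (+ n) ⊛ F (suc n)) P.-
    (const (+ 1) ⊕ const (+ n)) ⊛ (X ⊛ F n)
F-derivative zero = ≋-trans
    (solve 2 (λ x f → (x :* x :+ con (+ 4)) :* con (+ 0) := con (+ 2) :* (con (+ 0) :* con (+ 1)) :-
        (con (+ 1) :+ con (+ 0)) :* (x :* con (+ 0))) ≋-refl X [])
  (⊕-cong (⊛-congˡ (P.fromℤ (+ 2)) (⊛-cong {q = const (+ 1)} (≋-sym 0∷[]) ≋-refl))
      (scale-cong ≡.refl (⊛-cong {q = X ⊛ []} (⊕-cong (≋-refl {const (+ 1)}) (≋-sym 0∷[])) ≋-refl)))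
F-derivative (suc zero) = ≋-trans (⊛-congˡ (X ⊛ X ⊕ P.fromℤ (+ 4)) (D-const (+ 1)))
  (solve 1 (λ x → (x :* x :+ con (+ 4)) :* con (+ 0) := con (+ 2) :* (con (+ 1) :* (x :* con (+ 1) :+ con (+ 0)))
      :- (con (+ 1) :+ con (+ 1)) :* (x :* con (+ 1))) ≋-refl X)
F-derivative (suc (suc n)) = P.begin
  Q ⊛ D (X ⊛ F (suc n) ⊕ F n)
      P.≈⟨ ⊛-congˡ Q (≋-trans (D-⊕ (X ⊛ F (suc n)) (F n)) (⊕-cong (D-X⊛ (F (suc n))) (≋-refl {D (F n)}))) ⟩
  Q ⊛ (F (suc n) ⊕ X ⊛ D (F (suc n)) ⊕ D (F n))
    P.≈⟨ solve 5 (λ q a x da db → q :* (a :+ x :* da :+ db) := q :* a :+ x :* (q :* da) :+ q :* db) ≋-refl Q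
        (F (suc n)) X (D (F (suc n))) (D (F n)) ⟩
  Q ⊛ F (suc n) ⊕ X ⊛ (Q ⊛ D (F (suc n))) ⊕ Q ⊛ D (F n)
    P.≈⟨ ⊕-cong (⊕-cong (≋-refl {Q ⊛ F (suc n)}) (⊛-congˡ X (≋-trans (F-derivative (suc n))
           (⊕-cong (⊛-congˡ (P.fromℤ (+ 2)) (⊛-cong {q = F (suc (suc n))} (const-suc n) ≋-refl))
             (scale-cong ≡.refl (⊛-cong {q = X ⊛ F (suc n)} (⊕-cong (≋-refl {const (+ 1)}) (const-suc n))
                 ≋-refl)))))) (F-derivative n) ⟩
  Q ⊛ F (suc n) ⊕ X ⊛ (P.fromℤ (+ 2) ⊛ ((const (+ 1) ⊕ N) ⊛ F (suc (suc n))) P.- (const (+ 1) ⊕ (const (+ 1) ⊕ N))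
      ⊛ (X ⊛ F (suc n)))
    ⊕ (P.fromℤ (+ 2) ⊛ (N ⊛ F (suc n)) P.- (const (+ 1) ⊕ N) ⊛ (X ⊛ F n))
    P.≈⟨ solve 4 (λ x a b n → let c = x :* a :+ b ; one = con (+ 1) ; two = con (+ 2) in
           (x :* x :+ con (+ 4)) :* a :+ x :* (two :* ((one :+ n) :* c) :- (one :+ (one :+ n)) :* (x :* a)) :+
               (two :* (n :* a) :- (one :+ n) :* (x :* b))
           := two :* ((one :+ (one :+ n)) :* (x :* c :+ a)) :- (one :+ (one :+ (one :+ n))) :* (x :* c)) ≋-refl X
               (F (suc n)) (F n) N ⟩
  P.fromℤ (+ 2) ⊛ ((const (+ 1) ⊕ (const (+ 1) ⊕ N)) ⊛ F (suc (suc (suc n)))) P.-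
      (const (+ 1) ⊕ (const (+ 1) ⊕ (const (+ 1) ⊕ N))) ⊛ (X ⊛ F (suc (suc n)))
    P.≈⟨ ⊕-cong (⊛-congˡ (P.fromℤ (+ 2)) (⊛-cong {q = F (suc (suc (suc n)))} n+2 ≋-refl))
        (scale-cong ≡.refl (⊛-cong {q = X ⊛ F (suc (suc n))} (⊕-cong (≋-refl {const (+ 1)}) n+2) ≋-refl)) ⟨
  P.fromℤ (+ 2) ⊛ (const (+ suc (suc n)) ⊛ F (suc (suc (suc n)))) P.- (const (+ 1) ⊕ const (+ suc (suc n))) ⊛
      (X ⊛ F (suc (suc n))) P.∎
  where
  Q = X ⊛ X ⊕ P.fromℤ (+ 4)
  N = const (+ n)
  n+2 : const (+ suc (suc n)) ≋ const (+ 1) ⊕ (const (+ 1) ⊕ N)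
  n+2 = ≋-trans (const-suc (suc n)) (⊕-cong (≋-refl {const (+ 1)}) (const-suc n))

const-2* : ∀ n → const (+ (2 ℕ.* n)) ≋ P.fromℤ (+ 2) ⊛ const (+ n)
const-2* n = ≋-trans (mk≋ λ k → ≡.cong (λ c → coef (const c) k) (ℤP.pos-* 2 n))
  (≋-trans (const-⊛ (+ 2) (+ n)) (⊛-cong {q = const (+ n)} (const-⊕ (+ 1) (+ 1)) ≋-refl))

-- By `F-derivative` the ideal contains 2n times `F (suc n)`, and `F (suc n)` is a unit modulo
-- `F n`.
∋-discriminant : ∀ (I : Ideal) n → I Ideal.∋ F n → I Ideal.∋ D (F n) → I Ideal.∋ const (+ (2 ℕ.* n))
∋-discriminant I n h h′ = ∋-cong (≋-sym (const-2* n)) (∋-cassini I n _ (∋-cong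
  (solve 4 (λ x a b n → (a :- x :* b) :* (con (+ 2) :* (n :* a)) :- (con (+ 2) :* n :* b) :* b
      := (a :* a :- x :* (a :* b) :- b :* b) :* (con (+ 2) :* n)) ≋-refl X (F (suc n)) (F n) (const (+ n)))
  (∋-⊕ (∋-⊛ (F (suc n) ⊕ neg (X ⊛ F n)) 2nF) (∋-neg (∋-⊛ (P.fromℤ (+ 2) ⊛ const (+ n) ⊛ F n) h)))))
  where
  open Ideal I
  2nF : I Ideal.∋ P.fromℤ (+ 2) ⊛ (const (+ n) ⊛ F (suc n))
  2nF = ∋-cong (≋-trans (⊕-cong (F-derivative n) (≋-refl {(const (+ 1) ⊕ const (+ n)) ⊛ X ⊛ F n}))
      (solve 4 (λ a c x f → a :- c :* (x :* f) :+ c :* x :* f := a) ≋-refl _ (const (+ 1) ⊕ const (+ n)) X (F n)))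
    (∋-⊕ (∋-⊛ (X ⊛ X ⊕ P.fromℤ (+ 4)) h′) (∋-⊛ ((const (+ 1) ⊕ const (+ n)) ⊛ X) h))

-- Factorisation of the Fibonacci polynomials over divisors

open BigProduct P.*-commutativeMonoid
module Sum = BigProduct ℕP.+-0-commutativeMonoid

isEven : ℕ → Bool
isEven zero = true
isEven (suc n) = not (isEven n)

even⇒2∣ : ∀ n → isEven n ≡ true → 2 ∣ n
even⇒2∣ zero _ = 2 ∣0
even⇒2∣ (suc (suc n)) e = ∣m∣n⇒∣m+n (∣-refl {2}) (even⇒2∣ n (≡.trans (≡.sym (not-involutive (isEven n))) e))

2∣⇒even : ∀ n → 2 ∣ n → isEven n ≡ true
2∣⇒even n (divides q ≡.refl) = go q
  where
  go : ∀ q → isEven (q ℕ.* 2) ≡ true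
  go zero = ≡.refl
  go (suc q) = ≡.trans (not-involutive _) (go q)

-- F n = x^[n even] (half n)(x²)
half : ℕ → List ℤ
half zero = []
half (suc zero) = const (+ 1)
half (suc (suc n)) = (if isEven n then half (suc n) else X ⊛ half (suc n)) ⊕ half n

xpar : ℕ → List ℤ
xpar n = if isEven n then X else const (+ 1)

sq-1 : sq (const (+ 1)) ≋ const (+ 1)
sq-1 = mk≋ λ { zero → ≡.refl ; (suc zero) → ≡.refl ; (suc (suc k)) → ≡.refl }

sq-X : sq X ≋ X ⊛ X
sq-X = ≋-sym (≋-trans (X⊛ X)
    (mk≋ λ { zero → ≡.refl ; (suc zero) → ≡.refl ; (suc (suc zero)) → ≡.refl ; (suc (suc (suc zero))) → ≡.refl ;
        (suc (suc (suc (suc k)))) → ≡.refl }))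

F-half : ∀ n → F n ≋ xpar n ⊛ sq (half n)
F-half zero = ≋-sym (⊛-zeroʳ X)
F-half (suc zero) = ≋-sym (≋-trans (⊛-identityˡ _) sq-1)
F-half (suc (suc n)) with isEven n | F-half n | F-half (suc n)
... | true | e | e′ = ≋-trans (⊕-cong (⊛-congˡ X (≋-trans e′ (⊛-identityˡ _))) e)
  (≋-trans (≋-sym (⊛-distribˡ X (sq (half (suc n))) (sq (half n))))
      (⊛-congˡ X (≋-sym (sq-⊕ (half (suc n)) (half n)))))
... | false | e | e′ = ≋-trans (⊕-cong (⊛-congˡ X e′) e) (≋-trans
  (solve 3 (λ x a b → x :* (x :* a) :+ con (+ 1) :* b := con (+ 1) :* (x :* x :* a :+ b)) ≋-refl X
      (sq (half (suc n))) (sq (half n)))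
  (⊛-congˡ (const (+ 1)) (≋-sym
      (≋-trans (sq-⊕ (X ⊛ half (suc n)) (half n))
          (⊕-cong (≋-trans (sq-⊛ X (half (suc n))) (⊛-cong sq-X (≋-refl {sq (half (suc n))}))) ≋-refl)))))

monic-⊕ : ∀ {n p q} → IsMonic n p → BoundedBelow n q → IsMonic n (p ⊕ q)
monic-⊕ {n} {p} {q} (t , b) b′ = ≡.trans (coef-⊕ p q n) (≡.cong₂ ℤ._+_ t (b′ n ℕP.≤-refl)) ,
  λ k h → ≡.trans (coef-⊕ p q k) (≡.cong₂ ℤ._+_ (b k h) (b′ k (ℕP.<⇒≤ h)))

monic-X : IsMonic 1 X
monic-X = ≡.refl , λ { (suc (suc k)) _ → ≡.refl ; (suc zero) (s≤s ()) }

⌊/2⌋-suc-odd : ∀ n → isEven (suc n) ≡ true → ⌊ suc n /2⌋ ≡ suc ⌊ n /2⌋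
⌊/2⌋-suc-odd (suc zero) _ = ≡.refl
⌊/2⌋-suc-odd (suc (suc n)) e = ≡.cong suc (⌊/2⌋-suc-odd n (≡.trans (≡.sym (not-involutive _)) e))

⌊/2⌋-suc-even : ∀ n → isEven (suc n) ≡ false → ⌊ suc n /2⌋ ≡ ⌊ n /2⌋
⌊/2⌋-suc-even zero _ = ≡.refl
⌊/2⌋-suc-even (suc (suc n)) e = ≡.cong suc (⌊/2⌋-suc-even n (≡.trans (≡.sym (not-involutive _)) e))

half-monic : ∀ n → IsMonic ⌊ n /2⌋ (half (suc n))
half-monic zero = monic-1
half-monic (suc zero) = IsMonic-cong (≋-sym (⊕-identityʳ (const (+ 1)))) monic-1
half-monic (suc (suc n)) with isEven (suc n) in eq | half-monic (suc n) | half-monic n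
... | true | m | m′ = monic-⊕ (≡.subst (λ k → IsMonic k (half (suc (suc n)))) (⌊/2⌋-suc-odd n eq) m) λ k h →
    monic-bounded m′ k h
... | false | m | m′ = monic-⊕
    (≡.subst (λ k → IsMonic (suc k) (X ⊛ half (suc (suc n)))) (⌊/2⌋-suc-even n eq) (⊛-monic monic-X m)) λ k h →
        monic-bounded m′ k h

-- Course-of-values recursion: stage n knows the values at all d ≤ n, and the next stage divides
-- `half (suc n)` by the values at its proper divisors. That this division is exact is the content
-- of `factorization-step`.
halfFactorsTo : ℕ → ℕ → List ℤ
halfFactorsTo zero d = const (+ 1)
halfFactorsTo (suc n) d with d ℕ.≤? n
... | yes _ = halfFactorsTo n d
... | no _ = Defs.quotMonic (half (suc n)) (∏ n (at-divisor (suc n) (halfFactorsTo n)))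

-- The paper's Ψₙ is (G n)(x²) for n ≥ 3; G 1 = G 2 = 1, and the factor x = Ψ₂ is kept apart in xpart.
G : ℕ → List ℤ
G d = halfFactorsTo d d

halfFactorsTo-≡ : ∀ n d → d ℕ.≤ n → halfFactorsTo n d ≡ G d
halfFactorsTo-≡ zero zero z≤n = ≡.refl
halfFactorsTo-≡ (suc n) d d≤ with d ℕ.≤? n
... | yes d≤n = halfFactorsTo-≡ n d d≤n
... | no d≰n with ℕP.≤-antisym d≤ (ℕP.≰⇒> d≰n)
...   | ≡.refl with suc n ℕ.≤? n
...     | yes h = ⊥-elim (ℕP.1+n≰n h)
...     | no _ = ≡.refl

G-suc : ∀ n → G (suc n) ≡ Defs.quotMonic (half (suc n)) (∏ n (at-divisor (suc n) (halfFactorsTo n)))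
G-suc n with suc n ℕ.≤? n
... | yes h = ⊥-elim (ℕP.1+n≰n h)
... | no _ = ≡.refl

xpart : ℕ → List ℤ
xpart (suc (suc zero)) = X
xpart _ = const (+ 1)

xpart-≢2 : ∀ n → n ≢ 2 → xpart n ≡ const (+ 1)
xpart-≢2 zero h = ≡.refl
xpart-≢2 (suc zero) h = ≡.refl
xpart-≢2 (suc (suc zero)) h = ⊥-elim (h ≡.refl)
xpart-≢2 (suc (suc (suc n))) h = ≡.refl

∏∣-xpart : ∀ n → ∏∣ (suc n) xpart ≋ xpar (suc n)
∏∣-xpart n with isEven (suc n) in eq
... | true = ∏∣-single n 2 (s≤s z≤n) (even⇒2∣ (suc n) eq) λ d _ d≢2 → P.reflexive (xpart-≢2 d d≢2)
... | false = ∏∣-ε (suc n) λ d _ d∣n → P.reflexive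
    (xpart-≢2 d λ { ≡.refl → false≢true (≡.trans (≡.sym eq) (2∣⇒even (suc n) d∣n)) })
  where
  false≢true : false ≢ true
  false≢true ()

Psi : ℕ → List ℤ
Psi n = xpart n ⊛ sq (G n)

∏-sq : ∀ k f → sq (∏ k f) ≋ ∏ k (λ d → sq (f d))
∏-sq zero f = sq-1
∏-sq (suc k) f = ≋-trans (sq-⊛ (f (suc k)) (∏ k f)) (⊛-congˡ (sq (f (suc k))) (∏-sq k f))

sq-at-divisor : ∀ n f d → sq (at-divisor n f d) ≋ at-divisor n (λ d → sq (f d)) d
sq-at-divisor n f d with d ∣? n
... | yes _ = ≋-refl
... | no _ = sq-1

∏-sq-divisors : ∀ k n f → sq (∏ k (at-divisor n f)) ≋ ∏ k (at-divisor n (λ d → sq (f d)))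
∏-sq-divisors k n f = ≋-trans (∏-sq k (at-divisor n f)) (∏-cong k λ d _ _ → sq-at-divisor n f d)

∏-monic : ∀ k {δ f} → (∀ d → 1 ℕ.≤ d → d ℕ.≤ k → IsMonic (δ d) (f d)) → IsMonic (Sum.∏ k δ) (∏ k f)
∏-monic zero h = monic-1
∏-monic (suc k) h = ⊛-monic (h (suc k) (s≤s z≤n) ℕP.≤-refl) (∏-monic k λ d 1≤d d≤k → h d 1≤d (ℕP.m≤n⇒m≤1+n d≤k))

at-divisor-monic : ∀ n {δ f} d → (d ∣ n → IsMonic (δ d) (f d)) → IsMonic (Sum.at-divisor n δ d) (at-divisor n f d)
at-divisor-monic n d h with d ∣? n
... | yes d∣n = h d∣n
... | no _ = monic-1

xdegree : ℕ → ℕ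
xdegree (suc (suc zero)) = 1
xdegree _ = 0

xpart-monic : ∀ n → IsMonic (xdegree n) (xpart n)
xpart-monic zero = monic-1
xpart-monic (suc zero) = monic-1
xpart-monic (suc (suc zero)) = monic-X
xpart-monic (suc (suc (suc n))) = monic-1

xpar≢0 : ∀ n → ¬ xpar n ≋ []
xpar≢0 n with isEven n
... | true = monic≢0 monic-X
... | false = monic≢0 monic-1

degG : ℕ → ℕ
degG n = Defs.deg (G n)

record Factorization (n : ℕ) : Set where
  field
    half-factorization : half n ≋ ∏∣ n G
    G-monic : IsMonic (degG n) (G n)

  Psi-monic : IsMonic (xdegree n ℕ.+ (degG n ℕ.+ degG n)) (Psi n)
  Psi-monic = ⊛-monic (xpart-monic n) (sq-monic (G n) G-monic)

F-factorization : ∀ n → 1 ℕ.≤ n → Factorization n → F n ≋ ∏∣ n Psi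
F-factorization (suc n) _ f = ≋-trans (F-half (suc n)) (≋-trans
  (⊛-cong (≋-sym (∏∣-xpart n))
      (≋-trans (sq-cong _ _ (Factorization.half-factorization f)) (∏-sq-divisors (suc n) (suc n) G)))
  (≋-sym (∏∣-∙ (suc n) xpart (λ d → sq (G d)))))

-- Psi n · F g divides F n, so the derivative of F n lies in the ideal too.
∋-new-factor : ∀ (I : Ideal) n g → 1 ℕ.≤ n → F n ≋ ∏∣ n Psi → g ∣ n → g ℕ.< n → F g ≋ ∏∣ g Psi →
  I Ideal.∋ F g → I Ideal.∋ Psi n → I Ideal.∋ const (+ (2 ℕ.* n))
∋-new-factor I (suc n) zero 1≤n _ 0∣n _ _ _ _ = ⊥-elim (ℕP.<⇒≱ (divisor-positive 1≤n 0∣n) z≤n)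
∋-new-factor I (suc n) g@(suc _) _ Fn g∣n (s≤s g≤n) Fg h h′ = ∋-discriminant I (suc n)
  (∋-cong (≋-sym F≋) (∋-cong (⊛-comm (F g ⊛ R) (Psi (suc n))) (∋-⊛ (F g ⊛ R) h′)))
  (∋-cong (≋-sym (≋-trans (D-cong F≋)
      (≋-trans (D-⊛ (Psi (suc n)) (F g ⊛ R))
          (⊕-cong (≋-refl {D (Psi (suc n)) ⊛ (F g ⊛ R)}) (⊛-comm (Psi (suc n)) (D (F g ⊛ R)))))))
    (∋-⊕ (∋-⊛ (D (Psi (suc n))) (∋-cong (⊛-comm R (F g)) (∋-⊛ R h))) (∋-⊛ (D (F g ⊛ R)) h′)))
  where
  open Ideal I
  R = ∏ n (new-divisor g (suc n) Psi)
  F≋ : F (suc n) ≋ Psi (suc n) ⊛ (F g ⊛ R)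
  F≋ = ≋-trans Fn (≋-trans (∏∣-last n Psi) (⊛-congˡ (Psi (suc n))
    (≋-trans (∏-divisors-split n Psi (s≤s z≤n) g∣n g≤n) (⊛-cong (≋-sym Fg) (≋-refl {R})))))

Psi-∣-F : ∀ n → 1 ℕ.≤ n → F n ≋ ∏∣ n Psi → Psi n ∣ᵖ F n
Psi-∣-F (suc n) _ Fn = ∏ n (at-divisor (suc n) Psi) , ≋-sym (≋-trans Fn (∏∣-last n Psi))

module _ (N : ℕ) (ih : ∀ m → 1 ℕ.≤ m → m ℕ.< N → Factorization m) where

  private
    FΨ : ∀ m → 1 ℕ.≤ m → m ℕ.< N → F m ≋ ∏∣ m Psi
    FΨ m 1≤m m<N = F-factorization m 1≤m (ih m 1≤m m<N)

  -- The ideal (Ψₑ) : s contains `Psi d` and `Psi e`, hence `F d`, `F e` and `F g` for a common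
  -- divisor g of d and e. As d ≠ e, g is a proper divisor of one of them, so `∋-new-factor` yields
  -- a nonzero integer in the ideal.
  Psi-cancel : ∀ d e s → 1 ℕ.≤ d → 1 ℕ.≤ e → d ℕ.< N → e ℕ.< N → d ≢ e → Psi e ∣ᵖ Psi d ⊛ s → Psi e ∣ᵖ s
  Psi-cancel d e s 1≤d 1≤e d<N e<N d≢e h with ∋-F-gcd I (d ℕ.+ e) d e ℕP.≤-refl Fd Fe
    where
    I = colon (Psi e) s
    open Ideal I
    Ψe : I Ideal.∋ Psi e
    Ψe = ∣ᵖ-⊛ˡ (Psi e) s
    multiple : ∀ {p q} → p ∣ᵖ q → I Ideal.∋ p → I Ideal.∋ q
    multiple {p} (c , eq) i = ∋-cong (≋-trans (⊛-comm c p) eq) (∋-⊛ c i)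
    Fd : I Ideal.∋ F d
    Fd = multiple (Psi-∣-F d 1≤d (FΨ d 1≤d d<N)) h
    Fe : I Ideal.∋ F e
    Fe = multiple (Psi-∣-F e 1≤e (FΨ e 1≤e e<N)) Ψe
  ... | g , g∣d , g∣e , i = finish (ℕP.m≤n⇒m<n∨m≡n (∣⇒≤′ 1≤d g∣d)) (ℕP.m≤n⇒m<n∨m≡n (∣⇒≤′ 1≤e g∣e))
    where
    I = colon (Psi e) s
    ∣⇒≤′ : ∀ {a b} → 1 ℕ.≤ b → a ∣ b → a ℕ.≤ b
    ∣⇒≤′ {b = suc b} _ h = ∣⇒≤ h
    1≤g : 1 ℕ.≤ g
    1≤g = divisor-positive 1≤d g∣d
    scalar : ∀ k → 1 ℕ.≤ k → I Ideal.∋ const (+ (2 ℕ.* k)) → Psi e ∣ᵖ s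
    scalar (suc k) _ = monic-∣-scalar (Factorization.Psi-monic (ih e 1≤e e<N)) (+ (2 ℕ.* suc k)) s λ ()
    finish : g ℕ.< d ⊎ g ≡ d → g ℕ.< e ⊎ g ≡ e → Psi e ∣ᵖ s
    finish (inj₁ g<d) _ = scalar d 1≤d
        (∋-new-factor I d g 1≤d (FΨ d 1≤d d<N) g∣d g<d (FΨ g 1≤g (ℕP.<-trans g<d d<N)) i h)
    finish _ (inj₁ g<e) = scalar e 1≤e
        (∋-new-factor I e g 1≤e (FΨ e 1≤e e<N) g∣e g<e (FΨ g 1≤g (ℕP.<-trans g<e e<N)) i (∣ᵖ-⊛ˡ (Psi e) s))
    finish (inj₂ g≡d) (inj₂ g≡e) = ⊥-elim (d≢e (≡.trans (≡.sym g≡d) g≡e))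

  Psi-cancel-∏ : ∀ k e s → k ℕ.< e → e ℕ.< N → Psi e ∣ᵖ ∏ k (at-divisor N Psi) ⊛ s → Psi e ∣ᵖ s
  Psi-cancel-∏ zero e s _ _ h = ∣ᵖ-cong ≋-refl (⊛-identityˡ s) h
  Psi-cancel-∏ (suc k) e s k<e e<N h = Psi-cancel-∏ k e s (ℕP.<-trans (ℕP.n<1+n k) k<e) e<N
    (at-divisor-elim N Psi (suc k) (λ p → Psi e ∣ᵖ p ⊛ s′ → Psi e ∣ᵖ s′)
      (λ _ → Psi-cancel (suc k) e s′ (s≤s z≤n) (ℕP.≤-trans (s≤s z≤n) k<e) (ℕP.<-trans k<e e<N) e<N (ℕP.<⇒≢ k<e))
      (∣ᵖ-cong ≋-refl (⊛-identityˡ s′))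
      (∣ᵖ-cong ≋-refl (⊛-assoc (at-divisor N Psi (suc k)) (∏ k (at-divisor N Psi)) s) h))
    where
    s′ = ∏ k (at-divisor N Psi) ⊛ s

  -- Divisors of N enter one by one: `Psi (suc k)` divides F N, which is the earlier product times
  -- s, and cancelling the earlier factors shows that it divides s.
  ∏-Psi-∣-F : ∀ k → k ℕ.< N → ∏ k (at-divisor N Psi) ∣ᵖ F N
  ∏-Psi-∣-F zero _ = F N , ⊛-identityˡ (F N)
  ∏-Psi-∣-F (suc k) k<N with ∏-Psi-∣-F k (ℕP.<-trans (ℕP.n<1+n k) k<N) | suc k ∣? N
  ... | s , e | no _ = s , ≋-trans (⊛-cong (⊛-identityˡ (∏ k (at-divisor N Psi))) (≋-refl {s})) e
  ... | s , e | yes k∣N with Psi-cancel-∏ k (suc k) s ℕP.≤-refl k<N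
        (∣ᵖ-cong ≋-refl (≋-sym e) (∣ᵖ-trans (Psi-∣-F (suc k) (s≤s z≤n) (FΨ (suc k) (s≤s z≤n) k<N)) (F-∣ k∣N)))
  ...   | t , e′ = t , ≋-trans
    (solve 3 (λ a b t → a :* b :* t := b :* (a :* t)) ≋-refl (Psi (suc k)) (∏ k (at-divisor N Psi)) t)
    (≋-trans (⊛-congˡ (∏ k (at-divisor N Psi)) e′) e)

-- Substituting x² into the division of p by d gives a division of p(x²) by d(x²) with remainder of
-- small degree, which must vanish.
sq-∣-reflect : ∀ {n d p} → IsMonic n d → sq d ∣ᵖ sq p → d ∣ᵖ p
sq-∣-reflect {n} {d} {p} m h = quotient , ≋-sym
    (≋-trans division (≋-trans (⊕-cong (≋-refl {d ⊛ quotient}) r≋0) (⊕-identityʳ _)))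
  where
  open MonicDivision (monicDivide m p)
  r≋0 : remainder ≋ []
  r≋0 = sq-injective-zero remainder (monic-small-multiple (sq-monic d m)
    (∣-remainder {q = sq quotient} h
        (≋-trans (sq-cong _ _ division)
            (≋-trans (sq-⊕ (d ⊛ quotient) remainder) (⊕-cong (sq-⊛ d quotient) ≋-refl))))
    (sq-bounded-below n remainder remainder-bounded))

factorization-step : ∀ n → (∀ m → 1 ℕ.≤ m → m ℕ.< suc n → Factorization m) → Factorization (suc n)
factorization-step n ih = record
  { half-factorization = ≋-trans (≋-sym (proj₂ exact))
      (≋-trans (⊛-cong (≋-refl {D̃}) (≋-sym G≋)) (≋-trans (⊛-comm D̃ (G (suc n))) (≋-sym (∏∣-last n G))))
  ; G-monic = ≡.subst (λ k → IsMonic k (G (suc n))) (≡.sym (deg-≡ (monic⇒degree monic-G))) monic-G }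
  where
  D̃ = ∏ n (at-divisor (suc n) G)
  D̃-monic : IsMonic (Sum.∏ n (Sum.at-divisor (suc n) degG)) D̃
  D̃-monic = ∏-monic n λ d 1≤d d≤n → at-divisor-monic (suc n) d λ _ → Factorization.G-monic (ih d 1≤d (s≤s d≤n))
  exact : D̃ ∣ᵖ half (suc n)
  exact = exact′ n ih D̃-monic
    where
    exact′ : ∀ n → (∀ m → 1 ℕ.≤ m → m ℕ.< suc n → Factorization m) → ∀ {k} → IsMonic k
        (∏ n (at-divisor (suc n) G)) →
      ∏ n (at-divisor (suc n) G) ∣ᵖ half (suc n)
    exact′ zero ih _ = const (+ 1) , ⊛-identityˡ _
    -- For N = 2 the factor x belongs to `Psi 2` itself and to no smaller index, so the argument for
    -- N ≥ 3 does not apply.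
    exact′ (suc zero) ih _ = const (+ 1) , ≋-trans (P.*-identityʳ _)
        (≋-trans (≋-sym (∏-cong 1 {f = at-divisor 1 G} {g = at-divisor 2 G} λ { (suc zero) _ _ →
        P.reflexive (≡.trans (at-divisor-∣ {1} {G} {1} (∣-refl {1}))
            (≡.sym (at-divisor-∣ {2} {G} {1} (divides 2 ≡.refl)))) ; (suc (suc d)) _ (s≤s ()) }))
      (≋-trans (≋-sym (Factorization.half-factorization (ih 1 (s≤s z≤n) (s≤s (s≤s z≤n)))))
          (≋-sym (⊕-identityʳ (const (+ 1))))))
    exact′ (suc (suc n)) ih monic with ∏-Psi-∣-F (3 ℕ.+ n) ih (2 ℕ.+ n) ℕP.≤-refl
    ... | c , e = sq-∣-reflect monic
        (c , ⊛-cancelˡ (xpar N) (xpar≢0 N) (≋-trans (≋-sym (⊛-assoc (xpar N) (sq D′) c))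
        (≋-trans (⊛-cong xs≋ (≋-refl {c})) (≋-trans e (F-half N)))))
      where
      N = 3 ℕ.+ n
      D′ = ∏ (2 ℕ.+ n) (at-divisor N G)
      -- For N ≥ 3 the index 2 is a proper divisor of every even N, so the factor x is already among
      -- the earlier `Psi d`.
      xs≋ : xpar N ⊛ sq D′ ≋ ∏ (2 ℕ.+ n) (at-divisor N Psi)
      xs≋ = ≋-sym (≋-trans (∏-cong (2 ℕ.+ n) λ d _ _ → at-divisor-∙ N xpart (λ d → sq (G d)) d)
        (≋-trans (∏-∙ (2 ℕ.+ n) _ _)
            (⊛-cong (≋-trans (≋-sym (≋-trans (∏∣-last (2 ℕ.+ n) xpart) (⊛-identityˡ _))) (∏∣-xpart (2 ℕ.+ n)))
          (≋-sym (∏-sq-divisors (2 ℕ.+ n) N G)))))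
  c = proj₁ exact
  monic-c : ∃ λ k → ⌊ n /2⌋ ≡ Sum.∏ n (Sum.at-divisor (suc n) degG) ℕ.+ k × IsMonic k c
  monic-c = monic-quotient (half-monic n) D̃-monic (≋-sym (proj₂ exact))
  divisor≋ : ∏ n (at-divisor (suc n) (halfFactorsTo n)) ≋ D̃
  divisor≋ = ∏-cong n λ d _ d≤n → at-divisor-cong (suc n) d λ _ → P.reflexive (halfFactorsTo-≡ n d d≤n)
  G≋ : G (suc n) ≋ c
  G≋ = ≡.subst (_≋ c) (≡.sym (G-suc n)) (quotMonic-correct (IsMonic-cong (≋-sym divisor≋) D̃-monic)
    (≋-sym (≋-trans (⊛-cong divisor≋ (≋-refl {c})) (proj₂ exact))))
  monic-G : IsMonic (proj₁ monic-c) (G (suc n))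
  monic-G = IsMonic-cong (≋-sym G≋) (proj₂ (proj₂ monic-c))

factorizations : ∀ N n → 1 ℕ.≤ n → n ℕ.< N → Factorization n
factorizations (suc N) (suc n) _ (s≤s n<N) = factorization-step n λ m 1≤m m≤n → factorizations N m 1≤m
    (ℕP.<-≤-trans m≤n n<N)

factorization : ∀ n → 1 ℕ.≤ n → Factorization n
factorization n 1≤n = factorizations (suc n) n 1≤n ℕP.≤-refl

-- Cyclotomic polynomials

x+1 x-1 : List ℤ
x+1 = + 1 ∷ + 1 ∷ []
x-1 = linear (+ 1)

X≋x-1+1 : X ≋ x-1 ⊕ const (+ 1)
X≋x-1+1 = mk≋ λ { zero → ≡.sym (coef-⊕ x-1 (const (+ 1)) 0) ; (suc zero) → ≡.sym (coef-⊕ x-1 (const (+ 1)) 1) ;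
    (suc (suc k)) → ≡.sym (coef-⊕ x-1 (const (+ 1)) (suc (suc k))) }

x+1≋ : x+1 ≋ x-1 ⊕ P.fromℤ (+ 2)
x+1≋ = ≋-trans (mk≋ λ { zero → ≡.sym (coef-⊕ x-1 (const (+ 2)) 0) ; (suc zero) → ≡.sym (coef-⊕ x-1 (const (+ 2)) 1)
    ; (suc (suc k)) → ≡.sym (coef-⊕ x-1 (const (+ 2)) (suc (suc k))) })
  (⊕-cong (≋-refl {x-1}) (const-⊕ (+ 1) (+ 1)))

[x+1]²≋ : [x+1]² ≋ x+1 ⊛ x+1
[x+1]²≋ = ≋-sym (≋-trans (linear-⊛ (ℤ.- + 1) x+1) (mk≋ λ where
  zero → ≡.trans (coef-⊕ (scale (+ 1) x+1) (+ 0 ∷ x+1) 0) (≡.cong (ℤ._+ + 0) (coef-scale (+ 1) x+1 0))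
  (suc zero) → ≡.trans (coef-⊕ (scale (+ 1) x+1) (+ 0 ∷ x+1) 1) (≡.cong (ℤ._+ + 1) (coef-scale (+ 1) x+1 1))
  (suc (suc zero)) → ≡.trans (coef-⊕ (scale (+ 1) x+1) (+ 0 ∷ x+1) 2) (≡.cong (ℤ._+ + 1) (coef-scale (+ 1) x+1 2))
  (suc (suc (suc k))) → ≡.trans (coef-⊕ (scale (+ 1) x+1) (+ 0 ∷ x+1) (3 ℕ.+ k))
      (≡.cong (ℤ._+ + 0) (coef-scale (+ 1) x+1 (3 ℕ.+ k)))))

negX≋ : negX ≋ neg X
negX≋ = mk≋ λ { zero → ≡.sym (coef-neg X 0) ; (suc zero) → ≡.sym (coef-neg X 1) ; (suc (suc k)) → ≡.sym
    (coef-neg X (suc (suc k))) }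

-- This will be (xⁿ⁺¹ - 1) / (x - 1), divided also by x + 1 when n + 1 is even.
halfHomog : ℕ → List ℤ
halfHomog n = homog ⌊ n /2⌋ (coef (half (suc n)))

evenFactor : ℕ → List ℤ
evenFactor n = if isEven n then x+1 else const (+ 1)

homog-⊕ : ∀ m p q → homog m (coef (p ⊕ q)) ≋ homog m (coef p) ⊕ homog m (coef q)
homog-⊕ m p q = ≋-trans (homog-cong m (coef-⊕ p q)) (homog-+ m (coef p) (coef q))

homog-index : ∀ {m n} F → m ≡ n → homog m F ≋ homog n F
homog-index F ≡.refl = ≋-refl

homog-X⊛ : ∀ m p → homog (suc m) (coef (X ⊛ p)) ≋ [x+1]² ⊛ homog m (coef p)
homog-X⊛ m p = ≋-trans (homog-cong (suc m) (at (X⊛ p)))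
  (≋-trans (⊕-cong (mk≋ λ k → coef-scale (+ 0) (negX ^ᵖ suc m) k) (≋-refl {[x+1]² ⊛ homog m (coef p)}))
      (⊕-identityˡ _))

homog-raise₁ : ∀ n p → Bounded n p → homog (suc n) (coef p) ≋ neg X ⊛ homog n (coef p)
homog-raise₁ n p b = ≋-trans (homog-raise 1 n (coef p) b)
    (⊛-cong (≋-trans (P.*-identityʳ negX) negX≋) (≋-refl {homog n (coef p)}))

-- The image of the Fibonacci recursion: raising the formal degree by one gives -x, and multiplying
-- by the square of the old variable gives (x + 1)².
halfHomog-step : ∀ n → halfHomog (suc (suc n)) ≋
    (if isEven (suc n) then halfHomog (suc n) else [x+1]² ⊛ halfHomog (suc n)) ⊕ neg X ⊛ halfHomog n
halfHomog-step n with isEven (suc n) in eq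
... | true = ≋-trans (homog-⊕ (suc ⌊ n /2⌋) (half (suc (suc n))) (half (suc n)))
  (⊕-cong (homog-index (coef (half (suc (suc n)))) (≡.sym (⌊/2⌋-suc-odd n eq)))
      (homog-raise₁ ⌊ n /2⌋ (half (suc n)) (monic-bounded (half-monic n))))
... | false = ≋-trans (homog-⊕ (suc ⌊ n /2⌋) (X ⊛ half (suc (suc n))) (half (suc n)))
  (⊕-cong (≋-trans (homog-X⊛ ⌊ n /2⌋ (half (suc (suc n))))
      (⊛-congˡ [x+1]² (homog-index (coef (half (suc (suc n)))) (≡.sym (⌊/2⌋-suc-even n eq)))))
    (homog-raise₁ ⌊ n /2⌋ (half (suc n)) (monic-bounded (half-monic n))))

xⁿ-1 : ℕ → List ℤ
xⁿ-1 n = X ^ᵖ n P.- const (+ 1)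

-- The sequence xⁿ - 1 satisfies s₂ = (x + 1) s₁ - x s₀, with characteristic roots 1 and x. A free
-- boolean for the parity settles three consecutive indices in one case split.
spec-step : ∀ b e₀ e₁ {s₀ s₁} →
  x-1 ⊛ ((if not b then x+1 else const (+ 1)) ⊛ e₀) ≋ s₀ → x-1 ⊛ ((if not (not b) then x+1 else const (+ 1)) ⊛ e₁)
      ≋ s₁ →
  x-1 ⊛ ((if not (not (not b)) then x+1 else const (+ 1)) ⊛ ((if not b then e₁ else [x+1]² ⊛ e₁) ⊕ neg X ⊛ e₀)) ≋
      x+1 ⊛ s₁ ⊕ neg X ⊛ s₀
spec-step true e₀ e₁ s₀ s₁ = ≋-trans
    (⊛-congˡ x-1 (⊛-congˡ (const (+ 1)) (⊕-cong (⊛-cong [x+1]²≋ (≋-refl {e₁})) (≋-refl {neg X ⊛ e₀}))))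
  (≋-trans (solve 5 (λ a x p q y → p :* (con (+ 1) :* (a :* a :* x :+ :- y :* q)) := a :* (p :* (a :* x)) :+ :- y
      :* (p :* (con (+ 1) :* q))) ≋-refl x+1 e₁ x-1 e₀ X)
  (⊕-cong (⊛-congˡ x+1 s₁) (⊛-congˡ (neg X) s₀)))
spec-step false e₀ e₁ s₀ s₁ = ≋-trans
  (solve 5 (λ a x p q y → p :* (a :* (x :+ :- y :* q)) := a :* (p :* (con (+ 1) :* x)) :+ :- y :* (p :* (a :* q)))
      ≋-refl x+1 e₁ x-1 e₀ X)
  (⊕-cong (⊛-congˡ x+1 s₁) (⊛-congˡ (neg X) s₀))

halfHomog-spec : ∀ n → x-1 ⊛ (evenFactor (suc n) ⊛ halfHomog n) ≋ xⁿ-1 (suc n)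
halfHomog-spec zero = ≋-trans
    (solve 1 (λ x → x :* (con (+ 1) :* con (+ 1)) := (x :+ con (+ 1)) :* con (+ 1) :- con (+ 1)) ≋-refl x-1)
  (⊕-cong (⊛-cong (≋-sym X≋x-1+1) (≋-refl {const (+ 1)})) (≋-refl {neg (const (+ 1))}))
halfHomog-spec (suc zero) = ≋-trans (⊛-congˡ x-1 (⊛-cong x+1≋ (homog-cong 0 (at (⊕-identityʳ (const (+ 1)))))))
  (≋-trans (solve 1 (λ x → x :* ((x :+ con (+ 2)) :* con (+ 1)) := (x :+ con (+ 1)) :*
      ((x :+ con (+ 1)) :* con (+ 1)) :- con (+ 1)) ≋-refl x-1)
    (⊕-cong (⊛-cong (≋-sym X≋x-1+1) (⊛-cong (≋-sym X≋x-1+1) (≋-refl {const (+ 1)}))) (≋-refl {neg (const (+ 1))})))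
halfHomog-spec (suc (suc n)) = ≋-trans (⊛-congˡ x-1 (⊛-congˡ (evenFactor (suc (suc (suc n)))) (halfHomog-step n)))
  (≋-trans (spec-step (isEven n) (halfHomog n) (halfHomog (suc n)) (halfHomog-spec n) (halfHomog-spec (suc n)))
      combine)
  where
  combine : x+1 ⊛ xⁿ-1 (suc (suc n)) ⊕ neg X ⊛ xⁿ-1 (suc n) ≋ xⁿ-1 (suc (suc (suc n)))
  combine = ≋-trans (⊕-cong (⊛-cong
      (≋-trans x+1≋ (≋-trans (solve 1 (λ x → x :+ con (+ 2) := (x :+ con (+ 1)) :+ con (+ 1)) ≋-refl x-1)
          (⊕-cong (≋-sym X≋x-1+1) (≋-refl {const (+ 1)})))) (≋-refl {xⁿ-1 (suc (suc n))}))
              (≋-refl {neg X ⊛ xⁿ-1 (suc n)}))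
    (solve 2 (λ x y → (x :+ con (+ 1)) :* (x :* y :- con (+ 1)) :+ :- x :* (y :- con (+ 1)) := x :* (x :* y) :- con
        (+ 1)) ≋-refl X (X ^ᵖ suc n))

H : ℕ → List ℤ
H n = homog (degG n) (coef (G n))

homog-∏ : ∀ k {δ f} → (∀ d → 1 ℕ.≤ d → d ℕ.≤ k → IsMonic (δ d) (f d)) →
  homog (Sum.∏ k δ) (coef (∏ k f)) ≋ ∏ k (λ d → homog (δ d) (coef (f d)))
homog-∏ zero h = ≋-refl
homog-∏ (suc k) {δ} {f} h = ≋-trans
  (homog-⊛ (δ (suc k)) (Sum.∏ k δ) (f (suc k)) (∏ k f) (monic-bounded (h (suc k) (s≤s z≤n) ℕP.≤-refl))
    (monic-bounded (∏-monic k h′)))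
  (⊛-congˡ (homog (δ (suc k)) (coef (f (suc k)))) (homog-∏ k h′))
  where
  h′ : ∀ d → 1 ℕ.≤ d → d ℕ.≤ k → IsMonic (δ d) (f d)
  h′ d 1≤d d≤k = h d 1≤d (ℕP.m≤n⇒m≤1+n d≤k)

∏∣G-monic : ∀ n → IsMonic (Sum.∏∣ n degG) (∏∣ n G)
∏∣G-monic n = ∏-monic n λ d 1≤d _ → at-divisor-monic n d λ _ → Factorization.G-monic (factorization d 1≤d)

halfHomog-∏∣ : ∀ n → halfHomog n ≋ ∏∣ (suc n) H
halfHomog-∏∣ n = ≋-trans (homog-cong ⌊ n /2⌋ (at half≋)) (≋-trans
  (homog-index (coef (∏∣ (suc n) G))
      (degree-unique (degree-cong half≋ (monic⇒degree (half-monic n))) (monic⇒degree (∏∣G-monic (suc n)))))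
  (≋-trans (homog-∏ (suc n) λ d 1≤d _ → at-divisor-monic (suc n) d λ _ → Factorization.G-monic
      (factorization d 1≤d))
    (∏-cong (suc n) λ d _ _ → local d)))
  where
  half≋ = Factorization.half-factorization (factorization (suc n) (s≤s z≤n))
  local : ∀ d → homog (Sum.at-divisor (suc n) degG d) (coef (at-divisor (suc n) G d)) ≋ at-divisor (suc n) H d
  local d with d ∣? suc n
  ... | yes _ = ≋-refl
  ... | no _ = ≋-refl

-- Φ₁ and Φ₂ have the self-inverse roots 1 and - 1 and do not come from pairs w, v, so they are put
-- in by hand.
L₁ L₂ : ℕ → List ℤ
L₁ (suc zero) = x-1
L₁ _ = const (+ 1)
L₂ (suc (suc zero)) = x+1
L₂ _ = const (+ 1)

∏∣-L₁ : ∀ n → ∏∣ (suc n) L₁ ≋ x-1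
∏∣-L₁ n = ∏∣-single n 1 (s≤s z≤n) (divides (suc n) (≡.sym (ℕP.*-identityʳ (suc n)))) λ d 1≤d d≢1 → P.reflexive
    (other d 1≤d d≢1)
  where
  other : ∀ d → 1 ℕ.≤ d → d ≢ 1 → L₁ d ≡ const (+ 1)
  other (suc zero) _ h = ⊥-elim (h ≡.refl)
  other (suc (suc d)) _ _ = ≡.refl

∏∣-L₂ : ∀ n → ∏∣ (suc n) L₂ ≋ evenFactor (suc n)
∏∣-L₂ n with isEven (suc n) in eq
... | true = ∏∣-single n 2 (s≤s z≤n) (even⇒2∣ (suc n) eq) λ d _ d≢2 → P.reflexive (other d d≢2)
  where
  other : ∀ d → d ≢ 2 → L₂ d ≡ const (+ 1)
  other zero _ = ≡.refl
  other (suc zero) _ = ≡.refl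
  other (suc (suc zero)) h = ⊥-elim (h ≡.refl)
  other (suc (suc (suc d))) _ = ≡.refl
... | false = ∏∣-ε (suc n) λ d _ d∣n → P.reflexive (other d d∣n)
  where
  other : ∀ d → d ∣ suc n → L₂ d ≡ const (+ 1)
  other zero _ = ≡.refl
  other (suc zero) _ = ≡.refl
  other (suc (suc zero)) d∣n with ≡.trans (≡.sym eq) (2∣⇒even (suc n) d∣n)
  ... | ()
  other (suc (suc (suc d))) _ = ≡.refl

-- Q n is Φₙ, and Q′ leaves out the factor x - 1 = Φ₁.
Q′ Q : ℕ → List ℤ
Q′ n = L₂ n ⊛ H n
Q n = L₁ n ⊛ Q′ n

∏∣-Q′ : ∀ n → x-1 ⊛ ∏∣ (suc n) Q′ ≋ xⁿ-1 (suc n)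
∏∣-Q′ n = ≋-trans (⊛-congˡ x-1 (≋-trans (∏∣-∙ (suc n) L₂ H) (⊛-cong (∏∣-L₂ n) (≋-sym (halfHomog-∏∣ n)))))
    (halfHomog-spec n)

∏∣-Q : ∀ n → ∏∣ (suc n) Q ≋ xⁿ-1 (suc n)
∏∣-Q n = ≋-trans (∏∣-∙ (suc n) L₁ Q′) (≋-trans (⊛-cong (∏∣-L₁ n) (≋-refl {∏∣ (suc n) Q′})) (∏∣-Q′ n))

degL₁ degL₂ degQ : ℕ → ℕ
degL₁ (suc zero) = 1
degL₁ _ = 0
degL₂ (suc (suc zero)) = 1
degL₂ _ = 0
degQ n = degL₁ n ℕ.+ (degL₂ n ℕ.+ (degG n ℕ.+ degG n))

monic-linear : ∀ a → IsMonic 1 (linear a)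
monic-linear a = ≡.refl , λ { (suc (suc k)) _ → ≡.refl ; (suc zero) (s≤s ()) }

L₁-monic : ∀ n → IsMonic (degL₁ n) (L₁ n)
L₁-monic zero = monic-1
L₁-monic (suc zero) = monic-linear (+ 1)
L₁-monic (suc (suc n)) = monic-1

L₂-monic : ∀ n → IsMonic (degL₂ n) (L₂ n)
L₂-monic zero = monic-1
L₂-monic (suc zero) = monic-1
L₂-monic (suc (suc zero)) = monic-linear (ℤ.- + 1)
L₂-monic (suc (suc (suc n))) = monic-1

Q-monic : ∀ n → 1 ℕ.≤ n → IsMonic (degQ n) (Q n)
Q-monic n 1≤n = ⊛-monic (L₁-monic n) (⊛-monic (L₂-monic n)
  (homog-monic (degG n) (coef (G n)) (leading≈1 (Factorization.G-monic (factorization n 1≤n)))))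

X^-monic : ∀ n → IsMonic n (X ^ᵖ n)
X^-monic zero = monic-1
X^-monic (suc n) = ⊛-monic monic-X (X^-monic n)

xⁿ-1-monic : ∀ n → IsMonic (suc n) (xⁿ-1 (suc n))
xⁿ-1-monic n = monic-⊕ (X^-monic (suc n)) λ { (suc k) _ → coef-neg (const (+ 1)) (suc k) }

degQ-sum : ∀ n → Sum.∏∣ (suc n) degQ ≡ suc n
degQ-sum n = degree-unique
    (monic⇒degree (∏-monic (suc n) λ d 1≤d _ → at-divisor-monic (suc n) d λ _ → Q-monic d 1≤d))
  (degree-cong (≋-sym (∏∣-Q n)) (monic⇒degree (xⁿ-1-monic n)))

-- Both functions sum to n over the divisors of n: one by counting residues, the other by comparing
-- degrees in the factorisation of xⁿ - 1.
φ-≡ : ∀ n → 1 ℕ.≤ n → Defs.φ n ≡ degQ n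
φ-≡ n 1≤n = TotientSum.∏∣-determines (λ m → ≡.trans (TotientSum.totient-sum m) (≡.sym (degQ-sum m))) (suc n) n 1≤n
    ℕP.≤-refl

monomial-≋ : ∀ n → Defs.monomial (+ 1) n ≋ X ^ᵖ n
monomial-≋ zero = ≋-refl
monomial-≋ (suc n) = ≋-trans (∷-cong ≡.refl (monomial-≋ n)) (≋-sym (X⊛ (X ^ᵖ n)))

data Entries : ℕ → List (List ℤ) → Set where
  [] : Entries 0 []
  snoc : ∀ {n ps p} → Entries n ps → p ≋ Q (suc n) → Entries (suc n) (ps ++ p ∷ [])

entries-length : ∀ {n ps} → Entries n ps → length ps ≡ n
entries-length [] = ≡.refl
entries-length (snoc {ps = ps} es _) = ≡.trans (ListP.length-++ ps)
    (≡.trans (ℕP.+-comm (length ps) 1) (≡.cong suc (entries-length es)))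

prodDivisors-snoc : ∀ m d ps p → Defs.prodDivisors m d (ps ++ p ∷ []) ≋ Defs.prodDivisors m d ps ⊛ at-divisor m
    (λ _ → p) (d ℕ.+ length ps)
prodDivisors-snoc m d [] p rewrite ℕP.+-identityʳ d with d ∣? m
... | yes _ = ≋-trans (P.reflexive (⊛-≡ p (const (+ 1)))) (⊛-comm p (const (+ 1)))
... | no _ = ≋-sym (⊛-identityˡ (const (+ 1)))
prodDivisors-snoc m d (q ∷ ps) p rewrite ℕP.+-suc d (length ps) with d ∣? m
... | yes _ = ≋-trans (P.reflexive (⊛-≡ q _)) (≋-trans (⊛-congˡ q (prodDivisors-snoc m (suc d) ps p))
    (≋-trans (≋-sym (⊛-assoc q (Defs.prodDivisors m (suc d) ps) (at-divisor m (λ _ → p) (suc d ℕ.+ length ps))))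
        (⊛-cong (P.reflexive (≡.sym (⊛-≡ q (Defs.prodDivisors m (suc d) ps)))) ≋-refl)))
... | no _ = prodDivisors-snoc m (suc d) ps p

prodDivisors-≋ : ∀ m {n ps} → Entries n ps → Defs.prodDivisors m 1 ps ≋ ∏ n (at-divisor m Q)
prodDivisors-≋ m [] = ≋-refl
prodDivisors-≋ m (snoc {n} {ps} {p} es e) = ≋-trans (prodDivisors-snoc m 1 ps p) (≋-trans
  (⊛-cong (prodDivisors-≋ m es)
      (≋-trans (P.reflexive (≡.cong (λ k → at-divisor m (λ _ → p) (suc k)) (entries-length es)))
          (at-divisor-cong m (suc n) λ _ → e)))
  (⊛-comm (∏ n (at-divisor m Q)) (at-divisor m Q (suc n))))

cycloEntry : ∀ n {ps} → Entries n ps → Defs.quotMonic (Defs.monomial (+ 1) (suc n) Defs.⊖ const (+ 1))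
    (Defs.prodDivisors (suc n) 1 ps) ≋ Q (suc n)
cycloEntry n {ps} es = quotMonic-correct
  (IsMonic-cong (≋-sym (prodDivisors-≋ (suc n) es))
      (∏-monic n λ d 1≤d _ → at-divisor-monic (suc n) {degQ} d λ _ → Q-monic d 1≤d))
  (≋-trans (P.reflexive (⊖-≡ (Defs.monomial (+ 1) (suc n)) (const (+ 1))))
      (≋-trans (⊕-cong (monomial-≋ (suc n)) (≋-refl {neg (const (+ 1))}))
    (≋-trans (≋-sym (∏∣-Q n)) (≋-trans (∏∣-last n Q)
        (≋-trans (⊛-comm (Q (suc n)) (∏ n (at-divisor (suc n) Q)))
            (⊛-cong (≋-sym (prodDivisors-≋ (suc n) es)) (≋-refl {Q (suc n)})))))))

cycloTable-entries : ∀ n → Entries n (Defs.cycloTable n)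
cycloTable-entries zero = []
cycloTable-entries (suc n) = snoc (cycloTable-entries n) (cycloEntry n (cycloTable-entries n))

lastP-snoc : ∀ ps p → Defs.lastP (ps ++ p ∷ []) ≡ p
lastP-snoc [] p = ≡.refl
lastP-snoc (q ∷ []) p = ≡.refl
lastP-snoc (q ∷ r ∷ ps) p = lastP-snoc (r ∷ ps) p

Φ-≋ : ∀ n → Defs.Φ (suc n) ≋ Q (suc n)
Φ-≋ n = ≋-trans (P.reflexive (lastP-snoc (Defs.cycloTable n) _)) (cycloEntry n (cycloTable-entries n))

-- Values of the cyclotomic polynomials at 1

module Prod = BigProduct ℕP.*-1-commutativeMonoid

at1 : List ℤ → ℤ
at1 = eval (+ 1)

-- A natural number, as `DivisorProducts` requires; `at1-≡` restores the sign. Using `Q′` removes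
-- the zero of Φ₁ at 1.
valueAt1 : ℕ → ℕ
valueAt1 n = ℤ.∣ at1 (Q′ n) ∣

at1-X^ : ∀ n → at1 (X ^ᵖ n) ≡ + 1
at1-X^ zero = ≡.refl
at1-X^ (suc n) = ≡.trans (eval-⊛ (+ 1) X (X ^ᵖ n)) (≡.trans (ℤP.*-identityˡ _) (at1-X^ n))

at1-D-X^ : ∀ n → at1 (D (X ^ᵖ n)) ≡ + n
at1-D-X^ zero = eval-cong (+ 1) (D-const (+ 1))
at1-D-X^ (suc n) = ≡.trans (eval-cong (+ 1) (D-X⊛ (X ^ᵖ n))) (≡.trans (eval-⊕ (+ 1) (X ^ᵖ n) (X ⊛ D (X ^ᵖ n)))
  (≡.cong₂ ℤ._+_ (at1-X^ n) (≡.trans (eval-⊛ (+ 1) X (D (X ^ᵖ n))) (≡.trans (ℤP.*-identityˡ _) (at1-D-X^ n)))))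

at1-xⁿ-1 : ∀ n → at1 (D (xⁿ-1 n)) ≡ + n
at1-xⁿ-1 n = ≡.trans (eval-cong (+ 1)
    (≋-trans (D-⊕ (X ^ᵖ n) (neg (const (+ 1))))
        (≋-trans (⊕-cong (≋-refl {D (X ^ᵖ n)}) D-neg-1) (⊕-identityʳ (D (X ^ᵖ n))))))
  (at1-D-X^ n)
  where
  D-neg-1 : D (neg (const (+ 1))) ≋ []
  D-neg-1 = ≋-trans (D-scale (ℤ.- + 1) (const (+ 1)))
      (≋-trans (scale-cong {p = D (const (+ 1))} {q = []} ≡.refl (D-const (+ 1)))
          (mk≋ λ k → coef-scale (ℤ.- + 1) [] k))

-- Differentiating (x - 1) ∏ Q′ = xⁿ⁺¹ - 1 at 1 leaves the product on the left and n + 1 on the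
-- right.
at1-∏∣Q′ : ∀ n → at1 (∏∣ (suc n) Q′) ≡ + suc n
at1-∏∣Q′ n = ≡.trans (≡.sym (ℤP.+-identityʳ _))
    (≡.trans (≡.sym (RootProducts.eval-D-linear-⊛ ℤR (+ 1) (+ 1) (∏∣ (suc n) Q′)))
  (≡.trans (eval-cong (+ 1) (D-cong (∏∣-Q′ n))) (at1-xⁿ-1 (suc n))))

abs-at1-∏ : ∀ k f → ℤ.∣ at1 (∏ k f) ∣ ≡ Prod.∏ k (λ d → ℤ.∣ at1 (f d) ∣)
abs-at1-∏ zero f = ≡.refl
abs-at1-∏ (suc k) f = ≡.trans (≡.cong ℤ.∣_∣ (eval-⊛ (+ 1) (f (suc k)) (∏ k f)))
  (≡.trans (ℤP.abs-* (at1 (f (suc k))) _) (≡.cong (ℤ.∣ at1 (f (suc k)) ∣ ℕ.*_) (abs-at1-∏ k f)))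

valueAt1-product : ∀ n → Prod.∏∣ (suc n) valueAt1 ≡ suc n
valueAt1-product n = ≡.trans (Prod.∏-cong (suc n) λ d _ _ → local d)
    (≡.trans (≡.sym (abs-at1-∏ (suc n) (at-divisor (suc n) Q′))) (≡.cong ℤ.∣_∣ (at1-∏∣Q′ n)))
  where
  local : ∀ d → Prod.at-divisor (suc n) valueAt1 d ≡ ℤ.∣ at1 (at-divisor (suc n) Q′ d) ∣
  local d with d ∣? suc n
  ... | yes _ = ≡.refl
  ... | no _ = ≡.refl

NonNegative : ℤ → Set
NonNegative i = i ≡ + ℤ.∣ i ∣

nonNegative-* : ∀ {i j} → NonNegative i → NonNegative j → NonNegative (i ℤ.* j)
nonNegative-* {+ m} {+ n} _ _ = ≡.trans (≡.sym (ℤP.pos-* m n)) (≡.cong +_ (≡.sym (ℤP.abs-* (+ m) (+ n))))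

nonNegative-∏ : ∀ k f → (∀ d → 1 ℕ.≤ d → d ℕ.≤ k → NonNegative (at1 (f d))) → NonNegative (at1 (∏ k f))
nonNegative-∏ zero f h = ≡.refl
nonNegative-∏ (suc k) f h = ≡.subst NonNegative (≡.sym (eval-⊛ (+ 1) (f (suc k)) (∏ k f)))
  (nonNegative-* (h (suc k) (s≤s z≤n) ℕP.≤-refl) (nonNegative-∏ k f λ d 1≤d d≤k → h d 1≤d (ℕP.m≤n⇒m≤1+n d≤k)))

nonNegative-factor : ∀ i j n → NonNegative j → i ℤ.* j ≡ + suc n → NonNegative i
nonNegative-factor (+ m) j n _ _ = ≡.refl
nonNegative-factor -[1+ m ] (+ zero) n _ e with ≡.trans (≡.sym (ℤP.*-zeroʳ -[1+ m ])) e
... | ()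
nonNegative-factor -[1+ m ] (+ suc k) n _ ()

-- Strong induction: the product over all divisors is positive and the cofactor of the last value is
-- nonnegative, hence so is that value.
at1-nonNegative : ∀ N n → 1 ℕ.≤ n → n ℕ.< N → NonNegative (at1 (Q′ n))
at1-nonNegative (suc N) (suc n) _ (s≤s n<N) = nonNegative-factor (at1 (Q′ (suc n))) (at1 R) n
  (nonNegative-∏ n (at-divisor (suc n) Q′) λ d 1≤d d≤n → at-divisor-elim (suc n) Q′ d (λ p → NonNegative (at1 p))
      (λ _ → at1-nonNegative N d 1≤d (ℕP.<-≤-trans (s≤s d≤n) n<N)) ≡.refl)
  (≡.trans (≡.sym (eval-⊛ (+ 1) (Q′ (suc n)) R)) (≡.trans (eval-cong (+ 1) (≋-sym (∏∣-last n Q′))) (at1-∏∣Q′ n)))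
  where
  R = ∏ n (at-divisor (suc n) Q′)

at1-≡ : ∀ n → 1 ℕ.≤ n → at1 (Q′ n) ≡ + valueAt1 n
at1-≡ n 1≤n = at1-nonNegative (suc n) n 1≤n ℕP.≤-refl

valueAt1-prime-power : ∀ p α → Prime p → 1 ℕ.≤ α → valueAt1 (p ℕ.^ α) ≡ p
valueAt1-prime-power p (suc α) pp _ = DivisorProducts.u-prime-power valueAt1 valueAt1-product p α pp

valueAt1-other : ∀ n → 2 ℕ.≤ n → ¬ PrimePower n → valueAt1 n ≡ 1
valueAt1-other n 2≤n npp with primeDivisor n 2≤n
... | p , pp , p∣n with extractPrime p pp n n (ℕP.<⇒≤ 2≤n) ℕP.≤-refl
...   | zero , r , e , p∤r = ⊥-elim (p∤r (≡.subst (p ∣_) (≡.trans e (ℕP.*-identityˡ r)) p∣n))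
...   | suc α , zero , e , p∤r = ⊥-elim (p∤r (p ∣0))
...   | suc α , suc zero , e , p∤r = ⊥-elim (npp (p , suc α , pp , s≤s z≤n , ≡.trans e (ℕP.*-identityʳ _)))
...   | suc α , suc (suc r) , e , p∤r = ≡.trans (≡.cong valueAt1 e)
    (DivisorProducts.u-coprime-product valueAt1 valueAt1-product (p ℕ.^ suc α) (suc (suc r)) 1<p^ (s≤s (s≤s z≤n))
        coprime)
  where
  instance
    p≢0 : ℕ.NonZero p
    p≢0 = prime⇒nonZero pp
  1<p^ : 1 ℕ.< p ℕ.^ suc α
  1<p^ = ℕP.<-≤-trans (ℕ.nonTrivial⇒n>1 p {{prime⇒nonTrivial pp}}) (ℕP.m≤m*n p (p ℕ.^ α) {{ℕP.m^n≢0 p α}})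
  coprime : ∀ d → d ∣ p ℕ.^ suc α → d ∣ suc (suc r) → d ≡ 1
  coprime d d∣p^ d∣r with prime-power-divisor pp (suc α) d d∣p^
  ... | inj₁ d≡1 = d≡1
  ... | inj₂ p∣d = ⊥-elim (p∤r (∣-trans p∣d d∣r))

-- Unique factorisation

AllDivisible : ℕ → List ℤ → Set
AllDivisible p f = ∀ k → + p ∣ℤ coef f k

∣ℤ-zero : ∀ {k} → k ∣ℤ + 0
∣ℤ-zero = dividesℤ (+ 0) ≡.refl

prime-∣-* : ∀ {p} → Prime p → ∀ i j → + p ∣ℤ i ℤ.* j → + p ∣ℤ i ⊎ + p ∣ℤ j
prime-∣-* {p} pp i j h with euclidsLemma ℤ.∣ i ∣ ℤ.∣ j ∣ pp (≡.subst (p ∣_) (ℤP.abs-* i j) (∣⇒∣ᵤ h))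
... | inj₁ h′ = inj₁ (∣ᵤ⇒∣ h′)
... | inj₂ h′ = inj₂ (∣ᵤ⇒∣ h′)

∣ℤ-subtract : ∀ {k x y z} → z ≡ x ℤ.+ y → k ∣ℤ z → k ∣ℤ x → k ∣ℤ y
∣ℤ-subtract {k} {x} {y} e h h′ = ∣m+n∣m⇒∣nℤ (≡.subst (k ∣ℤ_) e h) h′

-- That is, polynomials modulo p have no zero divisors. If p does not divide the constant
-- coefficient of d, it divides those of s from the lowest up; otherwise the constant coefficient of
-- d is dropped.
gauss-prime : ∀ {p} → Prime p → ∀ d s → AllDivisible p (d ⊛ s) → AllDivisible p d ⊎ AllDivisible p s
gauss-prime pp [] s h = inj₁ λ k → ∣ℤ-zero
gauss-prime {p} pp (a ∷ d) s h with + p ∣?ℤ a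
... | no p∤a = inj₂ (right s h)
  where
  right : ∀ s → AllDivisible p ((a ∷ d) ⊛ s) → AllDivisible p s
  right [] h k = ∣ℤ-zero
  right (b ∷ s) h zero with prime-∣-* pp a b (≡.subst (+ p ∣ℤ_) (coef-⊛-zero a d (b ∷ s)) (h 0))
  ... | inj₁ p∣a = ⊥-elim (p∤a p∣a)
  ... | inj₂ p∣b = p∣b
  right (b ∷ s) h (suc k) = right s (λ k → ∣ℤ-subtract
    (≡.trans (at (⊛-∷ (a ∷ d) b s) (suc k)) (coef-⊕ (scale b (a ∷ d)) _ (suc k)))
    (h (suc k)) (≡.subst (+ p ∣ℤ_) (≡.sym (coef-scale b (a ∷ d) (suc k))) (∣m⇒∣m*nℤ _ (right (b ∷ s) h zero)))) k
... | yes p∣a with gauss-prime pp d s (λ k → ∣ℤ-subtract (coef-⊛-suc a d s k) (h (suc k)) (∣m⇒∣m*nℤ _ p∣a))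
...   | inj₁ p∣d = inj₁ λ { zero → p∣a ; (suc k) → p∣d k }
...   | inj₂ p∣s = inj₂ p∣s

divideOut : ∀ {p} f → AllDivisible p f → ∃ λ g → f ≋ const (+ p) ⊛ g
divideOut [] h = [] , ≋-sym (⊛-zeroʳ _)
divideOut {p} (a ∷ f) h with h 0 | divideOut f (λ k → h (suc k))
... | dividesℤ q e | g , e′ = q ∷ g , ≋-trans (mk≋ λ
  { zero → ≡.trans e (≡.trans (ℤP.*-comm q (+ p)) (≡.sym (coef-scale (+ p) (q ∷ g) 0)))
  ; (suc k) → ≡.trans (at e′ k)
      (≡.trans (at (≋-sym (scale-const (+ p) g)) k)
          (≡.trans (coef-scale (+ p) g k) (≡.sym (coef-scale (+ p) (q ∷ g) (suc k))))) })
  (scale-const (+ p) (q ∷ g))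

const-+* : ∀ m n → const (+ (m ℕ.* n)) ≋ const (+ m) ⊛ const (+ n)
const-+* m n = ≋-trans (P.reflexive (≡.cong const (ℤP.pos-* m n))) (const-⊛ (+ m) (+ n))

-- The prime factors of ℓ are removed one at a time, each from d or from s by `gauss-prime`; c
-- collects those taken from d.
gauss : ∀ q fuel ℓ d s → 1 ℕ.≤ ℓ → ℓ ℕ.≤ fuel → const (+ ℓ) ⊛ q ≋ d ⊛ s →
  ∃ λ c → ∃ λ d′ → ∃ λ s′ → c ≢ + 0 × d ≋ const c ⊛ d′ × q ≋ d′ ⊛ s′
gauss q (suc fuel) (suc zero) d s _ _ e = + 1 , d , s , (λ ()) , ≋-sym (⊛-identityˡ d) , ≋-trans
    (≋-sym (⊛-identityˡ q)) e
gauss q (suc fuel) ℓ@(suc (suc _)) d s _ ℓ≤ e with primeDivisor ℓ (s≤s (s≤s z≤n))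
... | p , pp , divides m ℓ≡ = descend (gauss-prime pp d s λ k → ≡.subst (+ p ∣ℤ_) (at (≋-trans (≋-sym ℓq≋) e) k)
      (≡.subst (+ p ∣ℤ_) (≡.trans (≡.sym (coef-scale (+ p) (const (+ m) ⊛ q) k))
          (at (scale-const (+ p) (const (+ m) ⊛ q)) k)) (∣m⇒∣m*nℤ _ ∣-reflℤ)))
  where
  1<p : 1 ℕ.< p
  1<p = ℕ.nonTrivial⇒n>1 p {{prime⇒nonTrivial pp}}
  1≤m : 1 ℕ.≤ m
  1≤m = divisor-positive {m} {ℓ} (s≤s z≤n) (divides p (≡.trans ℓ≡ (ℕP.*-comm m p)))
  m≤fuel : m ℕ.≤ fuel
  m≤fuel = ℕ.s≤s⁻¹ (ℕP.≤-trans (≡.subst (m ℕ.<_) (≡.sym ℓ≡) (ℕP.m<m*n m p {{ℕ.>-nonZero 1≤m}} 1<p)) ℓ≤)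
  p≢0 : + p ≢ + 0
  p≢0 z = ℕP.<⇒≢ (ℕP.<-trans (s≤s z≤n) 1<p) (≡.sym (ℤP.+-injective z))
  ℓq≋ : const (+ ℓ) ⊛ q ≋ const (+ p) ⊛ (const (+ m) ⊛ q)
  ℓq≋ = ≋-trans (⊛-cong (≋-trans (P.reflexive (≡.cong (λ n → const (+ n)) (≡.trans ℓ≡ (ℕP.*-comm m p))))
      (const-+* p m)) (≋-refl {q})) (⊛-assoc (const (+ p)) (const (+ m)) q)
  cancel-p : ∀ {r} → d ⊛ s ≋ const (+ p) ⊛ r → const (+ m) ⊛ q ≋ r
  cancel-p ds≋ = ⊛-cancelˡ (const (+ p)) (λ z → p≢0 (at z 0)) (≋-trans (≋-sym ℓq≋) (≋-trans e ds≋))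
  descend : AllDivisible p d ⊎ AllDivisible p s → ∃ λ c → ∃ λ d′ → ∃ λ s′ → c ≢ + 0 × d ≋ const c ⊛ d′ × q ≋ d′ ⊛ s′
  descend (inj₂ p∣s) with divideOut s p∣s
  ... | s₁ , s≋ = gauss q fuel m d s₁ 1≤m m≤fuel
      (cancel-p (≋-trans (⊛-congˡ d s≋)
          (solve 3 (λ d p s → d :* (p :* s) := p :* (d :* s)) ≋-refl d (const (+ p)) s₁)))
  descend (inj₁ p∣d) with divideOut d p∣d
  ... | d₁ , d≋ = rescale (gauss q fuel m d₁ s 1≤m m≤fuel
      (cancel-p (≋-trans (⊛-cong d≋ (≋-refl {s})) (⊛-assoc (const (+ p)) d₁ s))))
    where
    rescale : (∃ λ c → ∃ λ d′ → ∃ λ s′ → c ≢ + 0 × d₁ ≋ const c ⊛ d′ × q ≋ d′ ⊛ s′) →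
      ∃ λ c → ∃ λ d′ → ∃ λ s′ → c ≢ + 0 × d ≋ const c ⊛ d′ × q ≋ d′ ⊛ s′
    rescale (c , d′ , s′ , c≢0 , d₁≋ , q≋) = + p ℤ.* c , d′ , s′ ,
        (λ z → [ p≢0 , c≢0 ]′ (ℤP.i*j≡0⇒i≡0∨j≡0 (+ p) z)) ,
      ≋-trans d≋ (≋-trans (⊛-congˡ (const (+ p)) d₁≋)
          (≋-trans (≋-sym (⊛-assoc (const (+ p)) (const c) d′)) (⊛-cong (≋-sym (const-⊛ (+ p) c)) (≋-refl {d′}))))
              , q≋

IsUnit-degree : ∀ {u} → Defs.IsUnit u → HasDegree 0 u
IsUnit-degree {u} (inj₁ e) = degree-cong (≋-sym (≈⇒≋ {u} {const (+ 1)} e)) (const-degree {+ 1} λ ())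
IsUnit-degree {u} (inj₂ e) = degree-cong (≋-sym (≈⇒≋ {u} {const (ℤ.- + 1)} e)) (const-degree {ℤ.- + 1} λ ())

bounded-below⇒small : ∀ {n r} → BoundedBelow n r → r ≋ [] ⊎ ∃ λ m → m ℕ.< n × HasDegree m r
bounded-below⇒small {n} {r} b with zero-or-degree r
... | inj₁ z = inj₁ z
... | inj₂ (m , d) = inj₂ (m , ℕP.≰⇒> (λ n≤m → leading≢0 d (b m n≤m)) , d)

degree-0 : ∀ {p} → HasDegree 0 p → p ≋ const (coef p 0)
degree-0 d = mk≋ λ { zero → ≡.refl ; (suc k) → bounded d (suc k) z<s }

module _ {q n} (monic : IsMonic n q) (irreducible : Defs.Irreducible q) where

  factor-unit : ∀ {a b} → q ≋ a ⊛ b → Defs.IsUnit a ⊎ Defs.IsUnit b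
  factor-unit {a} {b} e = proj₂ (proj₂ irreducible) a b (≋⇒≈ (≋-trans e (P.reflexive (≡.sym (⊛-≡ a b)))))

  irreducible-degree : 1 ℕ.≤ n
  irreducible-degree = positive n monic
    where
    positive : ∀ n → IsMonic n q → 1 ℕ.≤ n
    positive zero m = ⊥-elim (proj₁ (proj₂ irreducible)
        (inj₁ (≋⇒≈ (≋-trans (degree-0 (monic⇒degree m)) (P.reflexive (≡.cong const (leading≈1 m)))))))
    positive (suc n) m = s≤s z≤n

  -- By `gauss` a factorisation of a multiple ℓ q descends to one of q with factors of the same
  -- degrees; as 0 < deg d < n, neither of these is a unit.
  no-small-divisor : ∀ {d e ℓ s} → HasDegree (suc e) d → suc e ℕ.< n → ℓ ≢ + 0 → ¬ const ℓ ⊛ q ≋ d ⊛ s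
  no-small-divisor {d} {e} {ℓ} {s} deg e<n ℓ≢0 eq = split ℓ ℓ≢0 eq
    where
    contradiction : ∀ {d d′ c s′} → HasDegree (suc e) d → c ≢ + 0 → d ≋ const c ⊛ d′ → q ≋ d′ ⊛ s′ → ⊥
    contradiction {d} {d′} {c} {s′} deg c≢0 d≋ q≋ with zero-or-degree d′ | zero-or-degree s′ | factor-unit q≋
    ... | inj₁ z | _ | _ = monic≢0 monic (≋-trans q≋ (≋-trans (⊛-cong z (≋-refl {s′})) ([]-⊛ s′)))
    ... | inj₂ _ | inj₁ z | _ = monic≢0 monic (≋-trans q≋ (≋-trans (⊛-congˡ d′ z) (⊛-zeroʳ d′)))
    ... | inj₂ (i , di) | inj₂ (j , dj) | u = units u
      where
      suc-e≡i : suc e ≡ i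
      suc-e≡i = degree-unique (degree-cong d≋ deg) (degree-⊛ (const-degree c≢0) di)
      n≡i+j : n ≡ i ℕ.+ j
      n≡i+j = degree-unique (degree-cong q≋ (monic⇒degree monic)) (degree-⊛ di dj)
      units : Defs.IsUnit d′ ⊎ Defs.IsUnit s′ → ⊥
      units (inj₁ u) with ≡.trans suc-e≡i (degree-unique di (IsUnit-degree u))
      ... | ()
      units (inj₂ u) = ℕP.<⇒≢ e<n
          (≡.trans suc-e≡i (≡.sym (≡.trans n≡i+j
              (≡.trans (≡.cong (i ℕ.+_) (degree-unique dj (IsUnit-degree u))) (ℕP.+-identityʳ i)))))
    conclude : (∃ λ c → ∃ λ d′ → ∃ λ s′ → c ≢ + 0 × d ≋ const c ⊛ d′ × q ≋ d′ ⊛ s′) → ⊥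
    conclude (c , d′ , s′ , c≢0 , d≋ , q≋) = contradiction deg c≢0 d≋ q≋
    neg-const : ∀ i → neg (const i) ≋ const (ℤ.- i)
    neg-const i = mk≋ λ { zero → coef-neg (const i) 0 ; (suc k) → coef-neg (const i) (suc k) }
    split : ∀ ℓ → ℓ ≢ + 0 → const ℓ ⊛ q ≋ d ⊛ s → ⊥
    split (+ zero) h _ = h ≡.refl
    split (+ suc ℓ) _ eq = conclude (gauss q (suc ℓ) (suc ℓ) d s (s≤s z≤n) ℕP.≤-refl eq)
    split -[1+ ℓ ] _ eq = conclude (gauss q (suc ℓ) (suc ℓ) d (neg s) (s≤s z≤n) ℕP.≤-refl
      (≋-trans (⊛-cong (≋-sym (neg-const -[1+ ℓ ])) (≋-refl {q}))
        (≋-trans (solve 2 (λ l q → :- l :* q := :- (l :* q)) ≋-refl (const -[1+ ℓ ]) q)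
          (≋-trans (scale-cong ≡.refl eq) (solve 2 (λ d s → :- (d :* s) := d :* :- s) ≋-refl d s)))))

  -- A Euclidean descent: pseudo-division of q by d leaves a remainder r of smaller degree with q
  -- dividing r b, nonzero by `no-small-divisor`. It ends at a nonzero constant, which the monic q
  -- ignores.
  ∣-small-multiple : ∀ fuel e d b → e ℕ.< fuel → e ℕ.< n → HasDegree e d → q ∣ᵖ d ⊛ b → q ∣ᵖ b
  ∣-small-multiple (suc fuel) zero d b _ _ deg h = monic-∣-scalar monic (coef d 0) b (leading≢0 deg)
    (∣ᵖ-cong ≋-refl (⊛-cong (degree-0 deg) (≋-refl {b})) h)
  ∣-small-multiple (suc fuel) (suc e) d b (s≤s e<fuel) e<n deg h with bounded-below⇒small (remainder-bounded)
    where open PseudoDivision (pseudoDivide (suc e) d deg q)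
  ... | inj₁ z = ⊥-elim (no-small-divisor deg e<n scalar≢0
      (≋-trans division (≋-trans (⊕-cong (≋-refl {d ⊛ quotient}) z) (⊕-identityʳ _))))
    where open PseudoDivision (pseudoDivide (suc e) d deg q)
  ... | inj₂ (e′ , e′<e , deg′) = ∣-small-multiple fuel e′ remainder b (ℕP.<-≤-trans e′<e e<fuel)
      (ℕP.<-trans e′<e e<n) deg′
      (∣ᵖ-cong ≋-refl (≋-trans (⊕-cong (⊛-cong division (≋-refl {b})) (≋-refl {neg (quotient ⊛ (d ⊛ b))}))
          (solve 4 (λ d s r b → (d :* s :+ r) :* b :- s :* (d :* b) := r :* b) ≋-refl d quotient remainder b))
        (∣ᵖ-⊕ (∣ᵖ-cong ≋-refl (solve 3 (λ l q b → (l :* b) :* q := (l :* q) :* b) ≋-refl (const scalar) q b)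
            (∣ᵖ-⊛ (const scalar ⊛ b) ∣ᵖ-refl))
          (∣ᵖ-cong ≋-refl (solve 1 (λ x → :- con (+ 1) :* x := :- x) ≋-refl (quotient ⊛ (d ⊛ b)))
              (∣ᵖ-⊛ (neg (const (+ 1))) (∣ᵖ-⊛ quotient h)))))
    where open PseudoDivision (pseudoDivide (suc e) d deg q)

  irreducible⇒prime : ∀ a b → q ∣ᵖ a ⊛ b → q ∣ᵖ a ⊎ q ∣ᵖ b
  irreducible⇒prime a b h with bounded-below⇒small remainder-bounded
    where open MonicDivision (monicDivide monic a)
  ... | inj₁ z = inj₁ (quotient , ≋-sym
      (≋-trans division (≋-trans (⊕-cong (≋-refl {q ⊛ quotient}) z) (⊕-identityʳ _))))
    where open MonicDivision (monicDivide monic a)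
  ... | inj₂ (e , e<n , deg) = inj₂ (∣-small-multiple (suc e) e remainder b ℕP.≤-refl e<n deg
      (∣-remainder {q = quotient ⊛ b} h (≋-trans (⊛-cong division (≋-refl {b}))
        (solve 4 (λ g s r b → (g :* s :+ r) :* b := g :* (s :* b) :+ r :* b) ≋-refl q quotient remainder b))))
    where open MonicDivision (monicDivide monic a)

  ∤-constant : ∀ c → c ≢ + 0 → ¬ q ∣ᵖ const c
  ∤-constant c c≢0 (s , e) with zero-or-degree s
  ... | inj₁ z = degree≢0 (const-degree c≢0) (≋-trans (≋-sym e) (≋-trans (⊛-congˡ q z) (⊛-zeroʳ q)))
  ... | inj₂ (k , d) = ℕP.<⇒≱ irreducible-degree
      (ℕP.≤-trans (ℕP.m≤m+n n k)
          (ℕP.≤-reflexive (degree-unique (degree-cong e (degree-⊛ (monic⇒degree monic) d)) (const-degree c≢0))))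

abs≡1 : ∀ i j → i ℤ.* j ≡ + 1 → i ≡ + 1 ⊎ i ≡ ℤ.- + 1
abs≡1 i j e with i | ℕP.m*n≡1⇒m≡1 ℤ.∣ i ∣ ℤ.∣ j ∣ (≡.trans (≡.sym (ℤP.abs-* i j)) (≡.cong ℤ.∣_∣ e))
... | + .1 | ≡.refl = inj₁ ≡.refl
... | -[1+ .0 ] | ≡.refl = inj₂ ≡.refl

-- A factor of a monic polynomial may have leading coefficient - 1; multiplying by `sign` makes it
-- monic.
record MonicFactor (n : ℕ) (a b : List ℤ) : Set where
  field
    {dega degb} : ℕ
    degrees : n ≡ dega ℕ.+ degb
    sign : ℤ
    sign² : sign ℤ.* sign ≡ + 1
    leading : coef a dega ≡ sign
    degreea : HasDegree dega a
    degreeb : HasDegree degb b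

  normalised-monic : IsMonic dega (const sign ⊛ a)
  normalised-monic = IsMonic-cong (scale-const sign a)
    (≡.trans (coef-scale sign a dega) (≡.trans (≡.cong (sign ℤ.*_) leading) sign²) ,
     λ k h → ≡.trans (coef-scale sign a k) (≡.trans (≡.cong (sign ℤ.*_) (bounded degreea k h)) (ℤP.*-zeroʳ sign)))

  normalised-∣ : const sign ⊛ a ∣ᵖ a
  normalised-∣ = const sign , ≋-trans (solve 2 (λ s a → s :* a :* s := s :* s :* a) ≋-refl (const sign) a)
    (≋-trans (⊛-cong (≋-trans (≋-sym (const-⊛ sign sign)) (P.reflexive (≡.cong const sign²))) (≋-refl {a}))
        (⊛-identityˡ a))

  degree-0⇒unit : dega ≡ 0 → Defs.IsUnit a
  degree-0⇒unit e = units sign sign² (≋-trans (degree-0 (≡.subst (λ k → HasDegree k a) e degreea))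
    (P.reflexive (≡.cong const (≡.trans (≡.cong (coef a) (≡.sym e)) leading))))
    where
    units : ∀ i → i ℤ.* i ≡ + 1 → a ≋ const i → Defs.IsUnit a
    units (+ suc zero) _ l = inj₁ (≋⇒≈ l)
    units -[1+ zero ] _ l = inj₂ (≋⇒≈ l)
    units (+ zero) ()
    units (+ suc (suc _)) ()
    units -[1+ suc _ ] ()

monicFactor : ∀ {n A a b} → IsMonic n A → A ≋ a ⊛ b → MonicFactor n a b
monicFactor {n} {A} {a} {b} m e with zero-or-degree a | zero-or-degree b
... | inj₁ z | _ = ⊥-elim (monic≢0 m (≋-trans e (≋-trans (⊛-cong z (≋-refl {b})) ([]-⊛ b))))
... | inj₂ _ | inj₁ z = ⊥-elim (monic≢0 m (≋-trans e (≋-trans (⊛-congˡ a z) (⊛-zeroʳ a))))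
... | inj₂ (i , di) | inj₂ (j , dj) = record
  { degrees = n≡ ; sign = coef a i ; sign² = square (abs≡1 (coef a i) (coef b j) product≡1) ; leading = ≡.refl ;
      degreea = di ; degreeb = dj }
  where
  n≡ : n ≡ i ℕ.+ j
  n≡ = degree-unique (degree-cong e (monic⇒degree m)) (degree-⊛ di dj)
  product≡1 : coef a i ℤ.* coef b j ≡ + 1
  product≡1 = ≡.trans (≡.sym (proj₁ (⊛-top i j a b (bounded di) (bounded dj))))
      (≡.trans (≡.sym (at e (i ℕ.+ j))) (≡.trans (≡.cong (coef A) (≡.sym n≡)) (leading≈1 m)))
  square : ∀ {x} → x ≡ + 1 ⊎ x ≡ ℤ.- + 1 → x ℤ.* x ≡ + 1
  square (inj₁ ≡.refl) = ≡.refl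
  square (inj₂ ≡.refl) = ≡.refl

MonicIrreducible : List ℤ → Set
MonicIrreducible q = Defs.Monic q × Defs.Irreducible q

-- Irreducibility is not decided here. Assuming that there is no irreducible factor, A itself is
-- irreducible, since a proper factor of it would be excluded by induction; hence the double
-- negation.
irreducibleFactor : ∀ fuel n A → IsMonic n A → 1 ℕ.≤ n → n ℕ.< fuel → ¬ ¬ ∃ λ q → MonicIrreducible q × q ∣ᵖ A
irreducibleFactor (suc fuel) n A m 1≤n (s≤s n≤fuel) none = none
    (A , (monic⇒Monic m , (λ z → monic≢0 m (≈⇒≋ z)) , nonunit , factors) , ∣ᵖ-refl)
  where
  nonunit : ¬ Defs.IsUnit A
  nonunit u = ℕP.<⇒≢ 1≤n (≡.sym (degree-unique (monic⇒degree m) (IsUnit-degree u)))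
  factors : ∀ a b → A Defs.≈ a Defs.⊛ b → Defs.IsUnit a ⊎ Defs.IsUnit b
  factors a b e = decide (dega ℕ.≟ 0) (degb ℕ.≟ 0)
    where
    A≋ : A ≋ a ⊛ b
    A≋ = ≋-trans (≈⇒≋ e) (P.reflexive (⊛-≡ a b))
    left : MonicFactor n a b
    left = monicFactor m A≋
    open MonicFactor left
    right : MonicFactor n b a
    right = monicFactor m (≋-trans A≋ (⊛-comm a b))
    decide : Dec (dega ≡ 0) → Dec (degb ≡ 0) → Defs.IsUnit a ⊎ Defs.IsUnit b
    decide (yes z) _ = inj₁ (degree-0⇒unit z)
    decide (no _) (yes z) = inj₂
        (MonicFactor.degree-0⇒unit right (≡.trans (degree-unique (MonicFactor.degreea right) degreeb) z))
    decide (no i≢0) (no j≢0) = ⊥-elim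
        (irreducibleFactor fuel dega (const sign ⊛ a) normalised-monic (ℕP.n≢0⇒n>0 i≢0)
      (ℕP.<-≤-trans (≡.subst (dega ℕ.<_) (≡.sym degrees) (ℕP.m<m+n dega (ℕP.n≢0⇒n>0 j≢0))) n≤fuel)
      λ (q , irr , q∣) → none (q , irr , ∣ᵖ-trans q∣ (∣ᵖ-trans normalised-∣ (b , ≋-sym A≋))))

Squarefree : List ℤ → Set
Squarefree A = ∀ q → Defs.Irreducible q → ¬ q ⊛ q ∣ᵖ A

-- An irreducible q is split off A and B, leaving A′ and B′. An irreducible r dividing A′ divides B
-- = q B′ and cannot divide q because A is squarefree, so it divides B′.
squarefree-∣ : ∀ fuel n A B → IsMonic n A → n ℕ.< fuel → Squarefree A →
  (∀ q → MonicIrreducible q → q ∣ᵖ A → q ∣ᵖ B) → ¬ ¬ (A ∣ᵖ B)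
squarefree-∣ (suc fuel) zero A B m _ sf h none = none
    (B , ≋-trans (⊛-cong (≋-trans (degree-0 (monic⇒degree m)) (P.reflexive (≡.cong const (leading≈1 m))))
        (≋-refl {B})) (⊛-identityˡ B))
squarefree-∣ (suc fuel) n@(suc _) A B m (s≤s n≤fuel) sf h none = irreducibleFactor (suc n) n A m (s≤s z≤n) ℕP.≤-refl
  λ (q , (qm , qi) , A′ , e) → step q qm qi A′ e (h q (qm , qi) (A′ , e))
  where
  step : ∀ q → Defs.Monic q → Defs.Irreducible q → ∀ A′ → q ⊛ A′ ≋ A → q ∣ᵖ B → ⊥
  step q qm qi A′ e (B′ , e′) = squarefree-∣ fuel k A′ B′ monic′ (ℕP.<-≤-trans k<n n≤fuel) sf′ h′
    λ (c , e″) → none (c , ≋-trans (⊛-cong (≋-sym e) (≋-refl {c}))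
        (≋-trans (⊛-assoc q A′ c) (≋-trans (⊛-congˡ q e″) e′)))
    where
    q-monic : IsMonic (Defs.deg q) q
    q-monic = monic-deg q qm
    quotient : ∃ λ k → n ≡ Defs.deg q ℕ.+ k × IsMonic k A′
    quotient = monic-quotient m q-monic (≋-sym e)
    k : ℕ
    k = proj₁ quotient
    monic′ : IsMonic k A′
    monic′ = proj₂ (proj₂ quotient)
    k<n : k ℕ.< n
    k<n = ≡.subst (k ℕ.<_) (≡.sym (≡.trans (proj₁ (proj₂ quotient)) (ℕP.+-comm (Defs.deg q) k)))
        (ℕP.m<m+n k (irreducible-degree q-monic qi))
    A′∣A : A′ ∣ᵖ A
    A′∣A = q , ≋-trans (⊛-comm A′ q) e
    sf′ : Squarefree A′
    sf′ r ri r²∣ = sf r ri (∣ᵖ-trans r²∣ A′∣A)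
    h′ : ∀ r → MonicIrreducible r → r ∣ᵖ A′ → r ∣ᵖ B′
    h′ r (rm , ri) r∣A′ with irreducible⇒prime (monic-deg r rm) ri q B′
        (∣ᵖ-cong ≋-refl (≋-sym e′) (h r (rm , ri) (∣ᵖ-trans r∣A′ A′∣A)))
    ... | inj₂ r∣B′ = r∣B′
    ... | inj₁ (c , rc≋q) with factor-unit q-monic qi (≋-sym rc≋q)
    ...   | inj₁ ru = ⊥-elim (proj₁ (proj₂ ri) ru)
    -- Here r divides both q and A′, so r² divides q A′ = A.
    ...   | inj₂ cu = ⊥-elim (sf r ri
        (∣ᵖ-trans (r²∣rA′ r∣A′) (∣ᵖ-cong ≋-refl (≋-trans (⊛-cong rc≋q (≋-refl {A′})) e) (rA′∣rcA′))))
      where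
      r²∣rA′ : r ∣ᵖ A′ → r ⊛ r ∣ᵖ r ⊛ A′
      r²∣rA′ (t , f) = t , ≋-trans (⊛-assoc r r t) (⊛-congˡ r f)
      rA′∣rcA′ : r ⊛ A′ ∣ᵖ r ⊛ c ⊛ A′
      rA′∣rcA′ = c , solve 3 (λ r a c → r :* a :* c := r :* c :* a) ≋-refl r A′ c

monic-∣-antisym : ∀ {m n A B} → IsMonic m A → IsMonic n B → A ∣ᵖ B → B ∣ᵖ A → A ≋ B
monic-∣-antisym {m} {n} {A} {B} ma mb (c , e) (d , f) with monic-quotient mb ma (≋-sym e) | monic-quotient ma mb
    (≋-sym f)
... | k , n≡m+k , mc | l , m≡n+l , _ = ≋-trans (≋-sym (≋-trans (⊛-congˡ A c≋1) (P.*-identityʳ A))) e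
  where
  k≡0 : k ≡ 0
  k≡0 = ℕP.m+n≡0⇒m≡0 k (ℕP.+-cancelˡ-≡ m (k ℕ.+ l) 0
      (≡.trans (≡.sym (ℕP.+-assoc m k l))
          (≡.trans (≡.cong (ℕ._+ l) (≡.sym n≡m+k)) (≡.trans (≡.sym m≡n+l) (≡.sym (ℕP.+-identityʳ m))))))
  c≋1 : c ≋ const (+ 1)
  c≋1 = ≋-trans (degree-0 (≡.subst (λ j → HasDegree j c) k≡0 (monic⇒degree mc)))
      (P.reflexive (≡.cong const (≡.subst (λ j → coef c j ≡ + 1) k≡0 (leading≈1 mc))))

-- The double negations disappear here, because equality of integer coefficients is decidable and
-- therefore stable.
squarefree-unique : ∀ {m n A B} → IsMonic m A → IsMonic n B → Squarefree A → Squarefree B →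
  (∀ q → MonicIrreducible q → q ∣ᵖ A → q ∣ᵖ B) → (∀ q → MonicIrreducible q → q ∣ᵖ B → q ∣ᵖ A) → A ≋ B
squarefree-unique {m} {n} {A} {B} ma mb sa sb h h′ = mk≋ λ k → decidable-stable (coef A k ℤP.≟ coef B k) λ ¬e →
  squarefree-∣ (suc m) m A B ma ℕP.≤-refl sa h λ A∣B → squarefree-∣ (suc n) n B A mb ℕP.≤-refl sb h′ λ B∣A →
    ¬e (at (monic-∣-antisym ma mb A∣B B∣A) k)

-- Identification of the fibotomic polynomial

open RootProducts ℤR using (derivativeResultant-cong; derivativeResultant-roots; derivativeProduct-∷)

-- Being prime, q divides some `Psi d` with d a divisor of N; for d < N it would already divide
-- `F d`.
newFactor⇒∣Psi : ∀ n q → MonicIrreducible q → Defs.NewFactor (suc n) q → q ∣ᵖ Psi (suc n)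
newFactor⇒∣Psi n q (qm , qi) (q∣F , q∤F) = search (suc n) ℕP.≤-refl (∣ᵖ-cong ≋-refl Fn q∣Fn)
  where
  N = suc n
  q-monic = monic-deg q qm
  Fn : F N ≋ ∏∣ N Psi
  Fn = F-factorization N (s≤s z≤n) (factorization N (s≤s z≤n))
  q∣Fn : q ∣ᵖ F N
  q∣Fn = ≡.subst (q ∣ᵖ_) (Fib-≡ N) (∣ₚ⇒∣ᵖ q∣F)
  q∤1 : ¬ q ∣ᵖ const (+ 1)
  q∤1 = ∤-constant q-monic qi (+ 1) λ ()
  search : ∀ k → k ℕ.≤ N → q ∣ᵖ ∏ k (at-divisor N Psi) → q ∣ᵖ Psi N
  search zero _ h = ⊥-elim (q∤1 h)
  search (suc k) k≤n h with irreducible⇒prime q-monic qi (at-divisor N Psi (suc k)) (∏ k (at-divisor N Psi)) h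
  ... | inj₂ h′ = search k (ℕP.<⇒≤ k≤n) h′
  ... | inj₁ h′ with suc k ∣? N
  ...   | no _ = ⊥-elim (q∤1 h′)
  ...   | yes _ with ℕP.m≤n⇒m<n∨m≡n k≤n
  ...     | inj₂ ≡.refl = h′
  ...     | inj₁ k<n = ⊥-elim (q∤F (suc k) (s≤s z≤n) k<n (∣ᵖ⇒∣ₚ (≡.subst (q ∣ᵖ_) (≡.sym (Fib-≡ (suc k)))
              (∣ᵖ-trans h′ (Psi-∣-F (suc k) (s≤s z≤n)
                  (F-factorization (suc k) (s≤s z≤n) (factorization (suc k) (s≤s z≤n))))))))

Psi-∣-F′ : ∀ n → Psi (suc n) ∣ᵖ F (suc n)
Psi-∣-F′ n = Psi-∣-F (suc n) (s≤s z≤n) (F-factorization (suc n) (s≤s z≤n) (factorization (suc n) (s≤s z≤n)))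

-- If q divided an earlier `F k`, it would divide `F g` for a common divisor g < N. By
-- `∋-new-factor` it would then divide 2N, impossible for a nonconstant monic polynomial.
∣Psi⇒newFactor : ∀ n q → MonicIrreducible q → q ∣ᵖ Psi (suc n) → Defs.NewFactor (suc n) q
∣Psi⇒newFactor n q (qm , qi) h = ∣ᵖ⇒∣ₚ (≡.subst (q ∣ᵖ_) (≡.sym (Fib-≡ N)) q∣Fn) , old
  where
  N = suc n
  q∣Fn : q ∣ᵖ F N
  q∣Fn = ∣ᵖ-trans h (Psi-∣-F′ n)
  common : ∀ k → (∃ λ g → g ∣ N × g ∣ suc k × q ∣ᵖ F g) → suc k ℕ.< N → ⊥
  common k (g , g∣n , g∣k , q∣Fg) k<n = ∤-constant (monic-deg q qm) qi (+ (2 ℕ.* N)) (λ ())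
    (∋-new-factor (multiples q) N g (s≤s z≤n) (F-factorization N (s≤s z≤n) (factorization N (s≤s z≤n))) g∣n
        (ℕP.≤-<-trans (∣⇒≤ g∣k) k<n)
      (F-factorization g 1≤g (factorization g 1≤g)) q∣Fg h)
    where
    1≤g : 1 ℕ.≤ g
    1≤g = divisor-positive (s≤s z≤n) g∣n
  old : ∀ k → 1 ℕ.≤ k → k ℕ.< N → ¬ q Defs.∣ₚ Defs.Fib k
  old (suc k) _ k<n q∣Fk = common k
    (∋-F-gcd (multiples q) (N ℕ.+ suc k) N (suc k) ℕP.≤-refl q∣Fn (≡.subst (q ∣ᵖ_) (Fib-≡ (suc k)) (∣ₚ⇒∣ᵖ q∣Fk)))
        k<n

-- If r² divides F N, then r divides the derivative too, hence 2N, and so is constant. Integer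
-- primes are among the irreducible r; they are excluded because a factor of a monic polynomial has
-- leading coefficient ± 1.
Psi-squarefree : ∀ n → Squarefree (Psi (suc n))
Psi-squarefree n r ri (c , e) = impossible (dega ℕ.≟ 0)
  where
  N = suc n
  monic-Psi = Factorization.Psi-monic (factorization N (s≤s z≤n))
  open MonicFactor (monicFactor monic-Psi (≋-sym (≋-trans (≋-sym (⊛-assoc r r c)) e)))
  r²∣F : r ⊛ r ∣ᵖ F N
  r²∣F = ∣ᵖ-trans (c , e) (Psi-∣-F′ n)
  r∣2n : r ∣ᵖ const (+ (2 ℕ.* N))
  r∣2n = ∋-discriminant (multiples r) N (∣ᵖ-trans (∣ᵖ-⊛ˡ r r) r²∣F)
    (∣ᵖ-cong ≋-refl (D-cong (proj₂ r²∣F))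
        (∣ᵖ-cong ≋-refl (≋-sym (≋-trans (D-⊛ (r ⊛ r) d)
            (⊕-cong (⊛-cong (D-⊛ r r) (≋-refl {d})) (≋-refl {r ⊛ r ⊛ D d}))))
      (D r ⊛ d ⊕ D r ⊛ d ⊕ r ⊛ D d , solve 4
          (λ r r′ d d′ → r :* (r′ :* d :+ r′ :* d :+ r :* d′) := (r′ :* r :+ r :* r′) :* d :+ r :* r :* d′) ≋-refl
              r (D r) d (D d))))
    where
    d = proj₁ r²∣F
  nonconstant : dega ≢ 0 → const sign ⊛ r ∣ᵖ const (+ (2 ℕ.* N)) → ⊥
  nonconstant i≢0 (s , f) = [
      (λ z → degree≢0 2n-degree (≋-trans (≋-sym f)
          (≋-trans (⊛-congˡ (const sign ⊛ r) z) (⊛-zeroʳ (const sign ⊛ r))))) ,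
      (λ (k , dk) → i≢0 (ℕP.m+n≡0⇒m≡0 dega
          (degree-unique (degree-cong f (degree-⊛ (monic⇒degree normalised-monic) dk)) 2n-degree)))
    ]′ (zero-or-degree s)
    where
    2n-degree : HasDegree 0 (const (+ (2 ℕ.* N)))
    2n-degree = const-degree {+ (2 ℕ.* N)} λ ()
  impossible : Dec (dega ≡ 0) → ⊥
  impossible (yes z) = proj₁ (proj₂ ri) (degree-0⇒unit z)
  impossible (no i≢0) = nonconstant i≢0 (∣ᵖ-trans normalised-∣ r∣2n)

-- `IsFibotomic` determines a monic polynomial through its irreducible divisors and squarefreeness,
-- which is the form of `squarefree-unique`.
fibotomic-≋ : ∀ n Ψ → Defs.IsFibotomic (suc n) Ψ → Ψ ≋ Psi (suc n)
fibotomic-≋ n Ψ (monic , factors , sf) = squarefree-unique (monic-deg Ψ monic)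
    (Factorization.Psi-monic (factorization (suc n) (s≤s z≤n)))
  (λ q qi h → sf q qi (∣ᵖ⇒∣ₚ (∣ᵖ-cong (P.reflexive (≡.sym (⊛-≡ q q))) ≋-refl h)))
  (Psi-squarefree n)
  (λ q qq@(qm , qi) h → newFactor⇒∣Psi n q qq (proj₁ (factors q qm qi) (∣ᵖ⇒∣ₚ h)))
  (λ q qq@(qm , qi) h → ∣ₚ⇒∣ᵖ (proj₂ (factors q qm qi) (∣Psi⇒newFactor n q qq h)))

-- Comparison of the discriminants

φ-positive : ∀ n → 1 ℕ.≤ Defs.φ (suc n)
φ-positive n = count n
  where
  count : ∀ k → 1 ℕ.≤ Defs.countCoprime (suc n) (suc k)
  count k with gcd (suc k) (suc n) ℕ.≟ 1
  ... | yes _ = s≤s z≤n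
  count zero | no h = ⊥-elim (h (∣1⇒≡1 (gcd[m,n]∣m 1 (suc n))))
  count (suc k) | no _ = count k

resultant-linear : ∀ p → IsMonic 1 p → derivativeResultant 1 p ≡ + 1
resultant-linear p (t , b) = ≡.trans (derivativeResultant-cong 1 p≋)
    (≡.trans (derivativeResultant-roots 1 (a ∷ []) ≡.refl) (derivativeProduct-∷ a []))
  where
  a = ℤ.- coef p 0
  p≋ : p ≋ rootProduct ℤR (a ∷ [])
  p≋ = ≋-trans (mk≋ λ { zero → ≡.sym (ℤP.neg-involutive (coef p 0)) ; (suc zero) → t ; (suc (suc k)) → b
      (suc (suc k)) (s≤s (s≤s z≤n)) })
    (≋-sym (P.*-identityʳ (linear a)))

valueAt1-H : ∀ n → at1 (H (3 ℕ.+ n)) ≡ + valueAt1 (3 ℕ.+ n)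
valueAt1-H n = ≡.trans (eval-cong (+ 1) (≋-sym (⊛-identityˡ (H (3 ℕ.+ n))))) (at1-≡ (3 ℕ.+ n) (s≤s z≤n))

-- For n = 2 both polynomials are linear with discriminant 1, and the two factors are 2. For n ≥ 3
-- both have degree 2m, so one common sign ε stands before the resultants.
disc-transfer : ∀ n → 2 ℕ.≤ n → ∀ Ψ → Defs.IsFibotomic n Ψ → + valueAt1 n ℤ.* Defs.disc Ψ ≡ + (2 ℕ.^ Defs.φ n) ℤ.*
    Defs.disc (Defs.Φ n)
disc-transfer (suc zero) (s≤s ()) Ψ fib
disc-transfer (suc (suc zero)) _ Ψ fib = ≡.cong₂ ℤ._*_ (≡.cong +_ (valueAt1-prime-power 2 1 prime[2] (s≤s z≤n)))
  (≡.trans (disc-linear Ψ (IsMonic-cong (≋-sym (fibotomic-≋ 1 Ψ fib))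
      (≡.subst (λ k → IsMonic k (Psi 2)) (≡.cong (λ g → suc (g ℕ.+ g)) g≡0)
          (Factorization.Psi-monic (factorization 2 (s≤s z≤n))))))
    (≡.sym (disc-linear (Defs.Φ 2)
        (IsMonic-cong (≋-sym (Φ-≋ 1))
            (≡.subst (λ k → IsMonic k (Q 2)) (≡.cong (λ g → suc (g ℕ.+ g)) g≡0) (Q-monic 2 (s≤s z≤n)))))))
  where
  g≡0 : degG 2 ≡ 0
  -- φ(2) = 1 is equal to `degQ 2`, which is 1 plus twice `degG 2`.
  g≡0 = ℕP.m+n≡0⇒m≡0 (degG 2) (≡.sym (ℕP.suc-injective (φ-≡ 2 (s≤s z≤n))))
  disc-linear : ∀ p → IsMonic 1 p → Defs.disc p ≡ + 1
  disc-linear p m = ≡.trans (disc-≡ m) (≡.trans (ℤP.*-identityˡ _) (resultant-linear p m))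
disc-transfer n@(suc (suc (suc n′))) _ Ψ fib = transfer (degG n ℕ.+ degG n) ≡.refl
  where
  m = degG n
  G-monic′ : IsMonic m (G n)
  G-monic′ = Factorization.G-monic (factorization n (s≤s z≤n))
  Ψ≋ : Ψ ≋ sq (G n)
  Ψ≋ = ≋-trans (fibotomic-≋ (2 ℕ.+ n′) Ψ fib) (⊛-identityˡ _)
  Φ≋ : Defs.Φ n ≋ H n
  Φ≋ = ≋-trans (Φ-≋ (2 ℕ.+ n′)) (≋-trans (⊛-identityˡ _) (⊛-identityˡ _))
  Ψ-monic : IsMonic (m ℕ.+ m) Ψ
  Ψ-monic = IsMonic-cong (≋-sym Ψ≋) (sq-monic (G n) G-monic′)
  Φ-monic : IsMonic (m ℕ.+ m) (Defs.Φ n)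
  Φ-monic = IsMonic-cong (≋-sym Φ≋) (homog-monic m (coef (G n)) (leading≈1 G-monic′))
  power : ℤr.fromℤ (+ (4 ℕ.^ m)) ≡ + (2 ℕ.^ Defs.φ n)
  power = ≡.trans (fromℤ-≡ (4 ℕ.^ m)) (≡.cong +_ (≡.trans (ℕP.^-*-assoc 2 2 m)
    (≡.cong (2 ℕ.^_) (≡.trans (≡.cong (m ℕ.+_) (ℕP.+-identityʳ m)) (≡.sym (φ-≡ n (s≤s z≤n)))))))
  transfer : ∀ k → m ℕ.+ m ≡ k → + valueAt1 n ℤ.* Defs.disc Ψ ≡ + (2 ℕ.^ Defs.φ n) ℤ.* Defs.disc (Defs.Φ n)
  -- `disc-≡` needs a degree of the form `suc k`; the degree is φ(n), and φ(n) > 0.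
  transfer zero 2m≡0 = ⊥-elim (ℕP.<⇒≢ (φ-positive (2 ℕ.+ n′)) (≡.sym (≡.trans (φ-≡ n (s≤s z≤n)) 2m≡0)))
  transfer (suc k) 2m≡ = begin
    + valueAt1 n ℤ.* Defs.disc Ψ
      ≡⟨ ≡.cong (ℤ._*_ (+ valueAt1 n)) (≡.trans (disc-≡ (≡.subst (λ d → IsMonic d Ψ) 2m≡ Ψ-monic))
           (≡.cong (ℤ._*_ ε) (≡.trans (derivativeResultant-cong (suc k) Ψ≋)
               (≡.cong (λ d → derivativeResultant d (sq (G n))) (≡.sym 2m≡))))) ⟩
    + valueAt1 n ℤ.* (ε ℤ.* derivativeResultant (m ℕ.+ m) (sq (G n)))
      ≡⟨ ℤr.solve 3 (λ v e r → v ℤr.:* (e ℤr.:* r) ℤr.:= e ℤr.:* (r ℤr.:* v)) ≡.refl (+ valueAt1 n) ε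
          (derivativeResultant (m ℕ.+ m) (sq (G n))) ⟩
    ε ℤ.* (derivativeResultant (m ℕ.+ m) (sq (G n)) ℤ.* + valueAt1 n)
      ≡⟨ ≡.cong (λ v → ε ℤ.* (derivativeResultant (m ℕ.+ m) (sq (G n)) ℤ.* v)) (≡.sym (valueAt1-H n′)) ⟩
    ε ℤ.* (derivativeResultant (m ℕ.+ m) (sq (G n)) ℤ.* at1 (H n))
      ≡⟨ ≡.cong (ℤ._*_ ε) (≡.trans (derivativeResultant-transfer ℤR m (G n) G-monic′)
          (≡.cong (ℤ._* derivativeResultant (m ℕ.+ m) (H n)) power)) ⟩
    ε ℤ.* (+ (2 ℕ.^ Defs.φ n) ℤ.* derivativeResultant (m ℕ.+ m) (H n))
      ≡⟨ ℤr.solve 3 (λ v e r → e ℤr.:* (v ℤr.:* r) ℤr.:= v ℤr.:* (e ℤr.:* r)) ≡.refl (+ (2 ℕ.^ Defs.φ n)) ε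
          (derivativeResultant (m ℕ.+ m) (H n)) ⟩
    + (2 ℕ.^ Defs.φ n) ℤ.* (ε ℤ.* derivativeResultant (m ℕ.+ m) (H n))
      ≡⟨ ≡.cong (ℤ._*_ (+ (2 ℕ.^ Defs.φ n))) (≡.trans (disc-≡ (≡.subst (λ d → IsMonic d (Defs.Φ n)) 2m≡ Φ-monic))
           (≡.cong (ℤ._*_ ε) (≡.trans (derivativeResultant-cong (suc k) Φ≋)
               (≡.cong (λ d → derivativeResultant d (H n)) (≡.sym 2m≡))))) ⟨
    + (2 ℕ.^ Defs.φ n) ℤ.* Defs.disc (Defs.Φ n) ∎
    where
    open ≡.≡-Reasoning
    ε = Defs.signℕ ((suc k ℕ.* k) ℕ./ 2)

open import Defs using (Poly; IsFibotomic; disc; Φ; φ)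
open import Data.Nat using (_≤_; _^_)
open import Data.Integer using (_*_)

theorem4p1 : (n : ℕ) → 2 ≤ n → (Ψ : Poly) → IsFibotomic n Ψ →
    ((p α : ℕ) → Prime p → 1 ≤ α → n ≡ p ^ α →
    (+ p) * disc Ψ ≡ (+ (2 ^ φ n)) * disc (Φ n))
    ×
    (¬ (∃ λ p → ∃ λ α → Prime p × 1 ≤ α × n ≡ p ^ α) →
    disc Ψ ≡ (+ (2 ^ φ n)) * disc (Φ n))
theorem4p1 n 2≤n Ψ fib =
  (λ p α pp 1≤α n≡ → ≡.trans
    (≡.cong (λ v → + v * disc Ψ) (≡.sym (≡.trans (≡.cong valueAt1 n≡) (valueAt1-prime-power p α pp 1≤α))))
    (disc-transfer n 2≤n Ψ fib)) ,
  λ npp → ≡.trans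
    (≡.sym (≡.trans (≡.cong (λ v → + v * disc Ψ) (valueAt1-other n 2≤n npp)) (ℤP.*-identityˡ (disc Ψ))))
    (disc-transfer n 2≤n Ψ fib)
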